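{- For any $\epsilon>0$, $\delta\in(0,1)$, and $n\in\mathbb{N}$, there exists a (randomized) streaming algorithm which, for any insertion-only stream over $[n]$ with frequencies $f^{(1)},f^{(2)},\dots,f^{(m)}$, provides $\ell_2$ $(\epsilon,\delta)$-weak tracking, uses space $O(\epsilon^{ -2}\log(1/\delta))$ words, and has update time $O(\log(1/\delta))$.
   Context: $[n]=\{1,\dots,n\}$. An insertion-only stream over $[n]$ of length $m$ is a fixed list $a_1,\dots,a_m\in[n]$; its frequency vector at time $t\in[m]$ is $f^{(t)}\in\mathbb{R}^n$ with $f^{(t)}_i=|\{1\le j\le t: a_j=i\}|$. A streaming algorithm reads $a_1,a_2,\dots,a_m$ once, in order, and after reading $a_t$ outputs an estimate $\sigma_t\in\mathbb{R}$. It provides $\ell_2$ $(\epsilon,\delta)$-weak tracking on the stream if $$\Pr\left[\exists\, t\in[m]:\ \bigl|\sigma_t-\|f^{(t)}\|_2^2\bigr|>\epsilon\|f^{(m)}\|_2^2\right]\le\delta,$$ the probability being over the algorithm's internal randomness (the stream is fixed independently of it). Space is the number of machine words used (including the storage of the random hash functions), where a machine word has at least $\Omega(\max(\log n,\log m))$ bits. Update time is the number of arithmetic operations needed to update the memory and the estimate $\sigma_t$ upon the arrival of one stream item. Constants hidden in $O(\cdot)$ are absolute; as usual, each factor inside $O(\cdot)$ (such as $\epsilon^{ -2}$, $\log(1/\delta)$) is read as $\max\{1,\text{factor}\}$. -}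

module Defs where

open import Data.Nat.Base as ℕ using (ℕ; zero; suc)
open import Data.Nat.DivMod using (_/_; _%_; _mod_)
open import Data.Nat.Properties using (m^n≢0; _<?_; _≟_)
open import Data.Integer.Base as ℤ using (+_)
open import Data.Rational as ℚ using (ℚ; 0ℚ; 1ℚ; _<_; _≤_; _*_; _-_; ∣_∣; ↥_; ↧ₙ_; +-*-rawSemiring)
open import Algebra.Definitions.RawSemiring +-*-rawSemiring using (_^_)
open import Data.Fin.Base using (Fin; toℕ)
import Data.Fin.Properties as Fin
open import Data.Vec.Base as Vec using (Vec; lookup; _[_]≔_)
import Data.Vec.Relation.Unary.All as VecAll
open import Data.List.Base as List using (List; []; _∷_; length; filter; take; allFin)
open import Data.List.Relation.Unary.All using (All)
open import Data.List.Relation.Unary.Unique.Propositional using (Unique)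
open import Data.Product.Base using (∃; ∃₂; _×_)
open import Data.Sum.Base using (_⊎_)
open import Data.Bool.Base using (if_then_else_)
open import Relation.Nullary using (¬_; does)
open import Relation.Binary.PropositionalEquality using (_≡_; _≢_)

fromℕ : ℕ → ℚ
fromℕ k = + k ℚ./ 1

------------------------------------------------------------------------
-- Real numbers

-- Two-sided Dedekind cuts: `lower q` is q < x and `upper q` is x < q.
record ℝ : Set₁ where
  field
    lower upper   : ℚ → Set
    lower-inhab   : ∃ lower
    upper-inhab   : ∃ upper
    lower-closed  : ∀ {p q} → p < q → lower q → lower p
    upper-closed  : ∀ {p q} → p < q → upper p → upper q
    lower-open    : ∀ {p} → lower p → ∃ λ q → p < q × lower q
    upper-open    : ∀ {q} → upper q → ∃ λ p → p < q × upper p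
    disjoint      : ∀ {q} → lower q → ¬ upper q
    located       : ∀ {p q} → p < q → lower p ⊎ upper q

infix 4 _<ᴿ_ _ᴿ<_ _·_<_

_<ᴿ_ : ℚ → ℝ → Set
q <ᴿ x = ℝ.lower x q

_ᴿ<_ : ℝ → ℚ → Set
x ᴿ< q = ℝ.upper x q

-- x · k < y, for a real x, a natural number k and a rational y.
_·_<_ : ℝ → ℕ → ℚ → Set
x · k < y = ∃ λ q → x ᴿ< q × q * fromℕ k < y

-- The bounds inside O(·) occur only on the right of ≤, so such a real is
-- represented by its upper cut: U q means that the real is < q.
UpperReal : Set₁
UpperReal = ℚ → Set

-- For ε > 0: 1/ε² < a iff 1 < a q² for some rational 0 < q < ε.
_⁻² : ℝ → UpperReal
(ε ⁻²) a = ∃ λ q → 0ℚ < q × q <ᴿ ε × 1ℚ < a * (q * q)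

-- For 0 < δ < 1: log₂ (1/δ) < p/d iff 1 < 2ᵖ qᵈ for some rational 0 < q < δ.
log₂[1/_] : ℝ → UpperReal
log₂[1/ δ ] b = 0ℚ < b × ∃ λ q →
  0ℚ < q × q <ᴿ δ × 1ℚ < fromℕ (2 ℕ.^ ℤ.∣ ↥ b ∣) * (q ^ (↧ₙ b))

max1 : UpperReal → UpperReal
max1 U a = 1ℚ < a × U a

-- Product of positive reals.
infixl 7 _⊗_
_⊗_ : UpperReal → UpperReal → UpperReal
(U ⊗ V) c = ∃₂ λ a b → U a × V b × a * b ≤ c

-- k is at most C times the real represented by U.
infix 4 _≤_∙_
_≤_∙_ : ℕ → ℕ → UpperReal → Set
k ≤ C ∙ U = ∀ c → U c → fromℕ k ≤ fromℕ C * c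

------------------------------------------------------------------------
-- Word RAM with `S` cells of `w` bits each

data Op : Set where
  add sub mul div mod lt eq : Op

-- `at i` is the cell whose address is stored in cell i.
data Addr (S : ℕ) : Set where
  cell at : Fin S → Addr S

data Operand (S : ℕ) : Set where
  const : ℕ → Operand S
  read  : Addr S → Operand S

infix  5 _≔_⟨_⟩_
infixr 4 _⨾_

data Cmd (S : ℕ) : Set where
  skip    : Cmd S
  _≔_⟨_⟩_ : Addr S → Operand S → Op → Operand S → Cmd S
  _⨾_     : Cmd S → Cmd S → Cmd S
  if      : Operand S → Cmd S → Cmd S → Cmd S
  while   : Operand S → Cmd S → Cmd S

-- Number of words needed to store a program, up to a constant factor.
size : ∀ {S} → Cmd S → ℕ
size skip            = 1
size (_ ≔ _ ⟨ _ ⟩ _) = 1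
size (c ⨾ c′)        = suc (size c ℕ.+ size c′)
size (if _ c c′)     = suc (size c ℕ.+ size c′)
size (while _ c)     = suc (size c)

module Machine (w : ℕ) where

  Word : Set
  Word = Fin (2 ℕ.^ w)

  word : ℕ → Word
  word k = _mod_ k (2 ℕ.^ w) {{m^n≢0 2 w}}

  Mem : ℕ → Set
  Mem S = Vec Word S

  -- All results are reduced modulo 2ʷ; dividing by 0 gives 0.
  ⟦_⟧ : Op → Word → Word → Word
  ⟦ op ⟧ x y = word (go op (toℕ x) (toℕ y))
    where
    go : Op → ℕ → ℕ → ℕ
    go add a b       = a ℕ.+ b
    go sub a b       = a ℕ.+ (2 ℕ.^ w ℕ.∸ b)
    go mul a b       = a ℕ.* b
    go div a zero    = 0
    go div a (suc b) = a / suc b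
    go mod a zero    = 0
    go mod a (suc b) = a % suc b
    go lt  a b       = if does (a <? b) then 1 else 0
    go eq  a b       = if does (a ≟ b) then 1 else 0

  -- An out-of-range address has no resolution, so the machine gets stuck.
  data _⊢_↦_ {S} (M : Mem S) : Addr S → Fin S → Set where
    cell : ∀ {i} → M ⊢ cell i ↦ i
    at   : ∀ {i j} → toℕ (lookup M i) ≡ toℕ j → M ⊢ at i ↦ j

  data _⊢_⇒_ {S} (M : Mem S) : Operand S → Word → Set where
    const : ∀ {k} → M ⊢ const k ⇒ word k
    read  : ∀ {a i} → M ⊢ a ↦ i → M ⊢ read a ⇒ lookup M i

  -- ⟨ c , M ⟩⇓⟨ k , M′ ⟩: started in memory M, the command c terminates in
  -- memory M′ after k operations.  Each assignment and each test counts as one.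
  data ⟨_,_⟩⇓⟨_,_⟩ {S} : Cmd S → Mem S → ℕ → Mem S → Set where
    skip : ∀ {M} → ⟨ skip , M ⟩⇓⟨ 0 , M ⟩
    assign : ∀ {M d a o b i x y} →
      M ⊢ d ↦ i → M ⊢ a ⇒ x → M ⊢ b ⇒ y →
      ⟨ d ≔ a ⟨ o ⟩ b , M ⟩⇓⟨ 1 , M [ i ]≔ ⟦ o ⟧ x y ⟩
    seq : ∀ {M M′ M″ c c′ k l} →
      ⟨ c , M ⟩⇓⟨ k , M′ ⟩ → ⟨ c′ , M′ ⟩⇓⟨ l , M″ ⟩ →
      ⟨ c ⨾ c′ , M ⟩⇓⟨ k ℕ.+ l , M″ ⟩
    if-true : ∀ {M M′ a x c c′ k} →
      M ⊢ a ⇒ x → toℕ x ≢ 0 → ⟨ c , M ⟩⇓⟨ k , M′ ⟩ →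
      ⟨ if a c c′ , M ⟩⇓⟨ suc k , M′ ⟩
    if-false : ∀ {M M′ a x c c′ k} →
      M ⊢ a ⇒ x → toℕ x ≡ 0 → ⟨ c′ , M ⟩⇓⟨ k , M′ ⟩ →
      ⟨ if a c c′ , M ⟩⇓⟨ suc k , M′ ⟩
    while-true : ∀ {M M′ M″ a x c k l} →
      M ⊢ a ⇒ x → toℕ x ≢ 0 →
      ⟨ c , M ⟩⇓⟨ k , M′ ⟩ → ⟨ while a c , M′ ⟩⇓⟨ l , M″ ⟩ →
      ⟨ while a c , M ⟩⇓⟨ suc (k ℕ.+ l) , M″ ⟩
    while-false : ∀ {M a x c} →
      M ⊢ a ⇒ x → toℕ x ≡ 0 →
      ⟨ while a c , M ⟩⇓⟨ 1 , M ⟩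

------------------------------------------------------------------------
-- Streams

Stream : ℕ → Set
Stream n = List (Fin n)

-- The items of [n] are represented by 0 , … , n − 1.
frequency : ∀ {n} → Stream n → Fin n → ℕ
frequency as i = length (filter (Fin._≟ i) as)

‖_‖² : ∀ {n} → (Fin n → ℕ) → ℕ
‖_‖² {n} f = List.sum (List.map (λ i → f i ℕ.^ 2) (allFin n))

-- ‖ f⁽ᵗ⁾ ‖², for t at most the length of the stream.
F₂ : ∀ {n} → Stream n → ℕ → ℕ
F₂ as t = ‖ frequency (take t as) ‖²

------------------------------------------------------------------------
-- Randomized streaming algorithms

-- Initially cell i holds a uniformly random element of {0 , … , bᵢ}, with
-- bᵢ = lookup random i, independently of the other cells.  All random bits
-- are thus stored in memory.  After `setup`, each item is written to the
-- cell `item` and processed by `update`; the estimate is then the quotient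
-- of the cells `num` and `den`.  The length of the stream and the word size
-- are not known to the algorithm.
record Algorithm : Set where
  field
    cells        : ℕ
    random       : Vec ℕ cells
    setup update : Cmd cells
    item num den : Fin cells

open Algorithm public

-- The program is charged for, since it may depend on n, ε and δ.
space : Algorithm → ℕ
space A = cells A ℕ.+ (size (setup A) ℕ.+ size (update A))

Seed : Algorithm → Set
Seed A = VecAll.All (λ b → Fin (suc b)) (random A)

#seeds : Algorithm → ℕ
#seeds A = List.product (List.map suc (Vec.toList (random A)))

quotient : ℕ → ℕ → ℚ
quotient a zero    = 0ℚ
quotient a (suc b) = + a ℚ./ suc b

-- Execution of A on a machine with w-bit words.
module Execution (A : Algorithm) (w : ℕ) where

  open Machine w

  -- No duplicate-free list of seeds satisfying E has more than δ · #seeds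
  -- elements.  This makes sense also when E is not decidable.
  Pr[_]≤_ : (Seed A → Set) → ℝ → Set
  Pr[ E ]≤ δ = ∀ (bad : List (Seed A)) → Unique bad → All E bad →
    ¬ (δ · #seeds A < fromℕ (length bad))

  estimate : Mem (cells A) → ℚ
  estimate M = quotient (toℕ (lookup M (num A))) (toℕ (lookup M (den A)))

  initial : Seed A → Mem (cells A)
  initial = VecAll.reduce (λ r → word (toℕ r))

  -- Run M as ks M′: reading the items as leads from memory M to M′, and ks
  -- lists the number of operations spent on each item.
  data Run {n} (M : Mem (cells A)) : Stream n → List ℕ → Mem (cells A) → Set where
    []  : Run M [] [] M
    _∷_ : ∀ {a as k ks M′ M″} →
      ⟨ update A , M [ item A ]≔ word (toℕ a) ⟩⇓⟨ k , M′ ⟩ →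
      Run M′ as ks M″ → Run M (a ∷ as) (k ∷ ks) M″

  RunFromStart : ∀ {n} → Seed A → Stream n → List ℕ → Mem (cells A) → Set
  RunFromStart s as ks M =
    ∃₂ λ k M₀ → ⟨ setup A , initial s ⟩⇓⟨ k , M₀ ⟩ × Run M₀ as ks M

  -- Whatever the seed, the algorithm processes the whole stream, with at most
  -- T operations per item.
  UpdateTime : ∀ {n} → Stream n → ℕ → Set
  UpdateTime as T = ∀ (s : Seed A) →
    ∃₂ λ ks M → RunFromStart s as ks M × All (ℕ._≤ T) ks

  -- The execution is deterministic, so there is at most one M for each seed s
  -- and time t.
  WeakTracking : ∀ {n} → ℝ → ℝ → Stream n → Set
  WeakTracking ε δ as = Pr[ Fails ]≤ δ
    where
    Fails : Seed A → Set
    Fails s = ∃ λ t → 1 ℕ.≤ t × t ℕ.≤ length as ×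
      ∃₂ λ ks M → RunFromStart s (take t as) ks M ×
      ε · F₂ as (length as) < ∣ estimate M - fromℕ (F₂ as t) ∣

-- The word size is at least c · max(1 , log₂ n , log₂ m).
LongWords : (c n m w : ℕ) → Set
LongWords c n m w = (2 ℕ.⊔ n ℕ.⊔ m) ℕ.^ c ℕ.≤ 2 ℕ.^ w

{-# OPTIONS --safe #-}

-- Each of 2ᵏ ≥ log₂ (1/δ) + O(1) independent copies keeps, for O(ε⁻²) buckets, the signed number of its items, and the sum of
-- the squares of these numbers; signs and buckets are the leading bits of polynomials over ℤ/2ᴷ of degrees 7 and 1.  Adding a
-- multiple of ∏ (X − y) to such a polynomial keeps its values at the y and moves its value elsewhere, so the signs are 8-wise
-- independent and the buckets collide no more often than random ones.
--
-- The error of a copy is a quadratic form in the signs whose coefficients grow with the stream.  The fourth moment of an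
-- increment is at most a constant times the square of the increase of its variance; cutting time where half of the variance
-- has been spent turns this into a bound on the maximum over all times, without a logarithmic loss.  A copy is thus wrong at
-- some time with probability at most 2⁻³², and more than a sixteenth of the copies are bad with probability at most δ.
--
-- A network of linear size combines the copies: each stage halves their number, every output being a tree of medians of three
-- inputs, and a random wiring preserves the bound of a sixteenth for all sets of bad inputs at once.  A median of three values
-- lies in every interval that contains two of them, so the value that remains is good.  If there are fewer items than
-- counters, one copy without signs and with a bucket for each item is exact.

module Submission where

open import Defs hiding (add; sub; mul; div; mod; lt; eq; const; read; cell; at; skip; if; while)
open import Level using (Level; 0ℓ)
open import Function.Base using (_∘_; id; case_of_)
open import Data.Bool.Base using (Bool; true; false; _∧_; _∨_; if_then_else_; T)
open import Data.Empty using (⊥)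
open import Data.Unit.Base using (⊤; tt)
open import Data.Product.Base using (∃; ∃₂; _×_; _,_; proj₁; proj₂)
open import Data.Sum.Base using (_⊎_; inj₁; inj₂; [_,_]′)
open import Data.Nat.Base
open import Data.Nat.Properties
open import Data.Nat.DivMod
open import Data.Nat.Divisibility using (_∣_; divides; ∣-refl)
import Data.Nat.Tactic.RingSolver as ℕ-Solver
open import Data.Integer.Base as ℤ using (ℤ; ∣_∣; 0ℤ; 1ℤ) renaming (+_ to pos;
  _+_ to infixl 6 _+ᶻ_; _*_ to infixl 7 _*ᶻ_; _-_ to infixl 6 _-ᶻ_; -_ to infix 8 -ᶻ_; _≤_ to infix 4 _≤ᶻ_)
import Data.Integer.Properties as ℤₚ
import Data.Integer.Tactic.RingSolver as ℤ-Solver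
open import Data.Fin.Base as Fin using (Fin; zero; suc; toℕ)
import Data.Fin.Properties as Finₚ
open import Data.List.Base as List using (List; []; _∷_; length; map; _++_; cartesianProductWith; downFrom)
import Data.List.Properties as Listₚ
open import Data.List.Membership.Propositional using (_∈_)
open import Data.List.Membership.Propositional.Properties using (∈-cartesianProductWith⁺)
open import Data.List.Relation.Unary.Any using (here; there)
open import Data.List.Relation.Unary.All as All using (All; []; _∷_)
open import Data.Vec.Base as Vec using (Vec; []; _∷_; lookup; replicate; _[_]≔_)
import Data.List.Relation.Unary.All.Properties as Allₚ
open import Data.List.Relation.Unary.Unique.Propositional using (Unique)
open import Data.List.Relation.Unary.AllPairs using ([]; _∷_)
import Data.List.Relation.Unary.Unique.Propositional.Properties as Uniqueₚ
import Data.Vec.Properties as Vecₚ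
import Data.Vec.Relation.Unary.All as VecAll
import Data.Vec.Relation.Unary.All.Properties as VecAllₚ
open import Relation.Binary.Definitions using (tri<; tri≈; tri>)
open import Relation.Nullary using (¬_; Dec; yes; no; contradiction)
open import Relation.Binary.PropositionalEquality
open import Algebra.Bundles using (CommutativeSemiring)
import Algebra.Properties.Group as Group
open import Data.Rational.Base as ℚ using (ℚ; 0ℚ; 1ℚ) renaming
  (_+_ to infixl 6 _+ℚ_; _*_ to infixl 7 _*ℚ_; _-_ to infixl 6 _-ℚ_; _≤_ to infix 4 _≤ℚ_; _<_ to infix 4 _<ℚ_)
import Data.Rational.Properties as ℚₚ
import Data.Rational.Unnormalised.Base as ℚᵘ
import Data.Rational.Unnormalised.Properties as ℚᵘₚ
import Data.Rational.Solver as ℚ-Solver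
import Data.Nat.Coprimality as Coprimality
open import Algebra.Definitions.RawSemiring ℚ.+-*-rawSemiring using () renaming (_^_ to infixr 8 _^ℚ_)

-- The program is charged for, so the update is straight-line code whose length is its running time
-- and, up to a factor, its size. Sorting the copies would cost more than linear time; hence the
-- fixed network, whose wiring only has to exist. It must work for every set of bad copies, because
-- that set depends on the seed and the wiring does not. A modulus that is a power of two needs no
-- prime and lets word arithmetic overflow freely. The price is that a difference j - y need not be
-- invertible: the modulus has to absorb the powers of two in up to seven such factors, and only
-- leading bits are read. Eight-wise independence is what the fourth moment of a form of degree two
-- requires. A second moment would not do: the two halves of an interval together keep all of the
-- variance, but only half of its square, and this slack pays for joining them. The word size
-- depends on n and on the length of the stream but not on ε and δ. The sketch is therefore used
-- only if its buckets number at most n, so that addresses fit into words; otherwise exact counting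
-- is affordable.

-- Finite sums and elementary inequalities

module Summation (R : CommutativeSemiring 0ℓ 0ℓ) where

  open CommutativeSemiring R using (Carrier; 0#; _≈_)
    renaming (_+_ to _⊕_; _*_ to _⊛_)
  private module R = CommutativeSemiring R
  open import Algebra.Properties.CommutativeSemigroup R.+-commutativeSemigroup using (interchange)

  ∑ : ∀ {a} {A : Set a} → List A → (A → Carrier) → Carrier
  ∑ []       f = 0#
  ∑ (x ∷ xs) f = f x ⊕ ∑ xs f

  module _ {a : Level} {A : Set a} where

    ∑-cong : (xs : List A) {f g : A → Carrier} → (∀ x → f x ≈ g x) → ∑ xs f ≈ ∑ xs g
    ∑-cong []       eq = R.refl
    ∑-cong (x ∷ xs) eq = R.+-cong (eq x) (∑-cong xs eq)

    ∑-zero : (xs : List A) → ∑ xs (λ _ → 0#) ≈ 0#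
    ∑-zero []       = R.refl
    ∑-zero (x ∷ xs) = R.trans (R.+-identityˡ _) (∑-zero xs)

    ∑-+ : (xs : List A) (f g : A → Carrier) → ∑ xs (λ x → f x ⊕ g x) ≈ ∑ xs f ⊕ ∑ xs g
    ∑-+ []       f g = R.sym (R.+-identityˡ _)
    ∑-+ (x ∷ xs) f g = R.trans (R.+-cong R.refl (∑-+ xs f g)) (interchange _ _ _ _)

    ∑-*ˡ : (xs : List A) (c : Carrier) (f : A → Carrier) → ∑ xs (λ x → c ⊛ f x) ≈ c ⊛ ∑ xs f
    ∑-*ˡ []       c f = R.sym (R.zeroʳ c)
    ∑-*ˡ (x ∷ xs) c f = R.trans (R.+-cong R.refl (∑-*ˡ xs c f)) (R.sym (R.distribˡ c _ _))

    ∑-*ʳ : (xs : List A) (f : A → Carrier) (c : Carrier) → ∑ xs (λ x → f x ⊛ c) ≈ ∑ xs f ⊛ c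
    ∑-*ʳ []       f c = R.sym (R.zeroˡ c)
    ∑-*ʳ (x ∷ xs) f c = R.trans (R.+-cong R.refl (∑-*ʳ xs f c)) (R.sym (R.distribʳ c _ _))

    ∑-++ : (xs ys : List A) (f : A → Carrier) → ∑ (xs ++ ys) f ≈ ∑ xs f ⊕ ∑ ys f
    ∑-++ []       ys f = R.sym (R.+-identityˡ _)
    ∑-++ (x ∷ xs) ys f = R.trans (R.+-cong R.refl (∑-++ xs ys f)) (R.sym (R.+-assoc _ _ _))

    ∑-map : ∀ {b} {B : Set b} (h : B → A) (xs : List B) (f : A → Carrier) →
            ∑ (map h xs) f ≈ ∑ xs (λ x → f (h x))
    ∑-map h []       f = R.refl
    ∑-map h (x ∷ xs) f = R.+-cong R.refl (∑-map h xs f)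

    ∑-swap : ∀ {b} {B : Set b} (xs : List A) (ys : List B) (f : A → B → Carrier) →
             ∑ xs (λ x → ∑ ys (f x)) ≈ ∑ ys (λ y → ∑ xs (λ x → f x y))
    ∑-swap []       ys f = R.sym (aux ys)
      where
      aux : ∀ {b} {B : Set b} (ys : List B) → ∑ ys (λ _ → 0#) ≈ 0#
      aux []       = R.refl
      aux (y ∷ ys) = R.trans (R.+-identityˡ _) (aux ys)
    ∑-swap (x ∷ xs) ys f = R.trans (R.+-cong R.refl (∑-swap xs ys f)) (R.sym (aux ys))
      where
      aux : ∀ ys → ∑ ys (λ y → f x y ⊕ ∑ xs (λ x → f x y)) ≈
                   ∑ ys (f x) ⊕ ∑ ys (λ y → ∑ xs (λ x → f x y))
      aux []       = R.sym (R.+-identityˡ _)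
      aux (y ∷ ys) = R.trans (R.+-cong R.refl (aux ys)) (interchange _ _ _ _)

  ∑-product : ∀ {a b c} {A : Set a} {B : Set b} {C : Set c} (h : A → B → C)
              (xs : List A) (ys : List B) (f : C → Carrier) →
              ∑ (cartesianProductWith h xs ys) f ≈ ∑ xs (λ x → ∑ ys (λ y → f (h x y)))
  ∑-product h []       ys f = R.refl
  ∑-product h (x ∷ xs) ys f = R.trans (∑-++ (map (h x) ys) _ f)
    (R.+-cong (∑-map (h x) ys f) (∑-product h xs ys f))

  ∑-cong< : ∀ n {f g : ℕ → Carrier} → (∀ i → i < n → f i ≈ g i) → ∑ (downFrom n) f ≈ ∑ (downFrom n) g
  ∑-cong< zero    eq = R.refl
  ∑-cong< (suc n) eq = R.+-cong (eq n ≤-refl) (∑-cong< n (λ i i<n → eq i (m<n⇒m<1+n i<n)))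

  -- Both sides are the sum of `h` over 0, ..., `n`. It shifts a sum along a full period by one and,
  -- in `∑-tabulate`, reverses the order of summation.
  ∑-rotate : ∀ n (h : ℕ → Carrier) → ∑ (downFrom n) (λ x → h (suc x)) ⊕ h 0 ≈ h n ⊕ ∑ (downFrom n) h
  ∑-rotate zero    h = R.+-comm 0# (h 0)
  ∑-rotate (suc n) h = R.trans (R.+-assoc (h (suc n)) _ (h 0)) (R.+-cong R.refl (∑-rotate n h))

open Summation +-*-commutativeSemiring public
open Summation ℤₚ.+-*-commutativeSemiring public using () renaming
  ( ∑ to ∑ᶻ; ∑-cong to ∑ᶻ-cong; ∑-zero to ∑ᶻ-zero; ∑-+ to ∑ᶻ-+; ∑-*ˡ to ∑ᶻ-*ˡ; ∑-*ʳ to ∑ᶻ-*ʳ; ∑-swap to ∑ᶻ-swap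
  ; ∑-product to ∑ᶻ-product; ∑-cong< to ∑ᶻ-cong<; ∑-rotate to ∑ᶻ-rotate)

∑-mono : ∀ {a} {A : Set a} (xs : List A) {f g : A → ℕ} → (∀ x → f x ≤ g x) → ∑ xs f ≤ ∑ xs g
∑-mono []       le = z≤n
∑-mono (x ∷ xs) le = +-mono-≤ (le x) (∑-mono xs le)

∑-mono< : ∀ n {f g : ℕ → ℕ} → (∀ i → i < n → f i ≤ g i) → ∑ (downFrom n) f ≤ ∑ (downFrom n) g
∑-mono< zero    le = z≤n
∑-mono< (suc n) le = +-mono-≤ (le n ≤-refl) (∑-mono< n (λ i i<n → le i (m<n⇒m<1+n i<n)))

∑-const : ∀ {a} {A : Set a} (xs : List A) c → ∑ xs (λ _ → c) ≡ length xs * c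
∑-const []       c = refl
∑-const (x ∷ xs) c = cong (c +_) (∑-const xs c)

∑-term : ∀ {a} {A : Set a} {xs : List A} (f : A → ℕ) {x} → x ∈ xs → f x ≤ ∑ xs f
∑-term f (here refl) = m≤m+n _ _
∑-term f (there x∈)  = ≤-trans (∑-term f x∈) (m≤n+m _ _)

∈-downFrom : ∀ {n x} → x < n → x ∈ downFrom n
∈-downFrom {suc n} {x} (s≤s le) with m≤n⇒m<n∨m≡n le
... | inj₁ x<n  = there (∈-downFrom x<n)
... | inj₂ refl = here refl

∑ᶻ-pos : ∀ {a} {A : Set a} (xs : List A) (f : A → ℕ) → ∑ᶻ xs (λ x → pos (f x)) ≡ pos (∑ xs f)
∑ᶻ-pos []       f = refl
∑ᶻ-pos (x ∷ xs) f = cong (pos (f x) +ᶻ_) (∑ᶻ-pos xs f)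

-- The probabilistic method: with `f` counting failures, a mean below one leaves a point without
-- any. It yields the wiring of the network.
∑<length⇒∃0 : ∀ {a} {A : Set a} (xs : List A) (f : A → ℕ) → ∑ xs f < length xs → ∃ λ x → x ∈ xs × f x ≡ 0
∑<length⇒∃0 []       f ()
∑<length⇒∃0 (x ∷ xs) f lt with f x in eq
... | zero  = x , here refl , eq
... | suc k with ∑<length⇒∃0 xs f (≤-trans (s≤s (m≤n+m _ k)) (s≤s⁻¹ lt))
... | y , y∈ , e = y , there y∈ , e

4xy≤ : ∀ x y → 4 * (x * y) ≤ (x + y) * (x + y)
4xy≤ x y with ≤-total x y
... | inj₁ x≤y with d , refl ← m≤n⇒∃[o]m+o≡n x≤y = subst (4 * (x * (x + d)) ≤_) (p x d) (m≤m+n _ (d * d))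
  where
  p : ∀ x d → 4 * (x * (x + d)) + d * d ≡ (x + (x + d)) * (x + (x + d))
  p = ℕ-Solver.solve-∀
... | inj₂ y≤x with d , refl ← m≤n⇒∃[o]m+o≡n y≤x = subst (4 * ((y + d) * y) ≤_) (p y d) (m≤m+n _ (d * d))
  where
  p : ∀ y d → 4 * ((y + d) * y) + d * d ≡ (y + d + y) * (y + d + y)
  p = ℕ-Solver.solve-∀

-- Only the cross term 2 S a b needs an argument: its square is at most 4 A B a² b² by the
-- hypothesis, and AM-GM bounds this by the square of A b² + a² B. Comparing squares avoids a square
-- root.
cauchy-schwarz-step : ∀ {S A B} a b → S * S ≤ A * B → (S + a * b) * (S + a * b) ≤ (A + a * a) * (B + b * b)
cauchy-schwarz-step {S} {A} {B} a b h = begin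
  (S + a * b) * (S + a * b)                       ≡⟨ e₁ S a b ⟩
  S * S + 2 * (S * (a * b)) + a * b * (a * b)     ≤⟨ +-monoˡ-≤ _ (+-mono-≤ h mid) ⟩
  A * B + (A * (b * b) + a * a * B) + a * b * (a * b) ≡⟨ e₂ A B a b ⟩
  (A + a * a) * (B + b * b)                       ∎
  where
  open ≤-Reasoning
  e₁ : ∀ S a b → (S + a * b) * (S + a * b) ≡ S * S + 2 * (S * (a * b)) + a * b * (a * b)
  e₁ = ℕ-Solver.solve-∀
  e₂ : ∀ A B a b → A * B + (A * (b * b) + a * a * B) + a * b * (a * b) ≡ (A + a * a) * (B + b * b)
  e₂ = ℕ-Solver.solve-∀
  mid : 2 * (S * (a * b)) ≤ A * (b * b) + a * a * B
  mid = ≮⇒≥ λ lt → <⇒≱ (*-mono-< lt lt) (begin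
    2 * (S * (a * b)) * (2 * (S * (a * b))) ≡⟨ q₁ S a b ⟩
    4 * (S * S * (a * b * (a * b)))         ≤⟨ *-monoʳ-≤ 4 (*-monoˡ-≤ (a * b * (a * b)) h) ⟩
    4 * (A * B * (a * b * (a * b)))         ≡⟨ q₂ A B a b ⟩
    4 * (A * (b * b) * (a * a * B))         ≤⟨ 4xy≤ (A * (b * b)) (a * a * B) ⟩
    (A * (b * b) + a * a * B) * (A * (b * b) + a * a * B) ∎)
    where
    q₁ : ∀ S a b → 2 * (S * (a * b)) * (2 * (S * (a * b))) ≡ 4 * (S * S * (a * b * (a * b)))
    q₁ = ℕ-Solver.solve-∀
    q₂ : ∀ A B a b → 4 * (A * B * (a * b * (a * b))) ≡ 4 * (A * (b * b) * (a * a * B))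
    q₂ = ℕ-Solver.solve-∀

cauchy-schwarz : ∀ {a} {A : Set a} (xs : List A) (f g : A → ℕ) →
  ∑ xs (λ x → f x * g x) * ∑ xs (λ x → f x * g x) ≤ ∑ xs (λ x → f x * f x) * ∑ xs (λ x → g x * g x)
cauchy-schwarz []       f g = z≤n
cauchy-schwarz (x ∷ xs) f g =
  subst₂ _≤_ (cong₂ _*_ (+-comm S _) (+-comm S _)) (cong₂ _*_ (+-comm A _) (+-comm B _))
    (cauchy-schwarz-step {S} {A} {B} (f x) (g x) (cauchy-schwarz xs f g))
  where
  S = ∑ xs (λ x → f x * g x)
  A = ∑ xs (λ x → f x * f x)
  B = ∑ xs (λ x → g x * g x)

square-cancel-≤ : ∀ {m n} → m * m ≤ n * n → m ≤ n
square-cancel-≤ h = ≮⇒≥ λ lt → <⇒≱ (*-mono-< lt lt) h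

-- Counting in product spaces

tuples : ∀ {a} {A : Set a} (n : ℕ) → List A → List (Vec A n)
tuples zero    xs = [] ∷ []
tuples (suc n) xs = cartesianProductWith _∷_ xs (tuples n xs)

∑-tuples-suc : ∀ {a} {A : Set a} n (xs : List A) (f : Vec A (suc n) → ℕ) →
  ∑ (tuples (suc n) xs) f ≡ ∑ xs (λ x → ∑ (tuples n xs) (λ v → f (x ∷ v)))
∑-tuples-suc n xs f = ∑-product _∷_ xs (tuples n xs) f

length≡∑1 : ∀ {a} {A : Set a} (xs : List A) → length xs ≡ ∑ xs (λ _ → 1)
length≡∑1 xs = sym (trans (∑-const xs 1) (*-identityʳ _))

length-tuples : ∀ {a} {A : Set a} n (xs : List A) → length (tuples n xs) ≡ length xs ^ n
length-tuples zero    xs = refl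
length-tuples (suc n) xs = begin
  length (tuples (suc n) xs)           ≡⟨ length≡∑1 (tuples (suc n) xs) ⟩
  ∑ (tuples (suc n) xs) (λ _ → 1)      ≡⟨ ∑-tuples-suc n xs _ ⟩
  ∑ xs (λ _ → ∑ (tuples n xs) (λ _ → 1)) ≡⟨ ∑-const xs _ ⟩
  length xs * ∑ (tuples n xs) (λ _ → 1) ≡⟨ cong (length xs *_) (trans (sym (length≡∑1 (tuples n xs))) (length-tuples n xs)) ⟩
  length xs ^ suc n                    ∎
  where open ≡-Reasoning

∈-tuples : ∀ {a} {A : Set a} {xs : List A} {n} (v : Vec A n) → (∀ i → lookup v i ∈ xs) → v ∈ tuples n xs
∈-tuples []      h = here refl
∈-tuples (x ∷ v) h = ∈-cartesianProductWith⁺ _∷_ (h zero) (∈-tuples v (λ i → h (suc i)))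

𝟙 : Bool → ℕ
𝟙 false = 0
𝟙 true  = 1

𝟙≤1 : ∀ b → 𝟙 b ≤ 1
𝟙≤1 false = z≤n
𝟙≤1 true  = ≤-refl

#true : ∀ {n} → Vec Bool n → ℕ
#true []      = 0
#true (b ∷ v) = 𝟙 b + #true v

-- The indicator that more than a sixteenth of the entries are true. Being a number, it can be
-- summed over tuples as a probability.
excess : ∀ {s} → Vec Bool s → ℕ
excess {s} v = 𝟙 (s <ᵇ #true v * 16)

^-distribʳ-* : ∀ m n k → (m * n) ^ k ≡ m ^ k * n ^ k
^-distribʳ-* m n zero    = refl
^-distribʳ-* m n (suc k) = trans (cong (m * n *_) (^-distribʳ-* m n k)) (interchange m n (m ^ k) (n ^ k))
  where
  interchange : ∀ a b c d → a * b * (c * d) ≡ a * c * (b * d)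
  interchange = ℕ-Solver.solve-∀

-- Markov's inequality for (2 ^ (e * 16)) ^ #true, whose mean over the tuples is a product.
chernoff : ∀ {a} {A : Set a} (xs : List A) (bad : A → Bool) e s →
  ∑ xs (λ x → 𝟙 (bad x)) * 2 ^ (e * 16) ≤ length xs →
  ∑ (tuples s xs) (λ v → excess (Vec.map bad v)) * 2 ^ (e * s) ≤ 2 ^ s * length xs ^ s
chernoff xs bad e s h = begin
  ∑ (tuples s xs) (λ v → excess (Vec.map bad v)) * 2 ^ (e * s)     ≡⟨ ∑-*ʳ (tuples s xs) _ _ ⟨
  ∑ (tuples s xs) (λ v → excess (Vec.map bad v) * 2 ^ (e * s))     ≤⟨ ∑-mono (tuples s xs) markov ⟩
  ∑ (tuples s xs) (λ v → y ^ #true (Vec.map bad v))                ≡⟨ mgf s ⟩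
  ∑ xs (λ x → y ^ 𝟙 (bad x)) ^ s                                   ≤⟨ ^-monoˡ-≤ s each ⟩
  (2 * length xs) ^ s                                              ≡⟨ ^-distribʳ-* 2 (length xs) s ⟩
  2 ^ s * length xs ^ s                                            ∎
  where
  open ≤-Reasoning
  y = 2 ^ (e * 16)
  markov : ∀ (v : Vec _ s) → excess (Vec.map bad v) * 2 ^ (e * s) ≤ y ^ #true (Vec.map bad v)
  markov v with s <ᵇ #true (Vec.map bad v) * 16 in s<b
  ... | false = z≤n
  ... | true  = begin
    1 * 2 ^ (e * s)             ≡⟨ *-identityˡ _ ⟩
    2 ^ (e * s)                 ≤⟨ ^-monoʳ-≤ 2 (*-monoʳ-≤ e (<⇒≤ (<ᵇ⇒< s (b * 16) (subst T (sym s<b) tt)))) ⟩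
    2 ^ (e * (b * 16))          ≡⟨ cong (2 ^_) (trans (cong (e *_) (*-comm b 16)) (sym (*-assoc e 16 b))) ⟩
    2 ^ (e * 16 * b)            ≡⟨ ^-*-assoc 2 (e * 16) b ⟨
    y ^ b                       ∎
    where b = #true (Vec.map bad v)
  mgf : ∀ s → ∑ (tuples s xs) (λ v → y ^ #true (Vec.map bad v)) ≡ ∑ xs (λ x → y ^ 𝟙 (bad x)) ^ s
  mgf zero    = refl
  mgf (suc s) = trans (∑-tuples-suc s xs _) (trans (∑-cong xs (λ x → trans
    (∑-cong (tuples s xs) (λ v → ^-distribˡ-+-* y (𝟙 (bad x)) _))
    (trans (∑-*ˡ (tuples s xs) (y ^ 𝟙 (bad x)) _) (cong (y ^ 𝟙 (bad x) *_) (mgf s))))) (∑-*ʳ xs _ _))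
  -- By `h` the fraction of bad points is at most 1/y, so y to the power of the indicator has mean
  -- at most 2. This is the origin of the factor 2ˢ.
  each : ∑ xs (λ x → y ^ 𝟙 (bad x)) ≤ 2 * length xs
  each = begin
    ∑ xs (λ x → y ^ 𝟙 (bad x))              ≤⟨ ∑-mono xs (λ x → le (bad x)) ⟩
    ∑ xs (λ x → 1 + y * 𝟙 (bad x))          ≡⟨ ∑-+ xs _ _ ⟩
    ∑ xs (λ _ → 1) + ∑ xs (λ x → y * 𝟙 (bad x)) ≡⟨ cong₂ _+_ (sym (length≡∑1 xs)) (∑-*ˡ xs y _) ⟩
    length xs + y * ∑ xs (λ x → 𝟙 (bad x))  ≤⟨ +-monoʳ-≤ (length xs) (≤-trans (≤-reflexive (*-comm y _)) (≤-trans h (≤-reflexive (sym (+-identityʳ _))))) ⟩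
    2 * length xs                           ∎
    where
    le : ∀ b → y ^ 𝟙 b ≤ 1 + y * 𝟙 b
    le false = m≤m+n 1 _
    le true  = m≤n+m _ 1

-- Median networks

median : ℕ → ℕ → ℕ → ℕ
median x y z = (x ⊓ y) ⊔ ((x ⊔ y) ⊓ z)

Up Down : (ℕ → Set) → Set
Up   P = ∀ {x y} → x ≤ y → P x → P y
Down P = ∀ {x y} → x ≤ y → P y → P x

module Majority (P : ℕ → Set) where

  ⊓-both : ∀ x y → P x → P y → P (x ⊓ y)
  ⊓-both x y p q with ⊓-sel x y
  ... | inj₁ e = subst P (sym e) p
  ... | inj₂ e = subst P (sym e) q

  ⊔-both : ∀ x y → P x → P y → P (x ⊔ y)
  ⊔-both x y p q with ⊔-sel x y
  ... | inj₁ e = subst P (sym e) p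
  ... | inj₂ e = subst P (sym e) q

  -- An interval is the intersection of an up-set and a down-set, and each is handled alone. `⊓` and
  -- `⊔` return one of their arguments. For an up-set it suffices that one argument of the outer `⊔`
  -- lies in it; for a down-set both are shown to.
  median-up : Up P → ∀ x y z → P x × P y ⊎ P x × P z ⊎ P y × P z → P (median x y z)
  median-up up x y z (inj₁ (p , q)) = up (m≤m⊔n _ _) (⊓-both x y p q)
  median-up up x y z (inj₂ (inj₁ (p , q))) = up (m≤n⊔m (x ⊓ y) _) (⊓-both (x ⊔ y) z (up (m≤m⊔n x y) p) q)
  median-up up x y z (inj₂ (inj₂ (p , q))) = up (m≤n⊔m (x ⊓ y) _) (⊓-both (x ⊔ y) z (up (m≤n⊔m x y) p) q)

  median-down : Down P → ∀ x y z → P x × P y ⊎ P x × P z ⊎ P y × P z → P (median x y z)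
  median-down dn x y z (inj₁ (p , q)) = ⊔-both (x ⊓ y) ((x ⊔ y) ⊓ z) (dn (m⊓n≤m x y) p) (dn (m⊓n≤m _ z) (⊔-both x y p q))
  median-down dn x y z (inj₂ (inj₁ (p , q))) = ⊔-both (x ⊓ y) ((x ⊔ y) ⊓ z) (dn (m⊓n≤m x y) p) (dn (m⊓n≤n (x ⊔ y) z) q)
  median-down dn x y z (inj₂ (inj₂ (p , q))) = ⊔-both (x ⊓ y) ((x ⊔ y) ⊓ z) (dn (m⊓n≤n x y) p) (dn (m⊓n≤n (x ⊔ y) z) q)

maj : Bool → Bool → Bool → Bool
maj false y z = y ∧ z
maj true  y z = y ∨ z

-- Leaves may repeat, so `trees` enumerates a product space: in a random tree the three subtrees are
-- independent, which makes the fraction of bad trees shrink quadratically.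
Tree : ℕ → ℕ → Set
Tree n zero    = Fin n
Tree n (suc d) = Vec (Tree n d) 3

module _ {n : ℕ} where

  evalTree : ∀ d → Vec ℕ n → Tree n d → ℕ
  evalTree zero    z i                = lookup z i
  evalTree (suc d) z (t ∷ u ∷ v ∷ []) = median (evalTree d z t) (evalTree d z u) (evalTree d z v)

  badTree : ∀ d → Vec Bool n → Tree n d → Bool
  badTree zero    S i                = lookup S i
  badTree (suc d) S (t ∷ u ∷ v ∷ []) = maj (badTree d S t) (badTree d S u) (badTree d S v)

  trees : ∀ d → List (Tree n d)
  trees zero    = List.allFin n
  trees (suc d) = tuples 3 (trees d)

Good : (P Q : ℕ → Set) → ℕ → Set
Good P Q x = P x × Q x

module _ {P Q : ℕ → Set} (up : Up P) (dn : Down Q) where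

  maj-good : ∀ b c d x y z → (b ≡ false → Good P Q x) → (c ≡ false → Good P Q y) → (d ≡ false → Good P Q z) →
             maj b c d ≡ false → Good P Q (median x y z)
  maj-good false false d x y z f g h _ =
    Majority.median-up P up x y z (inj₁ (proj₁ (f refl) , proj₁ (g refl))) ,
    Majority.median-down Q dn x y z (inj₁ (proj₂ (f refl) , proj₂ (g refl)))
  maj-good false true false x y z f g h _ =
    Majority.median-up P up x y z (inj₂ (inj₁ (proj₁ (f refl) , proj₁ (h refl)))) ,
    Majority.median-down Q dn x y z (inj₂ (inj₁ (proj₂ (f refl) , proj₂ (h refl))))
  maj-good true false false x y z f g h _ =
    Majority.median-up P up x y z (inj₂ (inj₂ (proj₁ (g refl) , proj₁ (h refl)))) ,
    Majority.median-down Q dn x y z (inj₂ (inj₂ (proj₂ (g refl) , proj₂ (h refl))))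

  tree-good : ∀ {n} d (z : Vec ℕ n) (S : Vec Bool n) → (∀ i → lookup S i ≡ false → Good P Q (lookup z i)) →
              ∀ t → badTree d S t ≡ false → Good P Q (evalTree d z t)
  tree-good zero    z S g i                = g i
  tree-good (suc d) z S g (t ∷ u ∷ v ∷ []) =
    maj-good (badTree d S t) (badTree d S u) (badTree d S v) _ _ _
      (tree-good d z S g t) (tree-good d z S g u) (tree-good d z S g v)

#bad : ∀ {n} → Vec Bool n → ℕ → ℕ
#bad S d = ∑ (trees d) (λ t → 𝟙 (badTree d S t))

module _ {n : ℕ} (S : Vec Bool n) where

  -- A median of three is bad only if two of its subtrees are. There are three pairs, and with the
  -- third subtree free each pair accounts for N B² triples.
  #bad-suc : ∀ d → #bad S (suc d) ≤ length (trees {n} d) * (3 * (#bad S d * #bad S d))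
  #bad-suc d = begin
    ∑ (tuples 3 ts) (λ t → 𝟙 (badTree (suc d) S t))
      ≡⟨ trans (∑-tuples-suc 2 ts _) (∑-cong ts λ t → trans (∑-tuples-suc 1 ts _) (∑-cong ts λ u → ∑-tuples-suc 0 ts _)) ⟩
    ∑ ts (λ t → ∑ ts (λ u → ∑ ts (λ v → 𝟙 (maj (b t) (b u) (b v)) + 0)))
      ≤⟨ ∑-mono ts (λ t → ∑-mono ts λ u → ∑-mono ts λ v → ≤-trans (≤-reflexive (+-identityʳ _)) (maj≤ (b t) (b u) (b v))) ⟩
    ∑ ts (λ t → ∑ ts (λ u → ∑ ts (λ v → β t * β u + (β t + β u) * β v)))
      ≡⟨ ∑-cong ts (λ t → ∑-cong ts λ u → trans (∑-+ ts _ _) (cong₂ _+_ (∑-const ts _) (∑-*ˡ ts (β t + β u) β))) ⟩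
    ∑ ts (λ t → ∑ ts (λ u → N * (β t * β u) + (β t + β u) * B))
      ≡⟨ ∑-cong ts (λ t → trans (∑-cong ts λ u → e₁ N (β t) (β u) B) (trans (∑-+ ts _ _) (cong₂ _+_ (∑-*ˡ ts (N * β t + B) β) (∑-const ts _)))) ⟩
    ∑ ts (λ t → (N * β t + B) * B + N * (β t * B))
      ≡⟨ trans (∑-cong ts λ t → e₂ N (β t) B) (trans (∑-+ ts _ _) (cong₂ _+_ (∑-*ˡ ts (N * B + N * B) β) (∑-const ts _))) ⟩
    (N * B + N * B) * B + N * (B * B)
      ≡⟨ e₃ N B ⟩
    N * (3 * (B * B)) ∎
    where
    open ≤-Reasoning
    ts = trees {n} d
    b  = badTree d S
    β  = λ t → 𝟙 (b t)
    N  = length ts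
    B  = #bad S d
    maj≤ : ∀ x y z → 𝟙 (maj x y z) ≤ 𝟙 x * 𝟙 y + (𝟙 x + 𝟙 y) * 𝟙 z
    maj≤ false false z     = z≤n
    maj≤ false true  false = z≤n
    maj≤ false true  true  = ≤-refl
    maj≤ true  false false = z≤n
    maj≤ true  false true  = ≤-refl
    maj≤ true  true  z     = s≤s z≤n
    e₁ : ∀ N x y B → N * (x * y) + (x + y) * B ≡ (N * x + B) * y + x * B
    e₁ = ℕ-Solver.solve-∀
    e₂ : ∀ N x B → (N * x + B) * B + N * (x * B) ≡ (N * B + N * B) * x + B * B
    e₂ = ℕ-Solver.solve-∀
    e₃ : ∀ N B → (N * B + N * B) * B + N * (B * B) ≡ N * (3 * (B * B))
    e₃ = ℕ-Solver.solve-∀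

  -- In terms of fractions, p ≤ 2 to the -(k + 1) gives 3 p² ≤ 4 p² ≤ 2 to the -2k. Rounding 3 up to
  -- 4 keeps all bounds powers of two.
  #bad-square : ∀ d k → #bad S d * 2 ^ suc k ≤ length (trees {n} d) →
                #bad S (suc d) * 2 ^ (k + k) ≤ length (trees {n} (suc d))
  #bad-square d k h = begin
    #bad S (suc d) * 2 ^ (k + k)            ≤⟨ *-monoˡ-≤ (2 ^ (k + k)) (#bad-suc d) ⟩
    N * (3 * (B * B)) * 2 ^ (k + k)         ≤⟨ *-monoˡ-≤ (2 ^ (k + k)) (*-monoʳ-≤ N (*-monoˡ-≤ (B * B) (n≤1+n 3))) ⟩
    N * (4 * (B * B)) * 2 ^ (k + k)         ≡⟨ cong (N * (4 * (B * B)) *_) (^-distribˡ-+-* 2 k k) ⟩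
    N * (4 * (B * B)) * (2 ^ k * 2 ^ k)     ≡⟨ e (2 ^ k) N B ⟩
    N * (B * (2 * 2 ^ k) * (B * (2 * 2 ^ k))) ≤⟨ *-monoʳ-≤ N (*-mono-≤ h h) ⟩
    N * (N * N)                             ≡⟨ cong (λ x → N * (N * x)) (sym (*-identityʳ N)) ⟩
    N ^ 3                                   ≡⟨ length-tuples 3 (trees d) ⟨
    length (trees {n} (suc d))              ∎
    where
    open ≤-Reasoning
    N  = length (trees {n} d)
    B  = #bad S d
    e : ∀ p N B → N * (4 * (B * B)) * (p * p) ≡ N * (B * (2 * p) * (B * (2 * p)))
    e = ℕ-Solver.solve-∀

#true≡∑ : ∀ {n} (S : Vec Bool n) {a} {A : Set a} (g : Fin n → A) (f : A → ℕ) → (∀ i → f (g i) ≡ 𝟙 (lookup S i)) →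
          ∑ (List.tabulate g) f ≡ #true S
#true≡∑ []      g f h = refl
#true≡∑ (b ∷ S) g f h = cong₂ _+_ (h zero) (#true≡∑ S (λ i → g (suc i)) f (λ i → h (suc i)))

subsets : ∀ n → List (Vec Bool n)
subsets n = tuples n (false ∷ true ∷ [])

Amplifies : ∀ d k → Vec (Tree (2 ^ suc k) d) (2 ^ k) → Set
Amplifies d k W = ∀ S → #true S * 16 ≤ 2 ^ suc k → #true (Vec.map (badTree d S) W) * 16 ≤ 2 ^ k

module StageExists (d k : ℕ)
  (trees-amplify : (S : Vec Bool (2 ^ suc k)) → #true S * 16 ≤ 2 ^ suc k →
    #bad S d * 2 ^ (4 * 16) ≤ length (trees {2 ^ suc k} d)) where

  -- A union bound over all sets of bad inputs.
  stage-exists : ∃ λ W → Amplifies d k W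
  stage-exists = W , amplifies
    where
    n = 2 ^ suc k
    s = 2 ^ k
    ts = trees {n} d
    fails : Vec (Tree n d) s → Vec Bool n → ℕ
    fails W S = 𝟙 (#true S * 16 ≤ᵇ n) * excess (Vec.map (badTree d S) W)
    per-subset : ∀ S → ∑ (tuples s ts) (λ W → fails W S) * 2 ^ (4 * s) ≤ 2 ^ s * length ts ^ s
    per-subset S with #true S * 16 ≤ᵇ n in eq
    ... | false = ≤-trans (≤-reflexive (cong (_* 2 ^ (4 * s)) (∑-zero (tuples s ts)))) z≤n
    ... | true  = ≤-trans (≤-reflexive (cong (_* 2 ^ (4 * s)) (∑-cong (tuples s ts) (λ _ → +-identityʳ _))))
      (chernoff ts (badTree d S) 4 s (trees-amplify S (≤ᵇ⇒≤ (#true S * 16) n (subst T (sym eq) tt))))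
    -- Each of the 2 to the 2s subsets of the inputs fails for at most a fraction 2 to the -3s of
    -- the wirings, so on average a wiring has less than one failure.
    total : ∑ (tuples s ts) (λ W → ∑ (subsets n) (fails W)) * 2 ^ (4 * s) ≤ 2 ^ (3 * s) * length ts ^ s
    total = begin
      ∑ (tuples s ts) (λ W → ∑ (subsets n) (fails W)) * 2 ^ (4 * s)
        ≡⟨ cong (_* 2 ^ (4 * s)) (∑-swap (tuples s ts) (subsets n) fails) ⟩
      ∑ (subsets n) (λ S → ∑ (tuples s ts) (λ W → fails W S)) * 2 ^ (4 * s)
        ≡⟨ ∑-*ʳ (subsets n) _ _ ⟨
      ∑ (subsets n) (λ S → ∑ (tuples s ts) (λ W → fails W S) * 2 ^ (4 * s))
        ≤⟨ ∑-mono (subsets n) per-subset ⟩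
      ∑ (subsets n) (λ _ → 2 ^ s * length ts ^ s)
        ≡⟨ trans (∑-const (subsets n) _) (cong (_* (2 ^ s * length ts ^ s)) (length-tuples n (false ∷ true ∷ []))) ⟩
      2 ^ (2 * s) * (2 ^ s * length ts ^ s)
        ≡⟨ trans (sym (*-assoc (2 ^ (2 * s)) (2 ^ s) _)) (cong (_* length ts ^ s) (trans (sym (^-distribˡ-+-* 2 (2 * s) s)) (cong (2 ^_) (+-comm (2 * s) s)))) ⟩
      2 ^ (3 * s) * length ts ^ s ∎
      where open ≤-Reasoning
    instance
      nz : NonZero n
      nz = m^n≢0 2 (suc k)
    trees>0 : ∀ c → 0 < length (trees {n} c)
    trees>0 zero    = subst (0 <_) (sym (Listₚ.length-tabulate {n = n} id)) (>-nonZero⁻¹ n)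
    trees>0 (suc c) = subst (0 <_) (sym (length-tuples 3 (trees c))) (m^n>0 (length (trees {n} c)) {{>-nonZero (trees>0 c)}} 3)
    strict : ∑ (tuples s ts) (λ W → ∑ (subsets n) (fails W)) < length (tuples s ts)
    strict = *-cancelʳ-< (2 ^ (4 * s)) _ _ (≤-<-trans total (subst (2 ^ (3 * s) * length ts ^ s <_)
      (trans (*-comm (2 ^ (4 * s)) _) (cong (_* 2 ^ (4 * s)) (sym (length-tuples s ts))))
      (*-monoˡ-< (length ts ^ s) {{>-nonZero (m^n>0 (length ts) {{>-nonZero (trees>0 d)}} s)}}
        (^-monoʳ-< 2 (s≤s (s≤s z≤n)) (*-monoˡ-< s {{m^n≢0 2 k}} (n<1+n 3))))))
    found = ∑<length⇒∃0 (tuples s ts) (λ W → ∑ (subsets n) (fails W)) strict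
    W = proj₁ found
    all-bool : ∀ b → b ∈ false ∷ true ∷ []
    all-bool false = here refl
    all-bool true  = there (here refl)
    amplifies : Amplifies d k W
    amplifies S h = ≮⇒≥ λ lt → <⇒≱ (one lt) (≤-trans (∑-term (fails W) (∈-tuples S (λ i → all-bool (lookup S i)))) (≤-reflexive (proj₂ (proj₂ found))))
      where
      one : s < #true (Vec.map (badTree d S) W) * 16 → 0 < fails W S
      one lt with #true S * 16 ≤ᵇ n | ≤⇒≤ᵇ h | s <ᵇ #true (Vec.map (badTree d S) W) * 16 | <⇒<ᵇ lt
      ... | true | _ | true | _ = s≤s z≤n

abstract
  -- Opaque, so that neither trees of depth five nor the constants computed from their cost are
  -- unfolded. The value enters through `five-amplify` and the number of temporary cells.
  depth : ℕ
  depth = 5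

  depth≡5 : depth ≡ 5
  depth≡5 = refl

Stage : ℕ → Set
Stage k = Vec (Tree (2 ^ suc k) depth) (2 ^ k)

-- Squaring the fraction 1/16 of bad inputs five times leaves a fraction of at most 2⁻⁶⁴.
five-amplify : ∀ d → d ≡ 5 → ∀ k (S : Vec Bool (2 ^ suc k)) → #true S * 16 ≤ 2 ^ suc k →
  #bad S d * 2 ^ (4 * 16) ≤ length (trees {2 ^ suc k} d)
five-amplify d refl k S h = ≤-trans (*-monoʳ-≤ (#bad S 5) (^-monoʳ-≤ 2 (m≤n+m 64 2)))
  -- The exponents are 4, 6, 10, 18, 34, 66, as k + 1 becomes 2k. The union bound over sets of bad
  -- inputs asks for 64.
  (#bad-square S 4 33 (#bad-square S 3 17 (#bad-square S 2 9 (#bad-square S 1 5 (#bad-square S 0 3 base)))))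
  where
  base : #bad S 0 * 2 ^ 4 ≤ length (trees {2 ^ suc k} 0)
  base = subst₂ _≤_ (cong (_* 16) (sym (#true≡∑ S id _ (λ _ → refl))))
    (sym (Listₚ.length-tabulate {n = 2 ^ suc k} id)) h

stage : ∀ k → ∃ λ (W : Stage k) → Amplifies depth k W
stage k = StageExists.stage-exists depth k (five-amplify depth depth≡5 k)

network : ∀ k → Vec ℕ (2 ^ k) → ℕ
network zero    z = lookup z zero
network (suc k) z = network k (Vec.map (evalTree depth z) (proj₁ (stage k)))

-- Every stage preserves the bound of a sixteenth, and for a single remaining value this bound says
-- that it is not bad. The set `S` changes from stage to stage, while the interval given by `P` and
-- `Q` stays the same.
network-good : ∀ {P Q} → Up P → Down Q → ∀ k (z : Vec ℕ (2 ^ k)) (S : Vec Bool (2 ^ k)) →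
  (∀ i → lookup S i ≡ false → Good P Q (lookup z i)) → #true S * 16 ≤ 2 ^ k → Good P Q (network k z)
network-good up dn zero (z ∷ []) (false ∷ []) g h = g zero refl
network-good up dn zero (z ∷ []) (true  ∷ []) g (s≤s ())
network-good {P} {Q} up dn (suc k) z S g h = network-good up dn k _ (Vec.map (badTree depth S) W)
  (λ i bad → subst (Good P Q) (sym (Vecₚ.lookup-map i (evalTree depth z) W))
    (tree-good up dn depth z S g (lookup W i) (trans (sym (Vecₚ.lookup-map i (badTree depth S) W)) bad)))
  (proj₂ (stage k) S h)
  where W = proj₁ (stage k)

-- Fourth moments of quadratic forms in random signs

-- Natural-valued, so that moments are summed and compared in ℕ; integers are left to the polynomial
-- identities.
sq fourth : ℤ → ℕ
sq x = ∣ x ∣ * ∣ x ∣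
fourth x = sq x * sq x

pos-sq : ∀ x → pos (sq x) ≡ x *ᶻ x
pos-sq (pos n)        = ℤₚ.pos-* n n
pos-sq (ℤ.-[1+_] n)   = refl

pos-fourth : ∀ x → pos (fourth x) ≡ x *ᶻ x *ᶻ (x *ᶻ x)
pos-fourth x = trans (ℤₚ.pos-* (sq x) (sq x)) (cong₂ _*ᶻ_ (pos-sq x) (pos-sq x))

-- Splits the square into a part odd in the sign and a part free of it. Applied twice it does the
-- same for the fourth power, and odd parts sum to zero.
sign-square : ∀ s B A → s *ᶻ s ≡ 1ℤ →
  (s *ᶻ B +ᶻ A) *ᶻ (s *ᶻ B +ᶻ A) ≡ s *ᶻ (B *ᶻ A +ᶻ B *ᶻ A) +ᶻ (B *ᶻ B +ᶻ A *ᶻ A)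
sign-square s B A h = trans (e₁ s B A) (trans
  (cong (λ z → s *ᶻ (B *ᶻ A +ᶻ B *ᶻ A) +ᶻ (z *ᶻ (B *ᶻ B) +ᶻ A *ᶻ A)) h)
  (cong (λ z → s *ᶻ (B *ᶻ A +ᶻ B *ᶻ A) +ᶻ (z +ᶻ A *ᶻ A)) (ℤₚ.*-identityˡ (B *ᶻ B))))
  where
  e₁ : ∀ s B A → (s *ᶻ B +ᶻ A) *ᶻ (s *ᶻ B +ᶻ A) ≡
       s *ᶻ (B *ᶻ A +ᶻ B *ᶻ A) +ᶻ (s *ᶻ s *ᶻ (B *ᶻ B) +ᶻ A *ᶻ A)
  e₁ = ℤ-Solver.solve-∀

monomial : ∀ {Ω : Set} → (ℕ → Ω → ℤ) → List ℕ → Ω → ℤ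
monomial s []       ω = 1ℤ
monomial s (y ∷ ys) ω = s y ω *ᶻ monomial s ys ω

-- Indices are processed in increasing order, each step adding the sign with the largest index.
-- Hence all that is assumed of the independence is that this sign, times at most seven earlier
-- ones, averages to zero.
module Moment {Ω : Set} (Ωs : List Ω) (s : ℕ → Ω → ℤ) (n : ℕ)
  (s²≡1 : ∀ j ω → s j ω *ᶻ s j ω ≡ 1ℤ)
  (vanish : ∀ j → j < n → ∀ ys → All (_< j) ys → length ys ≤ 7 →
            ∑ᶻ Ωs (λ ω → s j ω *ᶻ monomial s ys ω) ≡ 0ℤ) where

  Vanishes : ℕ → ℕ → (Ω → ℤ) → Set
  Vanishes j k g = ∀ ys → All (_< j) ys → length ys ≤ k → ∑ᶻ Ωs (λ ω → s j ω *ᶻ monomial s ys ω *ᶻ g ω) ≡ 0ℤ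

  -- f behaves like a polynomial of degree d in the signs s₀, …, sⱼ₋₁
  Degree : ℕ → ℕ → (Ω → ℤ) → Set
  Degree j d f = ∀ k g → Vanishes j (d + k) g → Vanishes j k (λ ω → f ω *ᶻ g ω)

  module _ {j : ℕ} where

    ≗-vanishes : ∀ {k g h} → (∀ ω → g ω ≡ h ω) → Vanishes j k g → Vanishes j k h
    ≗-vanishes eq v ys lt le = trans (∑ᶻ-cong Ωs λ ω → cong (s j ω *ᶻ monomial s ys ω *ᶻ_) (sym (eq ω))) (v ys lt le)

    degree-const : ∀ c → Degree j 0 (λ _ → c)
    degree-const c k g v ys lt le = trans (∑ᶻ-cong Ωs λ ω → e (s j ω) (monomial s ys ω) c (g ω))
      (trans (∑ᶻ-*ˡ Ωs c (λ ω → s j ω *ᶻ monomial s ys ω *ᶻ g ω)) (trans (cong (c *ᶻ_) (v ys lt le)) (ℤₚ.*-zeroʳ c)))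
      where
      e : ∀ a b c d → a *ᶻ b *ᶻ (c *ᶻ d) ≡ c *ᶻ (a *ᶻ b *ᶻ d)
      e = ℤ-Solver.solve-∀

    degree-sign : ∀ {i} → i < j → Degree j 1 (s i)
    degree-sign {i} i<j k g v ys lt le = trans (∑ᶻ-cong Ωs λ ω → e (s j ω) (monomial s ys ω) (s i ω) (g ω))
      (v (i ∷ ys) (i<j ∷ lt) (s≤s le))
      where
      e : ∀ a b c d → a *ᶻ b *ᶻ (c *ᶻ d) ≡ a *ᶻ (c *ᶻ b) *ᶻ d
      e = ℤ-Solver.solve-∀

    degree-+ : ∀ {d} f g → Degree j d f → Degree j d g → Degree j d (λ ω → f ω +ᶻ g ω)
    degree-+ f f' F F' k g v ys lt le = trans
      (∑ᶻ-cong Ωs λ ω → e (s j ω *ᶻ monomial s ys ω) (f ω) (f' ω) (g ω))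
      (trans (∑ᶻ-+ Ωs (λ ω → s j ω *ᶻ monomial s ys ω *ᶻ (f ω *ᶻ g ω)) (λ ω → s j ω *ᶻ monomial s ys ω *ᶻ (f' ω *ᶻ g ω)))
        (cong₂ _+ᶻ_ (F k g v ys lt le) (F' k g v ys lt le)))
      where
      e : ∀ m a b d → m *ᶻ ((a +ᶻ b) *ᶻ d) ≡ m *ᶻ (a *ᶻ d) +ᶻ m *ᶻ (b *ᶻ d)
      e = ℤ-Solver.solve-∀

    -- Since `Degree` is defined by its effect on vanishing sums, a product acts by applying the two
    -- effects in turn; no form has to be expanded into monomials.
    degree-* : ∀ {d e} f g → Degree j d f → Degree j e g → Degree j (d + e) (λ ω → f ω *ᶻ g ω)
    degree-* {d} {e} f f' F F' k g v = ≗-vanishes (λ ω → sym (ℤₚ.*-assoc (f ω) (f' ω) (g ω)))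
      (F k (λ ω → f' ω *ᶻ g ω) (F' (d + k) g λ ys lt le → v ys lt (≤-trans le (≤-reflexive (shuffle d e k)))))
      where
      shuffle : ∀ d e k → e + (d + k) ≡ d + e + k
      shuffle = ℕ-Solver.solve-∀

    degree-weaken : ∀ {d e} f → d ≤ e → Degree j d f → Degree j e f
    degree-weaken f d≤e F k g v = F k g (λ ys lt le → v ys lt (≤-trans le (+-monoˡ-≤ k d≤e)))

    vanish-degree : j < n → ∀ f → Degree j 7 f → ∑ᶻ Ωs (λ ω → s j ω *ᶻ f ω) ≡ 0ℤ
    vanish-degree j<n f F = trans (∑ᶻ-cong Ωs λ ω → e (s j ω) (f ω))
      (F 0 (λ _ → 1ℤ) (λ ys lt le → trans (∑ᶻ-cong Ωs λ ω → ℤₚ.*-identityʳ _) (vanish j j<n ys lt le)) [] [] z≤n)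
      where
      e : ∀ a b → a *ᶻ b ≡ a *ᶻ 1ℤ *ᶻ (b *ᶻ 1ℤ)
      e = ℤ-Solver.solve-∀

    module _ (j<n : j < n) (B A : Ω → ℤ) (dB : Degree j 1 B) (dA : Degree j 2 A) where

      private
        R P : Ω → ℤ
        R ω = B ω *ᶻ A ω +ᶻ B ω *ᶻ A ω
        P ω = B ω *ᶻ B ω +ᶻ A ω *ᶻ A ω
        dR : Degree j 3 R
        dR = degree-+ (λ ω → B ω *ᶻ A ω) (λ ω → B ω *ᶻ A ω) (degree-* B A dB dA) (degree-* B A dB dA)
        dP : Degree j 4 P
        dP = degree-+ (λ ω → B ω *ᶻ B ω) (λ ω → A ω *ᶻ A ω)
          (degree-weaken (λ ω → B ω *ᶻ B ω) (s≤s (s≤s z≤n)) (degree-* B B dB dB)) (degree-* A A dA dA)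

        odd-vanishes : (f : Ω → ℕ) (g : Ω → ℤ) (h : Ω → ℕ) → Degree j 7 g →
          (∀ ω → pos (f ω) ≡ s j ω *ᶻ g ω +ᶻ pos (h ω)) → ∑ Ωs f ≡ ∑ Ωs h
        odd-vanishes f g h dg eq = ℤₚ.+-injective (begin
          pos (∑ Ωs f)                                    ≡⟨ ∑ᶻ-pos Ωs f ⟨
          ∑ᶻ Ωs (λ ω → pos (f ω))                         ≡⟨ ∑ᶻ-cong Ωs eq ⟩
          ∑ᶻ Ωs (λ ω → s j ω *ᶻ g ω +ᶻ pos (h ω))         ≡⟨ ∑ᶻ-+ Ωs (λ ω → s j ω *ᶻ g ω) (λ ω → pos (h ω)) ⟩
          ∑ᶻ Ωs (λ ω → s j ω *ᶻ g ω) +ᶻ ∑ᶻ Ωs (λ ω → pos (h ω)) ≡⟨ cong₂ _+ᶻ_ (vanish-degree j<n g dg) (∑ᶻ-pos Ωs h) ⟩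
          0ℤ +ᶻ pos (∑ Ωs h)                              ≡⟨ ℤₚ.+-identityˡ _ ⟩
          pos (∑ Ωs h)                                    ∎)
          where open ≡-Reasoning

      second-moment : ∑ Ωs (λ ω → sq (s j ω *ᶻ B ω +ᶻ A ω)) ≡ ∑ Ωs (λ ω → sq (B ω)) + ∑ Ωs (λ ω → sq (A ω))
      second-moment = trans (odd-vanishes _ R (λ ω → sq (B ω) + sq (A ω)) (degree-weaken R (m≤m+n 3 4) dR) λ ω →
          trans (pos-sq (s j ω *ᶻ B ω +ᶻ A ω)) (trans (sign-square (s j ω) (B ω) (A ω) (s²≡1 j ω))
            (cong (s j ω *ᶻ R ω +ᶻ_) (cong₂ _+ᶻ_ (sym (pos-sq (B ω))) (sym (pos-sq (A ω)))))))
        (∑-+ Ωs (λ ω → sq (B ω)) (λ ω → sq (A ω)))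

      -- Here the independence is used in full: by `sign-square` the odd part is the sign times
      -- twice the product of `R`, of degree 3, and `P`, of degree 4, together 7. What survives is
      -- R² + P² = B⁴ + 6 A² B² + A⁴.
      fourth-moment : ∑ Ωs (λ ω → fourth (s j ω *ᶻ B ω +ᶻ A ω)) ≡
        ∑ Ωs (λ ω → fourth (B ω)) + (6 * ∑ Ωs (λ ω → sq (A ω) * sq (B ω)) + ∑ Ωs (λ ω → fourth (A ω)))
      fourth-moment = trans (odd-vanishes _ (λ ω → R ω *ᶻ P ω +ᶻ R ω *ᶻ P ω)
          (λ ω → fourth (B ω) + (6 * (sq (A ω) * sq (B ω)) + fourth (A ω)))
          (degree-+ (λ ω → R ω *ᶻ P ω) (λ ω → R ω *ᶻ P ω) (degree-* R P dR dP) (degree-* R P dR dP)) λ ω →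
          trans (pos-fourth (s j ω *ᶻ B ω +ᶻ A ω)) (trans (cong (λ z → z *ᶻ z) (sign-square (s j ω) (B ω) (A ω) (s²≡1 j ω)))
            (trans (sign-square (s j ω) (R ω) (P ω) (s²≡1 j ω))
            (cong (s j ω *ᶻ (R ω *ᶻ P ω +ᶻ R ω *ᶻ P ω) +ᶻ_) (even (B ω) (A ω))))))
        (trans (∑-+ Ωs (λ ω → fourth (B ω)) _) (cong (∑ Ωs (λ ω → fourth (B ω)) +_)
          (trans (∑-+ Ωs (λ ω → 6 * (sq (A ω) * sq (B ω))) (λ ω → fourth (A ω)))
            (cong (_+ ∑ Ωs (λ ω → fourth (A ω))) (∑-*ˡ Ωs 6 (λ ω → sq (A ω) * sq (B ω)))))))
        where
        even-ring : ∀ B A → (B *ᶻ A +ᶻ B *ᶻ A) *ᶻ (B *ᶻ A +ᶻ B *ᶻ A) +ᶻ (B *ᶻ B +ᶻ A *ᶻ A) *ᶻ (B *ᶻ B +ᶻ A *ᶻ A) ≡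
                    B *ᶻ B *ᶻ (B *ᶻ B) +ᶻ (pos 6 *ᶻ (A *ᶻ A *ᶻ (B *ᶻ B)) +ᶻ A *ᶻ A *ᶻ (A *ᶻ A))
        even-ring = ℤ-Solver.solve-∀
        even : ∀ B A → (B *ᶻ A +ᶻ B *ᶻ A) *ᶻ (B *ᶻ A +ᶻ B *ᶻ A) +ᶻ (B *ᶻ B +ᶻ A *ᶻ A) *ᶻ (B *ᶻ B +ᶻ A *ᶻ A) ≡
               pos (fourth B + (6 * (sq A * sq B) + fourth A))
        even B A = trans (even-ring B A) (sym (cong₂ _+ᶻ_ (pos-fourth B) (cong₂ _+ᶻ_
          (trans (ℤₚ.pos-* 6 (sq A * sq B)) (cong (pos 6 *ᶻ_) (trans (ℤₚ.pos-* (sq A) (sq B)) (cong₂ _*ᶻ_ (pos-sq A) (pos-sq B)))))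
          (pos-fourth A))))

  private N = length Ωs

  linear : (ℕ → ℕ) → ℕ → Ω → ℤ
  linear c i ω = ∑ᶻ (downFrom i) (λ l → s l ω *ᶻ pos (c l))

  energy : (ℕ → ℕ) → ℕ → ℕ
  energy c i = ∑ (downFrom i) (λ l → c l * c l)

  degree-linear : ∀ {j} c i → i ≤ j → Degree j 1 (linear c i)
  degree-linear c zero    le = degree-weaken (λ _ → 0ℤ) z≤n (degree-const 0ℤ)
  degree-linear c (suc i) le = degree-+ (λ ω → s i ω *ᶻ pos (c i)) (linear c i)
    (degree-* (s i) (λ _ → pos (c i)) (degree-sign le) (degree-const (pos (c i)))) (degree-linear c i (<⇒≤ le))

  linear-second : ∀ c i → i ≤ n → ∑ Ωs (λ ω → sq (linear c i ω)) ≡ N * energy c i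
  linear-second c zero    le = trans (∑-zero Ωs) (sym (*-zeroʳ N))
  linear-second c (suc i) le = trans
    (second-moment le (λ _ → pos (c i)) (linear c i) (degree-weaken (λ _ → pos (c i)) z≤n (degree-const (pos (c i))))
      (degree-weaken (linear c i) (s≤s z≤n) (degree-linear c i ≤-refl)))
    (trans (cong₂ _+_ (∑-const Ωs (c i * c i)) (linear-second c i (<⇒≤ le))) (sym (*-distribˡ-+ N (c i * c i) _)))

  -- The constant 3 of Khintchine's inequality: the cross term 6 b τ is exactly that of 3 (b + τ)²,
  -- and only 2 b² is given away.
  linear-fourth : ∀ c i → i ≤ n → ∑ Ωs (λ ω → fourth (linear c i ω)) ≤ N * (3 * (energy c i * energy c i))
  linear-fourth c zero    le = ≤-reflexive (trans (∑-zero Ωs) (sym (*-zeroʳ N)))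
  linear-fourth c (suc i) le = begin
    ∑ Ωs (λ ω → fourth (linear c (suc i) ω))
      ≡⟨ fourth-moment le (λ _ → pos (c i)) (linear c i) (degree-weaken (λ _ → pos (c i)) z≤n (degree-const (pos (c i))))
           (degree-weaken (linear c i) (s≤s z≤n) (degree-linear c i ≤-refl)) ⟩
    ∑ Ωs (λ _ → b * b) + (6 * ∑ Ωs (λ ω → sq (linear c i ω) * b) + ∑ Ωs (λ ω → fourth (linear c i ω)))
      ≤⟨ +-mono-≤ (≤-reflexive (∑-const Ωs (b * b))) (+-mono-≤ (*-monoʳ-≤ 6 (≤-reflexive
           (trans (∑-*ʳ Ωs (λ ω → sq (linear c i ω)) b) (cong (_* b) (linear-second c i (<⇒≤ le)))))) (linear-fourth c i (<⇒≤ le))) ⟩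
    N * (b * b) + (6 * (N * τ * b) + N * (3 * (τ * τ)))   ≤⟨ m≤m+n _ (N * (2 * (b * b))) ⟩
    N * (b * b) + (6 * (N * τ * b) + N * (3 * (τ * τ))) + N * (2 * (b * b)) ≡⟨ e N b τ ⟩
    N * (3 * ((b + τ) * (b + τ)))                         ∎
    where
    open ≤-Reasoning
    b = c i * c i
    τ = energy c i
    e : ∀ N b τ → N * (b * b) + (6 * (N * τ * b) + N * (3 * (τ * τ))) + N * (2 * (b * b)) ≡ N * (3 * ((b + τ) * (b + τ)))
    e = ℕ-Solver.solve-∀

  quadratic : (ℕ → ℕ → ℕ) → ℕ → Ω → ℤ
  quadratic c i ω = ∑ᶻ (downFrom i) (λ j → s j ω *ᶻ linear (c j) j ω)

  total-energy : (ℕ → ℕ → ℕ) → ℕ → ℕ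
  total-energy c i = ∑ (downFrom i) (λ j → energy (c j) j)

  degree-quadratic : ∀ {j} c i → i ≤ j → Degree j 2 (quadratic c i)
  degree-quadratic c zero    le = degree-weaken (λ _ → 0ℤ) z≤n (degree-const 0ℤ)
  degree-quadratic c (suc i) le = degree-+ (λ ω → s i ω *ᶻ linear (c i) i ω) (quadratic c i)
    (degree-* (s i) (linear (c i) i) (degree-sign le) (degree-linear (c i) i (<⇒≤ le))) (degree-quadratic c i (<⇒≤ le))

  -- If c is the constant of the inductive hypothesis, Cauchy-Schwarz bounds the mixed term by 6
  -- √(3c) t τ, which must not exceed 2 c t τ. The least such c is 27, for which both are 54 t τ.
  quadratic-fourth : ∀ c i → i ≤ n →
    ∑ Ωs (λ ω → fourth (quadratic c i ω)) ≤ N * (27 * (total-energy c i * total-energy c i))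
  quadratic-fourth c zero    le = ≤-reflexive (trans (∑-zero Ωs) (sym (*-zeroʳ N)))
  quadratic-fourth c (suc i) le = begin
    ∑ Ωs (λ ω → fourth (quadratic c (suc i) ω))
      ≡⟨ fourth-moment le (linear (c i) i) (quadratic c i) (degree-linear (c i) i ≤-refl) (degree-quadratic c i ≤-refl) ⟩
    ∑ Ωs (λ ω → fourth (L ω)) + (6 * ∑ Ωs (λ ω → sq (Q ω) * sq (L ω)) + ∑ Ωs (λ ω → fourth (Q ω)))
      ≤⟨ +-mono-≤ (linear-fourth (c i) i (<⇒≤ le)) (+-mono-≤ (*-monoʳ-≤ 6 mixed) IH) ⟩
    N * (3 * (τ * τ)) + (6 * (N * (9 * (t * τ))) + N * (27 * (t * t))) ≤⟨ m≤m+n _ (N * (24 * (τ * τ))) ⟩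
    N * (3 * (τ * τ)) + (6 * (N * (9 * (t * τ))) + N * (27 * (t * t))) + N * (24 * (τ * τ)) ≡⟨ e N t τ ⟩
    N * (27 * ((τ + t) * (τ + t))) ∎
    where
    open ≤-Reasoning
    L = linear (c i) i
    Q = quadratic c i
    τ = energy (c i) i
    t = total-energy c i
    IH = quadratic-fourth c i (<⇒≤ le)
    e : ∀ N t τ → N * (3 * (τ * τ)) + (6 * (N * (9 * (t * τ))) + N * (27 * (t * t))) + N * (24 * (τ * τ)) ≡
                  N * (27 * ((τ + t) * (τ + t)))
    e = ℕ-Solver.solve-∀
    e′ : ∀ N t τ → N * (27 * (t * t)) * (N * (3 * (τ * τ))) ≡ N * (9 * (t * τ)) * (N * (9 * (t * τ)))
    e′ = ℕ-Solver.solve-∀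
    mixed : ∑ Ωs (λ ω → sq (Q ω) * sq (L ω)) ≤ N * (9 * (t * τ))
    mixed = square-cancel-≤ (≤-trans (cauchy-schwarz Ωs (λ ω → sq (Q ω)) (λ ω → sq (L ω)))
      (≤-trans (*-mono-≤ IH (linear-fourth (c i) i (<⇒≤ le))) (≤-reflexive (e′ N t τ))))

-- A maximal inequality for processes whose increments have small fourth moments

weighted-square : ∀ x y → 4 * ((x + y) * (x + y)) ≤ 5 * (x * x) + 20 * (y * y)
weighted-square x y = *-cancelˡ-≤ 2 (+-cancelʳ-≤ (4 * (x * (4 * y))) _ _ (begin
  2 * (4 * ((x + y) * (x + y))) + 4 * (x * (4 * y))              ≡⟨ e₁ x y ⟩
  8 * (x * x) + 8 * (y * y) + 2 * (4 * (x * (4 * y)))            ≤⟨ +-monoʳ-≤ (8 * (x * x) + 8 * (y * y)) (*-monoʳ-≤ 2 (4xy≤ x (4 * y))) ⟩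
  8 * (x * x) + 8 * (y * y) + 2 * ((x + 4 * y) * (x + 4 * y))    ≡⟨ e₂ x y ⟩
  2 * (5 * (x * x) + 20 * (y * y)) + 4 * (x * (4 * y))           ∎))
  where
  open ≤-Reasoning
  e₁ : ∀ x y → 2 * (4 * ((x + y) * (x + y))) + 4 * (x * (4 * y)) ≡ 8 * (x * x) + 8 * (y * y) + 2 * (4 * (x * (4 * y)))
  e₁ = ℕ-Solver.solve-∀
  e₂ : ∀ x y → 8 * (x * x) + 8 * (y * y) + 2 * ((x + 4 * y) * (x + 4 * y)) ≡ 2 * (5 * (x * x) + 20 * (y * y)) + 4 * (x * (4 * y))
  e₂ = ℕ-Solver.solve-∀

-- (x + y)² ≤ (5/4) x² + 5 y², applied twice, gives the weights 125/64 < 2 and 125. The weight of x⁴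
-- has to be below 3 for the recursion in `combine` to close.
weighted-fourth : ∀ x y → (x + y) * (x + y) * ((x + y) * (x + y)) ≤ 2 * (x * x * (x * x)) + 125 * (y * y * (y * y))
weighted-fourth x y = *-cancelˡ-≤ 64 (begin
  64 * ((x + y) * (x + y) * ((x + y) * (x + y)))                            ≡⟨ e₁ ((x + y) * (x + y)) ⟩
  4 * (4 * ((x + y) * (x + y)) * (4 * ((x + y) * (x + y))))                 ≤⟨ *-monoʳ-≤ 4 (*-mono-≤ (weighted-square x y) (weighted-square x y)) ⟩
  4 * ((5 * (x * x) + 20 * (y * y)) * (5 * (x * x) + 20 * (y * y)))         ≤⟨ weighted-square (5 * (x * x)) (20 * (y * y)) ⟩
  5 * (5 * (x * x) * (5 * (x * x))) + 20 * (20 * (y * y) * (20 * (y * y)))  ≤⟨ m≤m+n _ (3 * (x * x * (x * x))) ⟩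
  5 * (5 * (x * x) * (5 * (x * x))) + 20 * (20 * (y * y) * (20 * (y * y))) + 3 * (x * x * (x * x)) ≡⟨ e₂ (x * x) (y * y) ⟩
  64 * (2 * (x * x * (x * x)) + 125 * (y * y * (y * y)))                    ∎)
  where
  open ≤-Reasoning
  e₁ : ∀ s → 64 * (s * s) ≡ 4 * (4 * s * (4 * s))
  e₁ = ℕ-Solver.solve-∀
  e₂ : ∀ x y → 5 * (5 * x * (5 * x)) + 20 * (20 * y * (20 * y)) + 3 * (x * x) ≡ 64 * (2 * (x * x) + 125 * (y * y))
  e₂ = ℕ-Solver.solve-∀

fourth-+ : ∀ x y → fourth (x +ᶻ y) ≤ fourth x * 2 + fourth y * 125
fourth-+ x y = ≤-trans (*-mono-≤ sq≤ sq≤) (≤-trans (weighted-fourth ∣ x ∣ ∣ y ∣) (≤-reflexive (cong₂ _+_ (*-comm 2 (fourth x)) (*-comm 125 (fourth y)))))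
  where
  sq≤ = *-mono-≤ (ℤₚ.∣i+j∣≤∣i∣+∣j∣ x y) (ℤₚ.∣i+j∣≤∣i∣+∣j∣ x y)

module Maximal {Ω : Set} (Ωs : List Ω) (X : ℕ → Ω → ℤ) (μ : ℕ → ℕ) (μ-mono : ∀ {s t} → s ≤ t → μ s ≤ μ t) (C : ℕ)
  (increments : ∀ s t → s ≤ t → ∑ Ωs (λ ω → fourth (X t ω -ᶻ X s ω)) ≤ C * ((μ t ∸ μ s) * (μ t ∸ μ s))) where

  Dominates : ℕ → ℕ → (Ω → ℕ) → Set
  Dominates s ℓ M = ∀ u ω → s ≤ u → u ≤ s + ℓ → fourth (X u ω -ᶻ X s ω) ≤ M ω

  -- A dominating function takes the place of the maximum over the interval, which is never formed;
  -- it is composed from those of the subintervals.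
  Bound : ℕ → ℕ → Set
  Bound s ℓ = ∃ λ M → Dominates s ℓ M × ∑ Ωs M ≤ C * ((μ (s + ℓ) ∸ μ s) * (μ (s + ℓ) ∸ μ s)) * 500

  -- The interval is cut where half of the variance μ has been spent.
  split : ∀ s ℓ k → k ≤ ℓ → 2 * (μ (s + suc ℓ) ∸ μ (s + suc k)) ≤ μ (s + suc ℓ) ∸ μ s →
    ∃ λ i → i ≤ ℓ × 2 * (μ (s + i) ∸ μ s) ≤ μ (s + suc ℓ) ∸ μ s × 2 * (μ (s + suc ℓ) ∸ μ (s + suc i)) ≤ μ (s + suc ℓ) ∸ μ s
  split s ℓ k k≤ℓ h with ≤-<-connex (2 * (μ (s + k) ∸ μ s)) (μ (s + suc ℓ) ∸ μ s)
  ... | inj₁ le = k , k≤ℓ , le , h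
  split s ℓ zero k≤ℓ h | inj₂ gt = contradiction gt (≤⇒≯ (≤-trans (≤-reflexive
    (cong (2 *_) (trans (cong (λ z → μ z ∸ μ s) (+-identityʳ s)) (n∸n≡0 (μ s))))) z≤n))
  split s ℓ (suc k) k≤ℓ h | inj₂ gt = split s ℓ k (<⇒≤ k≤ℓ) (half (μ (s + suc ℓ) ∸ μ (s + suc k)) (μ (s + suc k) ∸ μ s) (<⇒≤ gt) (≤-reflexive
      (m∸n+n≡m′ (μ-mono (m≤m+n s (suc k))) (μ-mono (+-monoʳ-≤ s (m≤n⇒m≤1+n k≤ℓ))))))
    where
    m∸n+n≡m′ : ∀ {a b c} → a ≤ b → b ≤ c → c ∸ b + (b ∸ a) ≡ c ∸ a
    m∸n+n≡m′ {a} {b} {c} a≤b b≤c = begin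
      c ∸ b + (b ∸ a)   ≡⟨ +-∸-assoc (c ∸ b) a≤b ⟨
      c ∸ b + b ∸ a     ≡⟨ cong (_∸ a) (m∸n+n≡m b≤c) ⟩
      c ∸ a             ∎
      where open ≡-Reasoning
    half : ∀ x y {D} → D ≤ 2 * y → x + y ≤ D → 2 * x ≤ D
    half x y {D} p q = ≤-trans (+-cancelʳ-≤ y _ _ (≤-trans (≤-reflexive (e x y)) (≤-trans (+-monoʳ-≤ x q)
      (≤-trans (+-monoʳ-≤ x p) (≤-reflexive (e′ x y)))))) q
      where
      e : ∀ x y → 2 * x + y ≡ x + (x + y)
      e = ℕ-Solver.solve-∀
      e′ : ∀ x y → x + 2 * y ≡ x + y + y
      e′ = ℕ-Solver.solve-∀

  -- The fixed point of the recursion: each half spends at most D/2 and contributes a quarter of D²,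
  -- and 500/4 + 2 · 500/4 + 125 = 500. As nothing is lost from one level to the next, the depth of
  -- the recursion does not enter.
  combine : ∀ a b d D S₁ S₂ S₃ → 2 * a ≤ D → 2 * b ≤ D → d ≤ D →
    S₁ ≤ C * (a * a) * 500 → S₂ ≤ C * (b * b) * 500 → S₃ ≤ C * (d * d) →
    S₁ + (S₂ * 2 + S₃ * 125) ≤ C * (D * D) * 500
  combine a b d D S₁ S₂ S₃ ha hb hd h₁ h₂ h₃ = begin
    S₁ + (S₂ * 2 + S₃ * 125)                                   ≤⟨ +-mono-≤ h₁ (+-mono-≤ (*-monoˡ-≤ 2 h₂) (*-monoˡ-≤ 125 h₃)) ⟩
    C * (a * a) * 500 + (C * (b * b) * 500 * 2 + C * (d * d) * 125) ≡⟨ e₁ C a b d ⟩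
    C * (2 * a * (2 * a)) * 125 + (C * (2 * b * (2 * b)) * 250 + C * (d * d) * 125)
      ≤⟨ +-mono-≤ (*-monoˡ-≤ 125 (*-monoʳ-≤ C (*-mono-≤ ha ha))) (+-mono-≤ (*-monoˡ-≤ 250 (*-monoʳ-≤ C (*-mono-≤ hb hb)))
           (*-monoˡ-≤ 125 (*-monoʳ-≤ C (*-mono-≤ hd hd)))) ⟩
    C * (D * D) * 125 + (C * (D * D) * 250 + C * (D * D) * 125) ≡⟨ e₂ (C * (D * D)) ⟩
    C * (D * D) * 500                                          ∎
    where
    open ≤-Reasoning
    e₁ : ∀ C a b d → C * (a * a) * 500 + (C * (b * b) * 500 * 2 + C * (d * d) * 125) ≡
         C * (2 * a * (2 * a)) * 125 + (C * (2 * b * (2 * b)) * 250 + C * (d * d) * 125)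
    e₁ = ℕ-Solver.solve-∀
    e₂ : ∀ x → x * 125 + (x * 250 + x * 125) ≡ x * 500
    e₂ = ℕ-Solver.solve-∀

  X-X : ∀ s ω → fourth (X s ω -ᶻ X s ω) ≡ 0
  X-X s ω = cong fourth (ℤₚ.+-inverseʳ (X s ω))

  -- The step from `s + i` to `s + suc i` belongs to neither half, because it alone may spend more
  -- than half of the variance. It is part of `jump`, the increment from the left end to the start
  -- of the right half. Both halves are shorter than the interval, which `fuel` records.
  bound : ∀ fuel s ℓ → ℓ ≤ fuel → Bound s ℓ
  bound fuel s zero ℓ≤ = (λ _ → 0) , dom , ≤-trans (≤-reflexive (∑-zero Ωs)) z≤n
    where
    dom : Dominates s zero (λ _ → 0)
    dom u ω s≤u u≤ with refl ← ≤-antisym s≤u (≤-trans u≤ (≤-reflexive (+-identityʳ s))) = ≤-reflexive (X-X s ω)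
  bound (suc fuel) s (suc ℓ) ℓ≤ with split s ℓ ℓ ≤-refl (≤-trans (≤-reflexive (cong (2 *_) (n∸n≡0 (μ (s + suc ℓ))))) z≤n)
  ... | i , i≤ℓ , hi , hj with bound fuel s i (≤-trans i≤ℓ (s≤s⁻¹ ℓ≤)) | bound fuel (s + suc i) (ℓ ∸ i) (≤-trans (m∸n≤m ℓ i) (s≤s⁻¹ ℓ≤))
  ... | M₁ , dom₁ , sum₁ | M₂ , dom₂ , sum₂ = M , dom ,
      ≤-trans (≤-reflexive sum) (combine (μ (s + i) ∸ μ s) (μ (s + suc ℓ) ∸ μ (s + suc i)) (μ (s + suc i) ∸ μ s) (μ (s + suc ℓ) ∸ μ s) (∑ Ωs M₁) (∑ Ωs M₂) (∑ Ωs jump) hi (hj)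
        (∸-monoˡ-≤ (μ s) (μ-mono (+-monoʳ-≤ s (s≤s i≤ℓ)))) sum₁ (subst (λ z → ∑ Ωs M₂ ≤ C * ((μ z ∸ μ (s + suc i)) * (μ z ∸ μ (s + suc i))) * 500) end sum₂) (increments s (s + suc i) (m≤m+n s (suc i))))
    where
    end : s + suc i + (ℓ ∸ i) ≡ s + suc ℓ
    end = trans (+-assoc s (suc i) (ℓ ∸ i)) (cong (λ z → s + suc z) (m+[n∸m]≡n i≤ℓ))
    jump : Ω → ℕ
    jump ω = fourth (X (s + suc i) ω -ᶻ X s ω)
    M : Ω → ℕ
    M ω = M₁ ω + (M₂ ω * 2 + jump ω * 125)
    sum : ∑ Ωs M ≡ ∑ Ωs M₁ + (∑ Ωs M₂ * 2 + ∑ Ωs jump * 125)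
    sum = trans (∑-+ Ωs M₁ (λ ω → M₂ ω * 2 + jump ω * 125)) (cong (∑ Ωs M₁ +_)
      (trans (∑-+ Ωs (λ ω → M₂ ω * 2) (λ ω → jump ω * 125)) (cong₂ _+_ (∑-*ʳ Ωs M₂ 2) (∑-*ʳ Ωs jump 125))))
    dom : Dominates s (suc ℓ) M
    dom u ω s≤u u≤ with ≤-<-connex u (s + i)
    ... | inj₁ u≤i = ≤-trans (dom₁ u ω s≤u u≤i) (m≤m+n _ _)
    ... | inj₂ i<u = begin
      fourth (X u ω -ᶻ X s ω)                                           ≡⟨ cong fourth (e (X u ω) (X (s + suc i) ω) (X s ω)) ⟩
      fourth ((X u ω -ᶻ X (s + suc i) ω) +ᶻ (X (s + suc i) ω -ᶻ X s ω)) ≤⟨ fourth-+ (X u ω -ᶻ X (s + suc i) ω) _ ⟩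
      fourth (X u ω -ᶻ X (s + suc i) ω) * 2 + jump ω * 125
        ≤⟨ +-monoˡ-≤ (jump ω * 125) (*-monoˡ-≤ 2 (dom₂ u ω (≤-trans (≤-reflexive (+-suc s i)) i<u) (≤-trans u≤ (≤-reflexive (sym end))))) ⟩
      M₂ ω * 2 + jump ω * 125                                           ≤⟨ m≤n+m _ (M₁ ω) ⟩
      M ω                                                               ∎
      where
      open ≤-Reasoning
      e : ∀ a b c → a -ᶻ c ≡ (a -ᶻ b) +ᶻ (b -ᶻ c)
      e = ℤ-Solver.solve-∀

-- Polynomial hashing modulo a power of two

∑ᶻ-tuples-suc : ∀ {a} {A : Set a} n (xs : List A) (f : Vec A (suc n) → ℤ) →
  ∑ᶻ (tuples (suc n) xs) f ≡ ∑ᶻ xs (λ x → ∑ᶻ (tuples n xs) (λ v → f (x ∷ v)))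
∑ᶻ-tuples-suc n xs f = ∑ᶻ-product _∷_ xs (tuples n xs) f

∑ᶻ-shift : ∀ M (h : ℕ → ℤ) → (∀ x → h (x + M) ≡ h x) → ∀ d →
  ∑ᶻ (downFrom M) (λ x → h (x + d)) ≡ ∑ᶻ (downFrom M) h
∑ᶻ-shift M h per zero    = ∑ᶻ-cong (downFrom M) (λ x → cong h (+-identityʳ x))
∑ᶻ-shift M h per (suc d) = begin
  ∑ᶻ (downFrom M) (λ x → h (x + suc d))  ≡⟨ ∑ᶻ-cong (downFrom M) (λ x → cong h (+-suc x d)) ⟩
  ∑ᶻ (downFrom M) (λ x → h (suc x + d))  ≡⟨ Group.∙-cancelʳ (record { isGroup = ℤₚ.+-0-isGroup }) (h d) _ _ (trans (∑ᶻ-rotate M (λ x → h (x + d)))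
    (trans (ℤₚ.+-comm (h (M + d)) _) (cong (∑ᶻ (downFrom M) (λ x → h (x + d)) +ᶻ_) (trans (cong h (+-comm M d)) (per d))))) ⟩
  ∑ᶻ (downFrom M) (λ x → h (x + d))      ≡⟨ ∑ᶻ-shift M h per d ⟩
  ∑ᶻ (downFrom M) h                      ∎
  where open ≡-Reasoning

eval : ∀ {k} → Vec ℕ k → ℕ → ℕ
eval []       x = 0
eval (a ∷ as) x = a + x * eval as x

infixl 6 _⊞_
_⊞_ : ∀ {k} → Vec ℕ k → Vec ℕ k → Vec ℕ k
_⊞_ = Vec.zipWith _+_

eval-⊞ : ∀ {k} (a b : Vec ℕ k) x → eval (a ⊞ b) x ≡ eval a x + eval b x
eval-⊞ []       []       x = refl
eval-⊞ (a ∷ as) (b ∷ bs) x = trans (cong (λ z → a + b + x * z) (eval-⊞ as bs x)) (e a b x (eval as x) (eval bs x))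
  where
  e : ∀ a b x p q → a + b + x * (p + q) ≡ a + x * p + (b + x * q)
  e = ℕ-Solver.solve-∀

module _ (M : ℕ) .{{_ : NonZero M}} where

  Respects : ∀ {k} → (Vec ℕ k → ℤ) → Set
  Respects g = ∀ a b → (∀ x → eval a x % M ≡ eval b x % M) → g a ≡ g b

  -- The coefficients of `a ⊞ d` may leave the range below `M`. A function that sees only values
  -- modulo `M` is periodic in every coefficient, so each shift moves a sum along a full period.
  ∑ᶻ-⊞ : ∀ k (g : Vec ℕ k → ℤ) → Respects g → ∀ d →
    ∑ᶻ (tuples k (downFrom M)) (λ a → g (a ⊞ d)) ≡ ∑ᶻ (tuples k (downFrom M)) g
  ∑ᶻ-⊞ zero    g resp []       = refl
  ∑ᶻ-⊞ (suc k) g resp (d ∷ ds) = begin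
    ∑ᶻ (tuples (suc k) xs) (λ a → g (a ⊞ (d ∷ ds)))
      ≡⟨ ∑ᶻ-tuples-suc k xs _ ⟩
    ∑ᶻ xs (λ x → ∑ᶻ (tuples k xs) (λ v → g (x + d ∷ v ⊞ ds)))
      ≡⟨ ∑ᶻ-cong xs (λ x → ∑ᶻ-⊞ k (λ v → g (x + d ∷ v)) (λ a b h → resp _ _ (λ y → tail-resp (x + d) a b y (h y))) ds) ⟩
    ∑ᶻ xs (λ x → ∑ᶻ (tuples k xs) (λ v → g (x + d ∷ v)))
      ≡⟨ ∑ᶻ-shift M (λ x → ∑ᶻ (tuples k xs) (λ v → g (x ∷ v)))
           (λ x → ∑ᶻ-cong (tuples k xs) (λ v → resp _ _ (λ y → head-resp x (y * eval v y)))) d ⟩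
    ∑ᶻ xs (λ x → ∑ᶻ (tuples k xs) (λ v → g (x ∷ v)))
      ≡⟨ ∑ᶻ-tuples-suc k xs g ⟨
    ∑ᶻ (tuples (suc k) xs) g ∎
    where
    open ≡-Reasoning
    xs = downFrom M
    head-resp : ∀ x p → (x + M + p) % M ≡ (x + p) % M
    head-resp x p = trans (cong (_% M) (e x M p)) ([m+n]%n≡m%n (x + p) M)
      where
      e : ∀ x M p → x + M + p ≡ x + p + M
      e = ℕ-Solver.solve-∀
    tail-resp : ∀ c (a b : Vec ℕ k) y → eval a y % M ≡ eval b y % M → eval (c ∷ a) y % M ≡ eval (c ∷ b) y % M
    tail-resp c a b y h = trans (%-distribˡ-+ c (y * eval a y) M) (trans (cong (λ z → (c % M + z) % M)
      (trans (%-distribˡ-* y (eval a y) M) (trans (cong (λ z → ((y % M) * z) % M) h) (sym (%-distribˡ-* y (eval b y) M)))))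
      (sym (%-distribˡ-+ c (y * eval b y) M)))

times-linear : ∀ {k} c (a : Vec ℕ k) → ∃ λ (d : Vec ℕ (suc k)) → ∀ x → eval d x ≡ (x + c) * eval a x
times-linear c []       = 0 ∷ [] , λ x → trans (*-zeroʳ x) (sym (*-zeroʳ (x + c)))
times-linear c (a ∷ as) with times-linear c as
... | d₀ ∷ ds , eq = c * a ∷ a + d₀ ∷ ds , λ x → begin
  c * a + x * (a + d₀ + x * eval ds x)      ≡⟨ e₁ c a x d₀ (x * eval ds x) ⟩
  c * a + x * (a + (d₀ + x * eval ds x))    ≡⟨ cong (λ z → c * a + x * (a + z)) (eq x) ⟩
  c * a + x * (a + (x + c) * eval as x)     ≡⟨ e₂ c a x (eval as x) ⟩
  (x + c) * (a + x * eval as x)             ∎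
  where
  open ≡-Reasoning
  e₁ : ∀ c a x d p → c * a + x * (a + d + p) ≡ c * a + x * (a + (d + p))
  e₁ = ℕ-Solver.solve-∀
  e₂ : ∀ c a x p → c * a + x * (a + (x + c) * p) ≡ (x + c) * (a + x * p)
  e₂ = ℕ-Solver.solve-∀

pad : ∀ {m} n (a : Vec ℕ m) → m ≤ n → ∃ λ (d : Vec ℕ n) → ∀ x → eval d x ≡ eval a x
pad n       []       _        = replicate n 0 , zeros n
  where
  zeros : ∀ n x → eval (replicate n 0) x ≡ 0
  zeros zero    x = refl
  zeros (suc n) x = trans (cong (x *_) (zeros n x)) (*-zeroʳ x)
pad (suc n) (a ∷ as) (s≤s le) with pad n as le
... | d , eq = a ∷ d , λ x → cong (λ z → a + x * z) (eq x)

-- ∏ (x − y) up to multiples of M, with the subtraction replaced by an addition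
roots : ℕ → List ℕ → ℕ → ℕ
roots M []       x = 1
roots M (y ∷ ys) x = (x + (M ∸ y)) * roots M ys x

-- The true product of the j - y, which `roots` represents modulo `M` at a point j above all the
-- roots. Being positive and bounded, it contains only a bounded power of two.
differences : List ℕ → ℕ → ℕ
differences []       x = 1
differences (y ∷ ys) x = (x ∸ y) * differences ys x

roots-poly : ∀ M κ ys → ∃ λ (d : Vec ℕ (suc (length ys))) → ∀ x → eval d x ≡ κ * roots M ys x
roots-poly M κ []       = κ ∷ [] , λ x → trans (cong (κ +_) (*-zeroʳ x)) (trans (+-identityʳ κ) (sym (*-identityʳ κ)))
roots-poly M κ (y ∷ ys) with roots-poly M κ ys
... | d , eq with times-linear (M ∸ y) d
... | d′ , eq′ = d′ , λ x → trans (eq′ x) (trans (cong ((x + (M ∸ y)) *_) (eq x)) (e (x + (M ∸ y)) κ (roots M ys x)))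
  where
  e : ∀ a b c → a * (b * c) ≡ b * (a * c)
  e = ℕ-Solver.solve-∀

roots-root : ∀ M ys → All (_≤ M) ys → All (λ y → ∃ λ q → roots M ys y ≡ q * M) ys
roots-root M []       []         = []
roots-root M (y ∷ ys) (le ∷ les) =
  (roots M ys y , trans (cong (_* roots M ys y) (m+[n∸m]≡n le)) (*-comm M _)) ∷
  All.map (λ { {x} (q , eq) → (x + (M ∸ y)) * q , trans (cong ((x + (M ∸ y)) *_) eq) (sym (*-assoc (x + (M ∸ y)) q M)) }) (roots-root M ys les)

roots-differences : ∀ M j ys → j ≤ M → All (_< j) ys → ∃ λ q → roots M ys j ≡ differences ys j + q * M
roots-differences M j []       j≤M []         = 0 , refl
roots-differences M j (y ∷ ys) j≤M (lt ∷ lts) with roots-differences M j ys j≤M lts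
... | q , eq = (j ∸ y) * q + (differences ys j + q * M) , trans (cong₂ _*_ shift eq) (e (j ∸ y) M (differences ys j) q)
  where
  shift : j + (M ∸ y) ≡ (j ∸ y) + M
  shift = begin
    j + (M ∸ y)   ≡⟨ +-∸-assoc j (≤-trans (<⇒≤ lt) j≤M) ⟨
    j + M ∸ y     ≡⟨ cong (_∸ y) (+-comm j M) ⟩
    M + j ∸ y     ≡⟨ +-∸-assoc M (<⇒≤ lt) ⟩
    M + (j ∸ y)   ≡⟨ +-comm M _ ⟩
    (j ∸ y) + M   ∎
    where open ≡-Reasoning
  e : ∀ a M d q → (a + M) * (d + q * M) ≡ a * d + (a * q + (d + q * M)) * M
  e = ℕ-Solver.solve-∀

differences>0 : ∀ j ys → All (_< j) ys → 0 < differences ys j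
differences>0 j []       []         = s≤s z≤n
differences>0 j (y ∷ ys) (lt ∷ lts) = *-mono-< (m<n⇒0<n∸m lt) (differences>0 j ys lts)

differences≤ : ∀ j u ys → j ≤ 2 ^ u → differences ys j ≤ 2 ^ (u * length ys)
differences≤ j u []       le = m^n>0 2 (u * 0)
differences≤ j u (y ∷ ys) le = ≤-trans (*-mono-≤ (≤-trans (m∸n≤m j y) le) (differences≤ j u ys le))
  (≤-reflexive (trans (sym (^-distribˡ-+-* 2 u (u * length ys))) (cong (2 ^_) (sym (*-suc u (length ys))))))

even-or-odd : ∀ n → (∃ λ k → n ≡ 2 * k) ⊎ (∃ λ k → n ≡ 1 + 2 * k)
even-or-odd zero    = inj₁ (0 , refl)
even-or-odd (suc n) with even-or-odd n
... | inj₁ (k , refl) = inj₂ (k , refl)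
... | inj₂ (k , refl) = inj₁ (suc k , cong suc (sym (+-suc k (k + 0))))

odd-part : ∀ fuel n → n ≤ fuel → 0 < n → ∃₂ λ v k → n ≡ 2 ^ v * (1 + 2 * k)
odd-part (suc fuel) n le n>0 with even-or-odd n
... | inj₂ (k , refl) = 0 , k , sym (+-identityʳ _)
... | inj₁ (suc k , refl) with odd-part fuel (suc k) (≤-trans (m≤m+n (suc k) _) (≤-trans (≤-reflexive (sym (+-suc k (k + 0)))) (s≤s⁻¹ le))) (s≤s z≤n)
... | v , o , eq = suc v , o , trans (cong (2 *_) eq) (sym (*-assoc 2 (2 ^ v) (1 + 2 * o)))
odd-part zero n le n>0 = contradiction (≤-trans n>0 le) (λ ())

-- Hensel lifting by one bit at a time: if the quotient `q` is odd, adding 2ᴷ to the inverse makes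
-- it even.
odd-inverse : ∀ k K → ∃₂ λ x q → (1 + 2 * k) * x ≡ 1 + 2 ^ K * q
odd-inverse k zero = 1 , 2 * k , e k
  where
  e : ∀ k → (1 + 2 * k) * 1 ≡ 1 + 1 * (2 * k)
  e = ℕ-Solver.solve-∀
odd-inverse k (suc K) with odd-inverse k K
... | x , q , eq with even-or-odd q
... | inj₁ (r , refl) = x , r , trans eq (cong suc (e (2 ^ K) r))
  where
  e : ∀ p r → p * (2 * r) ≡ 2 * p * r
  e = ℕ-Solver.solve-∀
... | inj₂ (r , refl) = x + 2 ^ K , 1 + r + k , trans (*-distribˡ-+ (1 + 2 * k) x (2 ^ K))
    (trans (cong (_+ (1 + 2 * k) * 2 ^ K) eq) (cong suc (e (2 ^ K) r k)))
  where
  e : ∀ p r k → p * (1 + 2 * r) + (1 + 2 * k) * p ≡ 2 * p * (1 + r + k)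
  e = ℕ-Solver.solve-∀

infixl 7 _%2^_ _/2^_
_%2^_ _/2^_ : ℕ → ℕ → ℕ
v %2^ K = _%_ v (2 ^ K) {{m^n≢0 2 K}}
v /2^ K = _/_ v (2 ^ K) {{m^n≢0 2 K}}

-- d is a multiple of ∏ (X − y) for y in ys, whose value at j is a power of two times a unit.
bump : ∀ K β u k ys j → All (_< j) ys → j ≤ 2 ^ u → u ≤ K → u * length ys + β ≤ K → length ys < k →
  ∃ λ (d : Vec ℕ k) → All (λ y → ∀ v → (v + eval d y) %2^ K ≡ v %2^ K) ys ×
                      (∀ v → (v + eval d j) %2^ K ≡ (v + 2 ^ (K ∸ β)) %2^ K)
bump K β u k ys j lts j≤ u≤K le len = d , All.map (λ {y} → at-root y) (roots-root M ys (All.map (λ lt → ≤-trans (<⇒≤ lt) j≤M) lts)) , at-j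
  where
  M = 2 ^ K
  instance
    M≢0 : NonZero M
    M≢0 = m^n≢0 2 K
  j≤M : j ≤ M
  j≤M = ≤-trans j≤ (^-monoʳ-≤ 2 u≤K)
  Δ = differences ys j
  fact = odd-part Δ Δ ≤-refl (differences>0 j ys lts)
  v₀ = proj₁ fact
  o = proj₁ (proj₂ fact)
  inv = odd-inverse o K
  x₀ = proj₁ inv
  -- The odd part of `Δ` is cancelled by its inverse `x₀` modulo `M`, and the other factor raises
  -- the remaining power of two to the exponent `K ∸ β`.
  κ = 2 ^ (K ∸ β ∸ v₀) * x₀
  -- The power of two in `Δ` is at most `Δ`, a product of `length ys` factors of at most 2ᵘ. This is
  -- why the modulus has to exceed the range of the items by so much.
  v≤ : v₀ ≤ K ∸ β
  v≤ = ≮⇒≥ λ lt → <⇒≱ (^-monoʳ-< 2 (s≤s (s≤s z≤n)) lt) (begin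
    2 ^ v₀                     ≤⟨ m≤m*n (2 ^ v₀) (1 + 2 * o) ⟩
    2 ^ v₀ * (1 + 2 * o)       ≡⟨ proj₂ (proj₂ fact) ⟨
    Δ                          ≤⟨ differences≤ j u ys j≤ ⟩
    2 ^ (u * length ys)        ≤⟨ ^-monoʳ-≤ 2 (≤-trans (≤-reflexive (sym (m+n∸n≡m (u * length ys) β))) (∸-monoˡ-≤ β le)) ⟩
    2 ^ (K ∸ β)                ∎)
    where open ≤-Reasoning
  κΔ : κ * Δ ≡ 2 ^ (K ∸ β) + 2 ^ (K ∸ β) * proj₁ (proj₂ inv) * M
  κΔ = begin
    κ * Δ                                                 ≡⟨ cong (κ *_) (proj₂ (proj₂ fact)) ⟩
    2 ^ (K ∸ β ∸ v₀) * x₀ * (2 ^ v₀ * (1 + 2 * o))        ≡⟨ e (2 ^ (K ∸ β ∸ v₀)) x₀ (2 ^ v₀) (1 + 2 * o) ⟩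
    2 ^ (K ∸ β ∸ v₀) * 2 ^ v₀ * ((1 + 2 * o) * x₀)        ≡⟨ cong₂ _*_ (trans (sym (^-distribˡ-+-* 2 (K ∸ β ∸ v₀) v₀)) (cong (2 ^_) (m∸n+n≡m v≤))) (proj₂ (proj₂ inv)) ⟩
    2 ^ (K ∸ β) * (1 + M * proj₁ (proj₂ inv))             ≡⟨ e′ (2 ^ (K ∸ β)) M (proj₁ (proj₂ inv)) ⟩
    2 ^ (K ∸ β) + 2 ^ (K ∸ β) * proj₁ (proj₂ inv) * M     ∎
    where
    open ≡-Reasoning
    e : ∀ a x b o → a * x * (b * o) ≡ a * b * (o * x)
    e = ℕ-Solver.solve-∀
    e′ : ∀ a M q → a * (1 + M * q) ≡ a + a * q * M
    e′ = ℕ-Solver.solve-∀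
  poly = roots-poly M κ ys
  padded = pad k (proj₁ poly) len
  d = proj₁ padded
  eval-d : ∀ x → eval d x ≡ κ * roots M ys x
  eval-d x = trans (proj₂ padded x) (proj₂ poly x)
  at-root : ∀ y → (∃ λ q → roots M ys y ≡ q * M) → ∀ v → (v + eval d y) % M ≡ v % M
  at-root y (q , eq) v = trans (cong (λ z → (v + z) % M) (trans (eval-d y) (trans (cong (κ *_) eq) (sym (*-assoc κ q M)))))
    ([m+kn]%n≡m%n v (κ * q) M)
  at-j : ∀ v → (v + eval d j) % M ≡ (v + 2 ^ (K ∸ β)) % M
  at-j v = trans (cong (_% M) (begin
      v + eval d j                  ≡⟨ cong (v +_) (trans (eval-d j) (trans (cong (κ *_) eq) (*-distribˡ-+ κ Δ (q * M)))) ⟩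
      v + (κ * Δ + κ * (q * M))     ≡⟨ cong (λ z → v + (z + κ * (q * M))) κΔ ⟩
      v + (h + h * r * M + κ * (q * M)) ≡⟨ e v h r M κ q ⟩
      v + h + (h * r + κ * q) * M   ∎)) ([m+kn]%n≡m%n (v + h) (h * r + κ * q) M)
    where
    open ≡-Reasoning
    h = 2 ^ (K ∸ β)
    r = proj₁ (proj₂ inv)
    q = proj₁ (roots-differences M j ys j≤M lts)
    eq = proj₂ (roots-differences M j ys j≤M lts)
    e : ∀ v h r M κ q → v + (h + h * r * M + κ * (q * M)) ≡ v + h + (h * r + κ * q) * M
    e = ℕ-Solver.solve-∀

top : ℕ → ℕ → ℕ → ℕ
top K β v = v %2^ K /2^ (K ∸ β)

module _ {K β : ℕ} (β≤K : β ≤ K) where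

  private
    B = 2 ^ β
    h = 2 ^ (K ∸ β)
    instance
      M≢0 : NonZero (2 ^ K)
      M≢0 = m^n≢0 2 K
      B≢0 : NonZero B
      B≢0 = m^n≢0 2 β
      h≢0 : NonZero h
      h≢0 = m^n≢0 2 (K ∸ β)
      Bh≢0 : NonZero (B * h)
      Bh≢0 = m*n≢0 B h
    M≡ : B * h ≡ 2 ^ K
    M≡ = trans (sym (^-distribˡ-+-* 2 β (K ∸ β))) (cong (2 ^_) (m+[n∸m]≡n β≤K))

  top≡ : ∀ v → top K β v ≡ v /2^ (K ∸ β) %2^ β
  top≡ v = trans (cong (_/ h) (%-congʳ {o = v} (sym M≡))) (m%[n*o]/o≡m/o%n v B h)

  top< : ∀ v → top K β v < B
  top< v = subst (_< B) (sym (top≡ v)) (m%n<n (v / h) B)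

  top-bump : ∀ v → top K β (v + h) ≡ (top K β v + 1) %2^ β
  top-bump v = trans (top≡ (v + h)) (trans (cong (_% B) (trans (+-distrib-/-∣ʳ v (∣-refl {h})) (cong (v / h +_) (n/n≡1 h))))
    (trans (sym (%-idemˡ (v / h) 1)) (cong (λ z → (z + 1) % B) (sym (top≡ v)))))
    where
    %-idemˡ : ∀ a b → (a % B + b) % B ≡ (a + b) % B
    %-idemˡ a b = trans (%-distribˡ-+ (a % B) b B) (trans (cong (λ z → (z + b % B) % B) (m%n%n≡m%n a B))
      (sym (%-distribˡ-+ a b B)))

%2^-idemˡ : ∀ b x y → (x %2^ b + y) %2^ b ≡ (x + y) %2^ b
%2^-idemˡ b x y = trans (%-distribˡ-+ (x % B) y B) (trans (cong (λ z → (z + y % B) % B) (m%n%n≡m%n x B)) (sym (%-distribˡ-+ x y B)))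
  where
  B = 2 ^ b
  instance
    B≢0 : NonZero B
    B≢0 = m^n≢0 2 b

top-cong : ∀ K β {v w} → v %2^ K ≡ w %2^ K → top K β v ≡ top K β w
top-cong K β eq = cong (_/2^ (K ∸ β)) eq

≡ᵇ-refl : ∀ n → (n ≡ᵇ n) ≡ true
≡ᵇ-refl zero    = refl
≡ᵇ-refl (suc n) = ≡ᵇ-refl n

≢⇒≡ᵇ : ∀ m n → m ≢ n → (m ≡ᵇ n) ≡ false
≢⇒≡ᵇ m n m≢n with m ≡ᵇ n in eq
... | false = refl
... | true  = contradiction (≡ᵇ⇒≡ m n (subst T (sym eq) tt)) m≢n

∑ᶻ-pick-≥ : ∀ n x (f : ℕ → ℤ) → n ≤ x → ∑ᶻ (downFrom n) (λ i → pos (𝟙 (x ≡ᵇ i)) *ᶻ f i) ≡ 0ℤ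
∑ᶻ-pick-≥ zero    x f le = refl
∑ᶻ-pick-≥ (suc n) x f le = cong₂ _+ᶻ_ (cong (λ b → pos (𝟙 b) *ᶻ f n) (≢⇒≡ᵇ x n (>⇒≢ le))) (∑ᶻ-pick-≥ n x f (<⇒≤ le))

∑ᶻ-pick : ∀ n x (f : ℕ → ℤ) → x < n → ∑ᶻ (downFrom n) (λ i → pos (𝟙 (x ≡ᵇ i)) *ᶻ f i) ≡ f x
∑ᶻ-pick (suc n) x f (s≤s le) with m≤n⇒m<n∨m≡n le
... | inj₁ x<n  = trans (cong₂ _+ᶻ_ (cong (λ b → pos (𝟙 b) *ᶻ f n) (≢⇒≡ᵇ x n (<⇒≢ x<n))) (∑ᶻ-pick n x f x<n)) (ℤₚ.+-identityˡ (f x))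
... | inj₂ refl = trans (cong₂ _+ᶻ_ (trans (cong (λ b → pos (𝟙 b) *ᶻ f n) (≡ᵇ-refl n)) (ℤₚ.*-identityˡ (f n))) (∑ᶻ-pick-≥ n n f ≤-refl)) (ℤₚ.+-identityʳ (f n))

sgn : ℕ → ℤ
sgn zero    = 1ℤ
sgn (suc _) = ℤ.-1ℤ

sgn² : ∀ x → sgn x *ᶻ sgn x ≡ 1ℤ
sgn² zero    = refl
sgn² (suc _) = refl

sgn-flip : ∀ x → x < 2 → sgn ((x + 1) %2^ 1) ≡ ℤ.-1ℤ *ᶻ sgn x
sgn-flip 0 _ = refl
sgn-flip 1 _ = refl
sgn-flip (suc (suc x)) (s≤s (s≤s ()))

≡-neg⇒≡0 : ∀ x → x ≡ ℤ.-1ℤ *ᶻ x → x ≡ 0ℤ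
≡-neg⇒≡0 (pos zero)    eq = refl
≡-neg⇒≡0 (pos (suc n)) ()
≡-neg⇒≡0 (ℤ.-[1+_] n)  ()

module Hashing (K u : ℕ) (u≤K : u ≤ K) where

  coefficients : (k : ℕ) → List (Vec ℕ k)
  coefficients k = tuples k (downFrom (2 ^ K))

  private instance
    M≢0 : NonZero (2 ^ K)
    M≢0 = m^n≢0 2 K

  hash : ∀ {k} → ℕ → ℕ → Vec ℕ k → ℕ
  hash β x a = top K β (eval a x)

  hash-⊞-fixed : ∀ {k} β (a d : Vec ℕ k) y → (∀ v → (v + eval d y) %2^ K ≡ v %2^ K) → hash β y (a ⊞ d) ≡ hash β y a
  hash-⊞-fixed β a d y h = top-cong K β (trans (cong (_%2^ K) (eval-⊞ a d y)) (h (eval a y)))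

  hash-⊞-moved : ∀ {k} β → β ≤ K → (a d : Vec ℕ k) (y : ℕ) → (∀ v → (v + eval d y) %2^ K ≡ (v + 2 ^ (K ∸ β)) %2^ K) →
    hash β y (a ⊞ d) ≡ (hash β y a + 1) %2^ β
  hash-⊞-moved β β≤K a d y h = trans (top-cong K β (trans (cong (_%2^ K) (eval-⊞ a d y)) (h (eval a y)))) (top-bump β≤K (eval a y))

  sign : ℕ → Vec ℕ 8 → ℤ
  sign j a = sgn (hash 1 j a)

  -- Translating the coefficients by the polynomial of `bump` with β = 1 adds half of the modulus at
  -- `j`: the sign of `j` flips, those of `ys` stay, and the sum equals its own negative.
  sign-vanish : u * 7 + 1 ≤ K → ∀ j → j ≤ 2 ^ u → ∀ ys → All (_< j) ys → length ys ≤ 7 →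
    ∑ᶻ (coefficients 8) (λ a → sign j a *ᶻ monomial sign ys a) ≡ 0ℤ
  sign-vanish le j j≤ ys lts len with bump K 1 u 8 ys j lts j≤ u≤K (≤-trans (+-monoˡ-≤ 1 (*-monoʳ-≤ u len)) le) (s≤s len)
  ... | d , fixed , moved = ≡-neg⇒≡0 _ (begin
    ∑ᶻ (coefficients 8) g                           ≡⟨ ∑ᶻ-⊞ (2 ^ K) 8 g respects d ⟨
    ∑ᶻ (coefficients 8) (λ a → g (a ⊞ d))           ≡⟨ ∑ᶻ-cong (coefficients 8) negates ⟩
    ∑ᶻ (coefficients 8) (λ a → ℤ.-1ℤ *ᶻ g a)        ≡⟨ ∑ᶻ-*ˡ (coefficients 8) ℤ.-1ℤ g ⟩
    ℤ.-1ℤ *ᶻ ∑ᶻ (coefficients 8) g                  ∎)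
    where
    open ≡-Reasoning
    g : Vec ℕ 8 → ℤ
    g a = sign j a *ᶻ monomial sign ys a
    monomial-cong : ∀ {a b} zs → All (λ y → sign y a ≡ sign y b) zs → monomial sign zs a ≡ monomial sign zs b
    monomial-cong []       []         = refl
    monomial-cong (z ∷ zs) (eq ∷ eqs) = cong₂ _*ᶻ_ eq (monomial-cong zs eqs)
    respects : Respects (2 ^ K) g
    respects a b h = cong₂ _*ᶻ_ (cong sgn (top-cong K 1 (h j))) (monomial-cong ys (All.universal (λ y → cong sgn (top-cong K 1 (h y))) ys))
    negates : ∀ a → g (a ⊞ d) ≡ ℤ.-1ℤ *ᶻ g a
    negates a = trans (cong₂ _*ᶻ_
      (trans (cong sgn (hash-⊞-moved 1 (≤-trans (m≤n+m 1 (u * 7)) le) a d j moved)) (sgn-flip (hash 1 j a) (top< (≤-trans (m≤n+m 1 (u * 7)) le) (eval a j))))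
      (monomial-cong ys (All.map (λ {y} f → cong sgn (hash-⊞-fixed 1 a d y f)) fixed)))
      (ℤₚ.*-assoc ℤ.-1ℤ (sign j a) (monomial sign ys a))

  module _ (b : ℕ) (u+b≤K : u + b ≤ K) where

    private
      b≤K : b ≤ K
      b≤K = ≤-trans (m≤n+m b u) u+b≤K
      instance
        B≢0 : NonZero (2 ^ b)
        B≢0 = m^n≢0 2 b

    -- Translation turns the event that the two hashes differ by l into the one for l + 1. So all 2ᵇ
    -- differences are equally frequent, and each `a` has exactly one of them.
    collision-probability : ∀ i j → i < j → j ≤ 2 ^ u →
      ∑ (coefficients 2) (λ a → 𝟙 (hash b i a ≡ᵇ hash b j a)) * 2 ^ b ≤ length (coefficients 2)
    collision-probability i j i<j j≤ with bump K b u 2 (i ∷ []) j (i<j ∷ []) j≤ u≤K (≤-trans (≤-reflexive (cong (_+ b) (*-identityʳ u))) u+b≤K) ≤-refl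
    ... | d , fixed ∷ [] , moved = begin
      ∑ cs (λ a → 𝟙 (hash b i a ≡ᵇ hash b j a)) * 2 ^ b  ≡⟨ cong (_* 2 ^ b) (∑-cong cs λ a → cong (λ z → 𝟙 (hash b i a ≡ᵇ z)) (sym (F₀ a))) ⟩
      ∑ cs (F 0) * 2 ^ b                                 ≡⟨ trans (*-comm _ (2 ^ b)) (cong (_* ∑ cs (F 0)) (sym (Listₚ.length-downFrom (2 ^ b)))) ⟩
      length (downFrom (2 ^ b)) * ∑ cs (F 0)             ≡⟨ ∑-const (downFrom (2 ^ b)) (∑ cs (F 0)) ⟨
      ∑ (downFrom (2 ^ b)) (λ _ → ∑ cs (F 0))            ≡⟨ ∑-cong (downFrom (2 ^ b)) (λ l → sym (all-equal l)) ⟩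
      ∑ (downFrom (2 ^ b)) (λ l → ∑ cs (F l))            ≡⟨ ∑-swap (downFrom (2 ^ b)) cs F ⟩
      ∑ cs (λ a → ∑ (downFrom (2 ^ b)) (λ l → F l a))    ≡⟨ ∑-cong cs one-shift ⟩
      ∑ cs (λ _ → 1)                                     ≡⟨ length≡∑1 cs ⟨
      length cs                                          ∎
      where
      open ≤-Reasoning
      cs = coefficients 2
      F : ℕ → Vec ℕ 2 → ℕ
      F l a = 𝟙 (hash b i a ≡ᵇ (hash b j a + l) %2^ b)
      F₀ : ∀ a → (hash b j a + 0) %2^ b ≡ hash b j a
      F₀ a = trans (cong (_%2^ b) (+-identityʳ (hash b j a))) (m<n⇒m%n≡m (top< b≤K (eval a j)))
      F-⊞ : ∀ l a → F l (a ⊞ d) ≡ F (suc l) a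
      F-⊞ l a = cong₂ (λ x y → 𝟙 (x ≡ᵇ y)) (hash-⊞-fixed b a d i fixed)
        (trans (cong (λ z → (z + l) %2^ b) (hash-⊞-moved b b≤K a d j moved))
          (trans (%2^-idemˡ b (hash b j a + 1) l) (cong (_%2^ b) (+-assoc (hash b j a) 1 l))))
      F-respects : ∀ l → Respects (2 ^ K) (λ a → pos (F l a))
      F-respects l a c h = cong₂ (λ x y → pos (𝟙 (x ≡ᵇ (y + l) %2^ b))) (top-cong K b (h i)) (top-cong K b (h j))
      next : ∀ l → ∑ cs (F (suc l)) ≡ ∑ cs (F l)
      next l = ℤₚ.+-injective (trans (sym (∑ᶻ-pos cs (F (suc l)))) (trans (∑ᶻ-cong cs (λ a → cong pos (sym (F-⊞ l a))))
        (trans (∑ᶻ-⊞ (2 ^ K) 2 (λ a → pos (F l a)) (F-respects l) d) (∑ᶻ-pos cs (F l)))))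
      all-equal : ∀ l → ∑ cs (F l) ≡ ∑ cs (F 0)
      all-equal zero    = refl
      all-equal (suc l) = trans (next l) (all-equal l)
      one-shift : ∀ a → ∑ (downFrom (2 ^ b)) (λ l → F l a) ≡ 1
      one-shift a = ℤₚ.+-injective (trans (sym (∑ᶻ-pos (downFrom (2 ^ b)) (λ l → F l a)))
        (trans (∑ᶻ-cong (downFrom (2 ^ b)) (λ l → cong (λ z → pos (𝟙 (x ≡ᵇ z %2^ b))) (+-comm (hash b j a) l)))
        (trans (∑ᶻ-shift (2 ^ b) (λ l → pos (𝟙 (x ≡ᵇ l %2^ b))) (λ l → cong (λ z → pos (𝟙 (x ≡ᵇ z))) ([m+n]%n≡m%n l (2 ^ b))) (hash b j a))
        (trans (∑ᶻ-cong< (2 ^ b) (λ l l< → cong (λ z → pos (𝟙 (x ≡ᵇ z))) (m<n⇒m%n≡m l<)))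
        (trans (∑ᶻ-cong (downFrom (2 ^ b)) (λ l → sym (ℤₚ.*-identityʳ (pos (𝟙 (x ≡ᵇ l))))))
          (∑ᶻ-pick (2 ^ b) x (λ _ → 1ℤ) (top< b≤K (eval a i))))))))
        where x = hash b i a

-- The failure probability of a single sketch

∑>0⇒∃ : ∀ n (f : ℕ → ℕ) → 0 < ∑ (downFrom n) f → ∃ λ i → i < n × 0 < f i
∑>0⇒∃ (suc n) f lt with f n in eq
... | suc k = n , ≤-refl , subst (0 <_) (sym eq) (s≤s z≤n)
... | zero with ∑>0⇒∃ n f lt
... | i , i<n , p = i , m<n⇒m<1+n i<n , p

𝟙>0 : ∀ b → 0 < 𝟙 b → b ≡ true
𝟙>0 true _ = refl

𝟙*≤ : ∀ b {x y} → (b ≡ true → x ≤ y) → 𝟙 b * x ≤ y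
𝟙*≤ false h = z≤n
𝟙*≤ true  h = ≤-trans (≤-reflexive (+-identityʳ _)) (h refl)

anyBelow : ℕ → (ℕ → Bool) → Bool
anyBelow n p = 0 <ᵇ ∑ (downFrom n) (λ i → 𝟙 (p i))

anyBelow⁻ : ∀ n p → anyBelow n p ≡ true → ∃ λ i → i < n × p i ≡ true
anyBelow⁻ n p h with ∑>0⇒∃ n (λ i → 𝟙 (p i)) (<ᵇ⇒< 0 (∑ (downFrom n) (λ i → 𝟙 (p i))) (subst T (sym h) tt))
... | i , i<n , q = i , i<n , 𝟙>0 (p i) q

T⇒≡true : ∀ {b} → T b → b ≡ true
T⇒≡true {true} _ = refl

anyBelow⁺ : ∀ n p i → i < n → p i ≡ true → anyBelow n p ≡ true
anyBelow⁺ n p i i<n h = T⇒≡true (<⇒<ᵇ (≤-trans (≤-reflexive (sym (cong 𝟙 h))) (∑-term (λ i → 𝟙 (p i)) (∈-downFrom i<n))))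

∑ᶻ-∸ : ∀ {a} {A : Set a} (xs : List A) (f g h : A → ℤ) → (∀ x → h x ≡ f x -ᶻ g x) → ∑ᶻ xs h ≡ ∑ᶻ xs f -ᶻ ∑ᶻ xs g
∑ᶻ-∸ []       f g h eq = refl
∑ᶻ-∸ (x ∷ xs) f g h eq = trans (cong₂ _+ᶻ_ (eq x) (∑ᶻ-∸ xs f g h eq)) (e (f x) (g x) (∑ᶻ xs f) (∑ᶻ xs g))
  where
  e : ∀ a b c d → (a -ᶻ b) +ᶻ (c -ᶻ d) ≡ (a +ᶻ c) -ᶻ (b +ᶻ d)
  e = ℤ-Solver.solve-∀

pos-∸ : ∀ x y → y ≤ x → pos (x ∸ y) ≡ pos x -ᶻ pos y
pos-∸ x y le = sym (trans (ℤₚ.m-n≡m⊖n x y) (ℤₚ.⊖-≥ le))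

∸-square : ∀ x y → y ≤ x → (x ∸ y) * (x ∸ y) + y * y ≤ x * x
∸-square x y le with d , refl ← m≤n⇒∃[o]m+o≡n le =
  ≤-trans (≤-reflexive (cong (λ z → z * z + y * y) (m+n∸m≡n y d)))
    (≤-trans (m≤m+n _ (2 * (y * d))) (≤-reflexive (e y d)))
  where
  e : ∀ y d → d * d + y * y + 2 * (y * d) ≡ (y + d) * (y + d)
  e = ℕ-Solver.solve-∀

triangle≤square : ∀ n (g : ℕ → ℕ) →
  2 * ∑ (downFrom n) (λ j → ∑ (downFrom j) (λ i → g i * g j)) ≤ ∑ (downFrom n) g * ∑ (downFrom n) g
triangle≤square zero    g = z≤n
triangle≤square (suc n) g = begin
  2 * (∑ (downFrom n) (λ i → g i * g n) + R)  ≡⟨ trans (cong (λ z → 2 * (z + R)) (∑-*ʳ (downFrom n) g (g n))) (e₁ S (g n) R) ⟩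
  2 * (g n * S) + 2 * R                       ≤⟨ +-mono-≤ (m≤m+n _ (g n * g n)) (triangle≤square n g) ⟩
  2 * (g n * S) + g n * g n + S * S           ≡⟨ e₂ (g n) S ⟩
  (g n + S) * (g n + S)                       ∎
  where
  open ≤-Reasoning
  S = ∑ (downFrom n) g
  R = ∑ (downFrom n) (λ j → ∑ (downFrom j) (λ i → g i * g j))
  e₁ : ∀ S x R → 2 * (S * x + R) ≡ 2 * (x * S) + 2 * R
  e₁ = ℕ-Solver.solve-∀
  e₂ : ∀ x S → 2 * (x * S) + x * x + S * S ≡ (x + S) * (x + S)
  e₂ = ℕ-Solver.solve-∀

-- Signs and buckets come from separate spaces `Ωs` and `Hs`, because the signs are averaged first,
-- with the buckets held fixed.
module Tail {Ω H : Set} (Ωs : List Ω) (Hs : List H) (sign : ℕ → Ω → ℤ) (hash : ℕ → H → ℕ) (B n : ℕ)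
  (sign² : ∀ j ω → sign j ω *ᶻ sign j ω ≡ 1ℤ)
  (vanish : ∀ j → j < n → ∀ ys → All (_< j) ys → length ys ≤ 7 →
            ∑ᶻ Ωs (λ ω → sign j ω *ᶻ monomial sign ys ω) ≡ 0ℤ)
  (collision : ∀ i j → i < j → j < n → ∑ Hs (λ a → 𝟙 (hash i a ≡ᵇ hash j a)) * B ≤ length Hs)
  (f : ℕ → ℕ → ℕ) (f-mono : ∀ {s t} → s ≤ t → ∀ i → f s i ≤ f t i) (f₀ : ∀ i → f 0 i ≡ 0) (m : ℕ) where

  private
    N = length Ωs
    module Mt = Moment Ωs sign n sign² vanish

  F₂ᵐ : ℕ
  F₂ᵐ = ∑ (downFrom n) (λ i → f m i * f m i)

  collide : H → ℕ → ℕ → ℕ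
  collide a i j = 𝟙 (hash i a ≡ᵇ hash j a)

  coupling : H → ℕ → ℕ → ℕ → ℕ
  coupling a t j i = 2 * (f t i * f t j) * collide a i j

  -- the error of the sketch after t items
  deviation : H → ℕ → Ω → ℤ
  deviation a t ω = ∑ᶻ (downFrom n) (λ j → sign j ω *ᶻ ∑ᶻ (downFrom j) (λ i → sign i ω *ᶻ pos (coupling a t j i)))

  coupling-mono : ∀ a {s t} → s ≤ t → ∀ j i → coupling a s j i ≤ coupling a t j i
  coupling-mono a s≤t j i = *-monoˡ-≤ (collide a i j) (*-monoʳ-≤ 2 (*-mono-≤ (f-mono s≤t i) (f-mono s≤t j)))

  private
    μ : H → ℕ → ℕ
    μ a t = Mt.total-energy (coupling a t) n

    μ-mono : ∀ a {s t} → s ≤ t → μ a s ≤ μ a t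
    μ-mono a s≤t = ∑-mono (downFrom n) λ j → ∑-mono (downFrom j) λ i → *-mono-≤ (coupling-mono a s≤t j i) (coupling-mono a s≤t j i)

    increment : H → ℕ → ℕ → ℕ → ℕ → ℕ
    increment a s t j i = coupling a t j i ∸ coupling a s j i

    -- Items are only inserted, so couplings grow, and (x - y)² ≤ x² - y² for y ≤ x. The energy of
    -- an increment is thus bounded by the increase of the energy, as the maximal inequality
    -- requires.
    increment-energy : ∀ a s t → s ≤ t → Mt.total-energy (increment a s t) n ≤ μ a t ∸ μ a s
    increment-energy a s t s≤t = m+n≤o⇒m≤o∸n _ (≤-trans (≤-reflexive (sym (trans
        (∑-cong (downFrom n) λ j → ∑-+ (downFrom j) (λ i → increment a s t j i * increment a s t j i) (λ i → coupling a s j i * coupling a s j i))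
        (∑-+ (downFrom n) (λ j → Mt.energy (increment a s t j) j) (λ j → Mt.energy (coupling a s j) j)))))
      (∑-mono (downFrom n) λ j → ∑-mono (downFrom j) λ i → ∸-square (coupling a t j i) (coupling a s j i) (coupling-mono a s≤t j i)))

    deviation-∸ : ∀ a s t → s ≤ t → ∀ ω → Mt.quadratic (increment a s t) n ω ≡ deviation a t ω -ᶻ deviation a s ω
    deviation-∸ a s t s≤t ω = ∑ᶻ-∸ (downFrom n) _ _ _ λ j → trans (cong (sign j ω *ᶻ_)
      (∑ᶻ-∸ (downFrom j) _ _ _ λ i → trans (cong (sign i ω *ᶻ_) (pos-∸ (coupling a t j i) (coupling a s j i) (coupling-mono a s≤t j i)))
        (distrib (sign i ω) (pos (coupling a t j i)) (pos (coupling a s j i)))))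
        (distrib (sign j ω) (Mt.linear (coupling a t j) j ω) (Mt.linear (coupling a s j) j ω))
      where
      distrib : ∀ x y z → x *ᶻ (y -ᶻ z) ≡ x *ᶻ y -ᶻ x *ᶻ z
      distrib = ℤ-Solver.solve-∀

    increments : ∀ a s t → s ≤ t → ∑ Ωs (λ ω → fourth (deviation a t ω -ᶻ deviation a s ω)) ≤ N * 27 * ((μ a t ∸ μ a s) * (μ a t ∸ μ a s))
    increments a s t s≤t = begin
      ∑ Ωs (λ ω → fourth (deviation a t ω -ᶻ deviation a s ω))  ≡⟨ ∑-cong Ωs (λ ω → cong fourth (sym (deviation-∸ a s t s≤t ω))) ⟩
      ∑ Ωs (λ ω → fourth (Mt.quadratic (increment a s t) n ω))  ≤⟨ Mt.quadratic-fourth (increment a s t) n ≤-refl ⟩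
      N * (27 * (τ * τ))                                        ≡⟨ *-assoc N 27 (τ * τ) ⟨
      N * 27 * (τ * τ)                                          ≤⟨ *-monoʳ-≤ (N * 27) (*-mono-≤ (increment-energy a s t s≤t) (increment-energy a s t s≤t)) ⟩
      N * 27 * ((μ a t ∸ μ a s) * (μ a t ∸ μ a s))              ∎
      where
      open ≤-Reasoning
      τ = Mt.total-energy (increment a s t) n

    deviation₀ : ∀ a ω → deviation a 0 ω ≡ 0ℤ
    deviation₀ a ω = trans (∑ᶻ-cong (downFrom n) λ j → trans (cong (sign j ω *ᶻ_) (trans (∑ᶻ-cong (downFrom j) λ i →
      trans (cong (λ z → sign i ω *ᶻ pos z) (cong (λ z → 2 * (z * f 0 j) * collide a i j) (f₀ i))) (ℤₚ.*-zeroʳ (sign i ω)))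
      (∑ᶻ-zero (downFrom j)))) (ℤₚ.*-zeroʳ (sign j ω))) (∑ᶻ-zero (downFrom n))

    maximal : ∀ a → ∃ λ (M : Ω → ℕ) → (∀ t ω → t ≤ m → fourth (deviation a t ω) ≤ M ω) × ∑ Ωs M ≤ N * 27 * (μ a m * μ a m) * 500
    maximal a = proj₁ bd , (λ t ω t≤m → ≤-trans (≤-reflexive (cong fourth (sym (minus-zero (deviation a t ω) (deviation₀ a ω))))) (proj₁ (proj₂ bd) t ω z≤n t≤m)) ,
        ≤-trans (proj₂ (proj₂ bd)) (*-monoˡ-≤ 500 (*-monoʳ-≤ (N * 27) (*-mono-≤ (m∸n≤m (μ a m) (μ a 0)) (m∸n≤m (μ a m) (μ a 0)))))
      where
      bd = Maximal.bound Ωs (deviation a) (μ a) (μ-mono a) (N * 27) (increments a) m 0 m ≤-refl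
      minus-zero : ∀ x {y} → y ≡ 0ℤ → x -ᶻ y ≡ x
      minus-zero x refl = ℤₚ.+-identityʳ x

    coupling-square : ∀ a t j i → coupling a t j i * coupling a t j i ≡ 4 * (f t i * f t i * (f t j * f t j)) * collide a i j
    coupling-square a t j i = trans (e (f t i) (f t j) (collide a i j)) (cong (4 * (f t i * f t i * (f t j * f t j)) *_) (idem (hash i a ≡ᵇ hash j a)))
      where
      e : ∀ x y z → 2 * (x * y) * z * (2 * (x * y) * z) ≡ 4 * (x * x * (y * y)) * (z * z)
      e = ℕ-Solver.solve-∀
      idem : ∀ c → 𝟙 c * 𝟙 c ≡ 𝟙 c
      idem false = refl
      idem true  = refl

    -- A squared coupling is 4 fᵢ² fⱼ² on a collision, which has probability at most 1/`B`, and the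
    -- sum of fᵢ² fⱼ² over i < j is at most half the square of `F₂ᵐ`.
    variance : ∑ Hs (λ a → μ a m) * B ≤ length Hs * (2 * (F₂ᵐ * F₂ᵐ))
    variance = begin
      ∑ Hs (λ a → μ a m) * B
        ≡⟨ cong (_* B) (trans (∑-swap Hs (downFrom n) (λ a j → Mt.energy (coupling a m j) j)) (∑-cong (downFrom n) λ j → ∑-swap Hs (downFrom j) (λ a i → coupling a m j i * coupling a m j i))) ⟩
      ∑ (downFrom n) (λ j → ∑ (downFrom j) (λ i → ∑ Hs (λ a → coupling a m j i * coupling a m j i))) * B
        ≡⟨ trans (sym (∑-*ʳ (downFrom n) _ (B))) (∑-cong (downFrom n) λ j → sym (∑-*ʳ (downFrom j) _ (B))) ⟩
      ∑ (downFrom n) (λ j → ∑ (downFrom j) (λ i → ∑ Hs (λ a → coupling a m j i * coupling a m j i) * B))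
        ≤⟨ ∑-mono< n (λ j j<n → ∑-mono< j λ i i<j → pair i j i<j j<n) ⟩
      ∑ (downFrom n) (λ j → ∑ (downFrom j) (λ i → length Hs * 4 * (g i * g j)))
        ≡⟨ trans (∑-cong (downFrom n) λ j → ∑-*ˡ (downFrom j) (length Hs * 4) _) (∑-*ˡ (downFrom n) (length Hs * 4) _) ⟩
      length Hs * 4 * R                        ≡⟨ e (length Hs) R ⟩
      length Hs * (2 * (2 * R))                ≤⟨ *-monoʳ-≤ (length Hs) (*-monoʳ-≤ 2 (triangle≤square n g)) ⟩
      length Hs * (2 * (F₂ᵐ * F₂ᵐ))            ∎
      where
      open ≤-Reasoning
      g : ℕ → ℕ
      g i = f m i * f m i
      R = ∑ (downFrom n) (λ j → ∑ (downFrom j) (λ i → g i * g j))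
      e : ∀ h R → h * 4 * R ≡ h * (2 * (2 * R))
      e = ℕ-Solver.solve-∀
      pair : ∀ i j → i < j → j < n → ∑ Hs (λ a → coupling a m j i * coupling a m j i) * B ≤ length Hs * 4 * (g i * g j)
      pair i j i<j j<n = begin
        ∑ Hs (λ a → coupling a m j i * coupling a m j i) * B
          ≡⟨ cong (_* B) (trans (∑-cong Hs (λ a → coupling-square a m j i)) (∑-*ˡ Hs (4 * (g i * g j)) (λ a → collide a i j))) ⟩
        4 * (g i * g j) * ∑ Hs (λ a → collide a i j) * B    ≡⟨ *-assoc (4 * (g i * g j)) _ (B) ⟩
        4 * (g i * g j) * (∑ Hs (λ a → collide a i j) * B)  ≤⟨ *-monoʳ-≤ (4 * (g i * g j)) (collision i j i<j j<n) ⟩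
        4 * (g i * g j) * length Hs                             ≡⟨ e₂ (g i * g j) (length Hs) ⟩
        length Hs * 4 * (g i * g j)                             ∎
        where
        e₂ : ∀ x h → 4 * x * h ≡ h * 4 * x
        e₂ = ℕ-Solver.solve-∀

  module _ (E : ℕ) where

    -- E is the reciprocal of the relative accuracy
    bad : H → Ω → Bool
    bad a ω = anyBelow (suc m) (λ t → F₂ᵐ <ᵇ ∣ deviation a t ω ∣ * E)

    private
      #badₐ : H → ℕ
      #badₐ a = ∑ Ωs (λ ω → 𝟙 (bad a ω))

      F² = F₂ᵐ * F₂ᵐ

      markov : ∀ a → #badₐ a * (F² * F²) ≤ N * 27 * (μ a m * μ a m) * 500 * (E * E * (E * E))
      markov a = begin
        #badₐ a * (F² * F²)                   ≡⟨ ∑-*ʳ Ωs (λ ω → 𝟙 (bad a ω)) (F² * F²) ⟨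
        ∑ Ωs (λ ω → 𝟙 (bad a ω) * (F² * F²))  ≤⟨ ∑-mono Ωs (λ ω → 𝟙*≤ (bad a ω) (λ eq → each ω (anyBelow⁻ (suc m) (λ t → F₂ᵐ <ᵇ ∣ deviation a t ω ∣ * E) eq))) ⟩
        ∑ Ωs (λ ω → M ω * (E * E * (E * E)))  ≡⟨ ∑-*ʳ Ωs M (E * E * (E * E)) ⟩
        ∑ Ωs M * (E * E * (E * E))            ≤⟨ *-monoˡ-≤ (E * E * (E * E)) (proj₂ (proj₂ (maximal a))) ⟩
        N * 27 * (μ a m * μ a m) * 500 * (E * E * (E * E)) ∎
        where
        open ≤-Reasoning
        M = proj₁ (maximal a)
        e : ∀ x E → x * E * (x * E) * (x * E * (x * E)) ≡ x * x * (x * x) * (E * E * (E * E))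
        e = ℕ-Solver.solve-∀
        exceeds : ∀ x → (F₂ᵐ <ᵇ x * E) ≡ true → F² * F² ≤ x * x * (x * x) * (E * E * (E * E))
        exceeds x p = ≤-trans (*-mono-≤ (*-mono-≤ F≤ F≤) (*-mono-≤ F≤ F≤)) (≤-reflexive (e x E))
          where
          F≤ : F₂ᵐ ≤ x * E
          F≤ = <⇒≤ (<ᵇ⇒< F₂ᵐ (x * E) (subst T (sym p) tt))
        each : ∀ ω → (∃ λ t → t < suc m × (F₂ᵐ <ᵇ ∣ deviation a t ω ∣ * E) ≡ true) → F² * F² ≤ M ω * (E * E * (E * E))
        each ω (t , t≤m , p) = ≤-trans (exceeds ∣ deviation a t ω ∣ p)
          (*-monoˡ-≤ (E * E * (E * E)) (proj₁ (proj₂ (maximal a)) t ω (s≤s⁻¹ t≤m)))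

      -- A probability is at most 1, hence at most the square root of any bound on it. This makes
      -- the bound linear in `μ`, whose mean over the buckets involves only pairwise collisions,
      -- unlike the mean of its square. The constant is 117² = 13689 ≥ 27 · 500.
      root : ∀ a → #badₐ a * F² ≤ N * (E * E) * 117 * μ a m
      root a = square-cancel-≤ (begin
        #badₐ a * F² * (#badₐ a * F²)                                ≡⟨ e₁ (#badₐ a) F² ⟩
        #badₐ a * (#badₐ a * (F² * F²))                              ≤⟨ *-mono-≤ #bad≤N (markov a) ⟩
        N * (N * 27 * (μ a m * μ a m) * 500 * (E * E * (E * E)))     ≡⟨ e₂ N (μ a m) (E * E) 27 500 ⟩
        N * (E * E) * μ a m * (N * (E * E) * μ a m) * (27 * 500)        ≤⟨ *-monoʳ-≤ (N * (E * E) * μ a m * (N * (E * E) * μ a m)) (m≤m+n (27 * 500) 189) ⟩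
        N * (E * E) * μ a m * (N * (E * E) * μ a m) * (117 * 117)        ≡⟨ e₃ (N * (E * E)) (μ a m) 117 ⟩
        N * (E * E) * 117 * μ a m * (N * (E * E) * 117 * μ a m)      ∎)
        where
        open ≤-Reasoning
        #bad≤N : #badₐ a ≤ N
        #bad≤N = ≤-trans (∑-mono Ωs (λ ω → 𝟙≤1 (bad a ω))) (≤-reflexive (sym (length≡∑1 Ωs)))
        e₁ : ∀ x F → x * F * (x * F) ≡ x * (x * (F * F))
        e₁ = ℕ-Solver.solve-∀
        e₂ : ∀ N μ E c d → N * (N * c * (μ * μ) * d * (E * E)) ≡ N * E * μ * (N * E * μ) * (c * d)
        e₂ = ℕ-Solver.solve-∀
        e₃ : ∀ x μ c → x * μ * (x * μ) * (c * c) ≡ x * c * μ * (x * c * μ)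
        e₃ = ℕ-Solver.solve-∀

    failure-probability : 0 < F₂ᵐ →
      ∑ Hs (λ a → ∑ Ωs (λ ω → 𝟙 (bad a ω))) * B ≤ length Hs * length Ωs * (E * E) * (117 * 2)
    failure-probability F>0 = *-cancelʳ-≤ _ _ F² {{>-nonZero (*-mono-< F>0 F>0)}} (begin
      ∑ Hs #badₐ * B * F²                        ≡⟨ e₁ (∑ Hs #badₐ) (B) F² ⟩
      ∑ Hs #badₐ * F² * B                        ≡⟨ cong (_* B) (∑-*ʳ Hs #badₐ F²) ⟨
      ∑ Hs (λ a → #badₐ a * F²) * B              ≤⟨ *-monoˡ-≤ (B) (∑-mono Hs root) ⟩
      ∑ Hs (λ a → N * (E * E) * 117 * μ a m) * B ≡⟨ cong (_* B) (∑-*ˡ Hs (N * (E * E) * 117) (λ a → μ a m)) ⟩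
      N * (E * E) * 117 * ∑ Hs (λ a → μ a m) * B ≡⟨ *-assoc (N * (E * E) * 117) _ (B) ⟩
      N * (E * E) * 117 * (∑ Hs (λ a → μ a m) * B) ≤⟨ *-monoʳ-≤ (N * (E * E) * 117) variance ⟩
      N * (E * E) * 117 * (length Hs * (2 * F²))     ≡⟨ e₂ N (E * E) (length Hs) F² 117 ⟩
      length Hs * N * (E * E) * (117 * 2) * F²             ∎)
      where
      open ≤-Reasoning
      e₁ : ∀ x y z → x * y * z ≡ x * z * y
      e₁ = ℕ-Solver.solve-∀
      e₂ : ∀ N E H F c → N * E * c * (H * (2 * F)) ≡ H * N * E * (c * 2) * F
      e₂ = ℕ-Solver.solve-∀

-- The sketch of a history

∑ᶻ-* : ∀ {a b} {A : Set a} {B : Set b} (xs : List A) (ys : List B) (f : A → ℤ) (g : B → ℤ) →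
  ∑ᶻ xs f *ᶻ ∑ᶻ ys g ≡ ∑ᶻ xs (λ x → ∑ᶻ ys (λ y → f x *ᶻ g y))
∑ᶻ-* xs ys f g = trans (sym (∑ᶻ-*ʳ xs f (∑ᶻ ys g))) (∑ᶻ-cong xs (λ x → sym (∑ᶻ-*ˡ ys (f x) g)))

∑ᶻ-square : ∀ n (φ : ℕ → ℕ → ℤ) → (∀ i j → φ i j ≡ φ j i) →
  ∑ᶻ (downFrom n) (λ i → ∑ᶻ (downFrom n) (φ i)) ≡
  ∑ᶻ (downFrom n) (λ i → φ i i) +ᶻ ∑ᶻ (downFrom n) (λ j → ∑ᶻ (downFrom j) (λ i → φ i j +ᶻ φ i j))
∑ᶻ-square zero    φ symm = refl
∑ᶻ-square (suc n) φ symm = begin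
  φ n n +ᶻ ∑ᶻ ds (φ n) +ᶻ ∑ᶻ ds (λ i → φ i n +ᶻ ∑ᶻ ds (φ i))
    ≡⟨ cong₂ (λ x y → φ n n +ᶻ x +ᶻ y) (∑ᶻ-cong ds (λ i → symm n i)) (trans (∑ᶻ-+ ds (λ i → φ i n) (λ i → ∑ᶻ ds (φ i))) (cong (R +ᶻ_) (∑ᶻ-square n φ symm))) ⟩
  φ n n +ᶻ R +ᶻ (R +ᶻ (D +ᶻ S))          ≡⟨ e (φ n n) R D S ⟩
  (φ n n +ᶻ D) +ᶻ ((R +ᶻ R) +ᶻ S)        ≡⟨ cong (λ z → (φ n n +ᶻ D) +ᶻ (z +ᶻ S)) (sym (∑ᶻ-+ ds (λ i → φ i n) (λ i → φ i n))) ⟩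
  (φ n n +ᶻ D) +ᶻ (∑ᶻ ds (λ i → φ i n +ᶻ φ i n) +ᶻ S) ∎
  where
  open ≡-Reasoning
  ds = downFrom n
  R = ∑ᶻ ds (λ i → φ i n)
  D = ∑ᶻ ds (λ i → φ i i)
  S = ∑ᶻ ds (λ j → ∑ᶻ (downFrom j) (λ i → φ i j +ᶻ φ i j))
  e : ∀ a R D S → a +ᶻ R +ᶻ (R +ᶻ (D +ᶻ S)) ≡ (a +ᶻ D) +ᶻ ((R +ᶻ R) +ᶻ S)
  e = ℤ-Solver.solve-∀

count : List ℕ → ℕ → ℕ
count p i = ∑ p (λ x → 𝟙 (x ≡ᵇ i))

∑ᶻ-count : ∀ n p → All (_< n) p → (φ : ℕ → ℤ) → ∑ᶻ p φ ≡ ∑ᶻ (downFrom n) (λ i → pos (count p i) *ᶻ φ i)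
∑ᶻ-count n []      []         φ = sym (∑ᶻ-zero (downFrom n))
∑ᶻ-count n (x ∷ p) (lt ∷ lts) φ = sym (trans
  (∑ᶻ-cong (downFrom n) (λ i → ℤₚ.*-distribʳ-+ (φ i) (pos (𝟙 (x ≡ᵇ i))) (pos (count p i))))
  (trans (∑ᶻ-+ (downFrom n) (λ i → pos (𝟙 (x ≡ᵇ i)) *ᶻ φ i) (λ i → pos (count p i) *ᶻ φ i))
    (cong₂ _+ᶻ_ (∑ᶻ-pick n x φ lt) (sym (∑ᶻ-count n p lts φ)))))

≡ᵇ-sym : ∀ m n → (m ≡ᵇ n) ≡ (n ≡ᵇ m)
≡ᵇ-sym zero    zero    = refl
≡ᵇ-sym zero    (suc n) = refl
≡ᵇ-sym (suc m) zero    = refl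
≡ᵇ-sym (suc m) (suc n) = ≡ᵇ-sym m n

≡ᵇ-+ʳ : ∀ x y k → (x + k ≡ᵇ y + k) ≡ (x ≡ᵇ y)
≡ᵇ-+ʳ x y zero    = cong₂ _≡ᵇ_ (+-identityʳ x) (+-identityʳ y)
≡ᵇ-+ʳ x y (suc k) = trans (cong₂ _≡ᵇ_ (+-suc x k) (+-suc y k)) (≡ᵇ-+ʳ x y k)

module Sketch (B : ℕ) (h σ : ℕ → ℕ) (h<B : ∀ x → h x < B) (σ<2 : ∀ x → σ x < 2) where

  -- Each bucket has a counter for either sign: own x counts the sign of x, other x the opposite sign.
  own other : ℕ → ℕ
  own x   = h x + σ x * B
  other x = h x + (1 ∸ σ x) * B

  private
    code< : ∀ {x s} → x < B → s < 2 → x + s * B < B + B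
    code< {x} {0} x<B _ = ≤-trans (≤-trans (s≤s (≤-reflexive (+-identityʳ x))) x<B) (m≤m+n B B)
    code< {x} {1} x<B _ = +-mono-<-≤ x<B (≤-reflexive (+-identityʳ B))
    code< {x} {suc (suc s)} x<B (s≤s (s≤s ()))

  own< : ∀ x → own x < B + B
  own< x = code< (h<B x) (σ<2 x)

  other< : ∀ x → other x < B + B
  other< x = code< (h<B x) (s≤s (m∸n≤m 1 (σ x)))

  counter : List ℕ → ℕ → ℕ
  counter p v = ∑ p (λ y → 𝟙 (own y ≡ᵇ v))

  -- The kernel of the sketch: when the squares are opened, the value of a history becomes the sum
  -- of `κ` over all ordered pairs of its items.
  κ : ℕ → ℕ → ℤ
  κ x y = sgn (σ x) *ᶻ sgn (σ y) *ᶻ pos (𝟙 (h x ≡ᵇ h y))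

  κ-sym : ∀ x y → κ x y ≡ κ y x
  κ-sym x y = cong₂ _*ᶻ_ (ℤₚ.*-comm (sgn (σ x)) (sgn (σ y))) (cong (λ b → pos (𝟙 b)) (≡ᵇ-sym (h x) (h y)))

  κ-refl : ∀ x → κ x x ≡ 1ℤ
  κ-refl x = cong₂ (λ z b → z *ᶻ pos (𝟙 b)) (sgn² (σ x)) (≡ᵇ-refl (h x))

  -- Within a bucket, the product of two signs is the indicator that they agree minus the indicator
  -- that they differ. With a counter for either sign, no negative number has to be stored.
  κ-own-other : ∀ x y → κ x y ≡ pos (𝟙 (own x ≡ᵇ own y)) -ᶻ pos (𝟙 (own x ≡ᵇ other y))
  κ-own-other x y = go (σ x) (σ y) (σ<2 x) (σ<2 y)
    where
    low : ∀ {x} y → x < B → (x + 0 ≡ᵇ y + (B + 0)) ≡ false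
    low {x} y x<B = ≢⇒≡ᵇ (x + 0) (y + (B + 0)) (<⇒≢ (≤-trans (≤-trans (s≤s (≤-reflexive (+-identityʳ x))) x<B)
      (≤-trans (m≤n+m B y) (≤-reflexive (cong (y +_) (sym (+-identityʳ B)))))))
    high : ∀ x {y} → y < B → (x + (B + 0) ≡ᵇ y + 0) ≡ false
    high x {y} y<B = trans (≡ᵇ-sym (x + (B + 0)) (y + 0)) (low x y<B)
    plus : ∀ k → 1ℤ *ᶻ pos k ≡ pos k -ᶻ 0ℤ
    plus k = trans (ℤₚ.*-identityˡ (pos k)) (sym (ℤₚ.+-identityʳ (pos k)))
    minus : ∀ k → ℤ.-1ℤ *ᶻ pos k ≡ 0ℤ -ᶻ pos k
    minus k = trans (ℤₚ.-1*i≡-i (pos k)) (sym (ℤₚ.+-identityˡ (-ᶻ pos k)))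
    c = 𝟙 (h x ≡ᵇ h y)
    difference : ∀ {b b′ d d′} → b′ ≡ b → d′ ≡ d → pos (𝟙 b) -ᶻ pos (𝟙 d) ≡ pos (𝟙 b′) -ᶻ pos (𝟙 d′)
    difference refl refl = refl
    go : ∀ s t → s < 2 → t < 2 → sgn s *ᶻ sgn t *ᶻ pos c ≡
         pos (𝟙 (h x + s * B ≡ᵇ h y + t * B)) -ᶻ pos (𝟙 (h x + s * B ≡ᵇ h y + (1 ∸ t) * B))
    go 0 0 _ _ = trans (plus c) (difference (≡ᵇ-+ʳ (h x) (h y) 0) (low (h y) (h<B x)))
    go 0 1 _ _ = trans (minus c) (difference (low (h y) (h<B x)) (≡ᵇ-+ʳ (h x) (h y) 0))
    go 1 0 _ _ = trans (minus c) (difference (high (h x) (h<B y)) (≡ᵇ-+ʳ (h x) (h y) (B + 0)))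
    go 1 1 _ _ = trans (plus c) (difference (≡ᵇ-+ʳ (h x) (h y) (B + 0)) (high (h x) (h<B y)))
    go (suc (suc s)) t (s≤s (s≤s ()))
    go 0 (suc (suc t)) _ (s≤s (s≤s ()))
    go 1 (suc (suc t)) _ (s≤s (s≤s ()))

  signed-size : List ℕ → ℕ → ℤ
  signed-size p b = ∑ᶻ p (λ x → sgn (σ x) *ᶻ pos (𝟙 (h x ≡ᵇ b)))

  value : List ℕ → ℕ
  value p = ∑ (downFrom B) (λ b → sq (signed-size p b))

  value-κ : ∀ p → pos (value p) ≡ ∑ᶻ p (λ x → ∑ᶻ p (κ x))
  value-κ p = begin
    pos (value p)
      ≡⟨ ∑ᶻ-pos (downFrom B) (λ b → sq (signed-size p b)) ⟨
    ∑ᶻ (downFrom B) (λ b → pos (sq (signed-size p b)))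
      ≡⟨ ∑ᶻ-cong (downFrom B) (λ b → trans (pos-sq (signed-size p b)) (∑ᶻ-* p p (term b) (term b))) ⟩
    ∑ᶻ (downFrom B) (λ b → ∑ᶻ p (λ x → ∑ᶻ p (λ y → term b x *ᶻ term b y)))
      ≡⟨ trans (∑ᶻ-swap (downFrom B) p (λ b x → ∑ᶻ p (λ y → term b x *ᶻ term b y))) (∑ᶻ-cong p λ x → ∑ᶻ-swap (downFrom B) p (λ b y → term b x *ᶻ term b y)) ⟩
    ∑ᶻ p (λ x → ∑ᶻ p (λ y → ∑ᶻ (downFrom B) (λ b → term b x *ᶻ term b y)))
      ≡⟨ ∑ᶻ-cong p (λ x → ∑ᶻ-cong p (same-bucket x)) ⟩
    ∑ᶻ p (λ x → ∑ᶻ p (κ x)) ∎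
    where
    open ≡-Reasoning
    term : ℕ → ℕ → ℤ
    term b x = sgn (σ x) *ᶻ pos (𝟙 (h x ≡ᵇ b))
    e : ∀ s a t c → s *ᶻ a *ᶻ (t *ᶻ c) ≡ a *ᶻ (s *ᶻ t *ᶻ c)
    e = ℤ-Solver.solve-∀
    same-bucket : ∀ x y → ∑ᶻ (downFrom B) (λ b → term b x *ᶻ term b y) ≡ κ x y
    same-bucket x y = trans (∑ᶻ-cong (downFrom B) (λ b → e (sgn (σ x)) (pos (𝟙 (h x ≡ᵇ b))) (sgn (σ y)) (pos (𝟙 (h y ≡ᵇ b)))))
      (trans (∑ᶻ-pick B (h x) (λ b → sgn (σ x) *ᶻ sgn (σ y) *ᶻ pos (𝟙 (h y ≡ᵇ b))) (h<B x))
        (cong (λ b → sgn (σ x) *ᶻ sgn (σ y) *ᶻ pos (𝟙 b)) (≡ᵇ-sym (h y) (h x))))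

  -- The kernel gives the change caused by an item as 1 plus twice the difference of its two
  -- counters, so two lookups suffice for an update. That difference may be negative, hence the form
  -- without subtraction.
  value-∷ : ∀ a p → value (a ∷ p) + 2 * counter p (other a) ≡ value p + 2 * counter p (own a) + 1
  value-∷ a p = ℤₚ.+-injective (begin
    pos (value (a ∷ p) + 2 * C′)                             ≡⟨ cong (pos (value (a ∷ p)) +ᶻ_) (ℤₚ.pos-* 2 C′) ⟩
    pos (value (a ∷ p)) +ᶻ pos 2 *ᶻ pos C′                   ≡⟨ cong (_+ᶻ pos 2 *ᶻ pos C′) expand ⟩
    pos (value p) +ᶻ pos 2 *ᶻ (pos C -ᶻ pos C′) +ᶻ 1ℤ +ᶻ pos 2 *ᶻ pos C′ ≡⟨ e₁ (pos (value p)) (pos C) (pos C′) ⟩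
    pos (value p) +ᶻ pos 2 *ᶻ pos C +ᶻ 1ℤ                    ≡⟨ cong (λ z → pos (value p) +ᶻ z +ᶻ 1ℤ) (ℤₚ.pos-* 2 C) ⟨
    pos (value p + 2 * C + 1)                                ∎)
    where
    open ≡-Reasoning
    C = counter p (own a)
    C′ = counter p (other a)
    S = ∑ᶻ p (λ x → κ x a)
    S≡ : S ≡ pos C -ᶻ pos C′
    S≡ = trans (∑ᶻ-∸ p _ _ _ (λ x → κ-own-other x a)) (cong₂ _-ᶻ_ (∑ᶻ-pos p (λ x → 𝟙 (own x ≡ᵇ own a))) (∑ᶻ-pos p (λ x → 𝟙 (own x ≡ᵇ other a))))
    e₁ : ∀ z c d → z +ᶻ pos 2 *ᶻ (c -ᶻ d) +ᶻ 1ℤ +ᶻ pos 2 *ᶻ d ≡ z +ᶻ pos 2 *ᶻ c +ᶻ 1ℤ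
    e₁ = ℤ-Solver.solve-∀
    e₂ : ∀ s w → 1ℤ +ᶻ s +ᶻ (s +ᶻ w) ≡ w +ᶻ pos 2 *ᶻ s +ᶻ 1ℤ
    e₂ = ℤ-Solver.solve-∀
    expand : pos (value (a ∷ p)) ≡ pos (value p) +ᶻ pos 2 *ᶻ (pos C -ᶻ pos C′) +ᶻ 1ℤ
    expand = begin
      pos (value (a ∷ p))                                     ≡⟨ value-κ (a ∷ p) ⟩
      κ a a +ᶻ ∑ᶻ p (κ a) +ᶻ ∑ᶻ p (λ x → κ x a +ᶻ ∑ᶻ p (κ x)) ≡⟨ cong₂ _+ᶻ_ (cong₂ _+ᶻ_ (κ-refl a) (∑ᶻ-cong p (κ-sym a)))
        (trans (∑ᶻ-+ p (λ x → κ x a) (λ x → ∑ᶻ p (κ x))) (cong (S +ᶻ_) (sym (value-κ p)))) ⟩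
      1ℤ +ᶻ S +ᶻ (S +ᶻ pos (value p))                         ≡⟨ e₂ S (pos (value p)) ⟩
      pos (value p) +ᶻ pos 2 *ᶻ S +ᶻ 1ℤ                       ≡⟨ cong (λ z → pos (value p) +ᶻ pos 2 *ᶻ z +ᶻ 1ℤ) S≡ ⟩
      pos (value p) +ᶻ pos 2 *ᶻ (pos C -ᶻ pos C′) +ᶻ 1ℤ       ∎

  counter≤length : ∀ p v → counter p v ≤ length p
  counter≤length p v = ≤-trans (∑-mono p (λ y → 𝟙≤1 (own y ≡ᵇ v))) (≤-reflexive (sym (length≡∑1 p)))

  -- Excludes overflow: with words that can hold the square of the length of the stream, the stored
  -- value is exact.
  value≤ : ∀ p → value p ≤ length p * length p
  value≤ []      = ≤-reflexive (∑-zero (downFrom B))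
  value≤ (a ∷ p) = begin
    value (a ∷ p)                               ≤⟨ m≤m+n _ (2 * counter p (other a)) ⟩
    value (a ∷ p) + 2 * counter p (other a)     ≡⟨ value-∷ a p ⟩
    value p + 2 * counter p (own a) + 1         ≤⟨ +-monoˡ-≤ 1 (+-mono-≤ (value≤ p) (*-monoʳ-≤ 2 (counter≤length p (own a)))) ⟩
    length p * length p + 2 * length p + 1      ≡⟨ e (length p) ⟩
    suc (length p) * suc (length p)             ∎
    where
    open ≤-Reasoning
    e : ∀ l → l * l + 2 * l + 1 ≡ suc l * suc l
    e = ℕ-Solver.solve-∀

  -- Once items are grouped by value, the diagonal of the kernel gives the second frequency moment
  -- exactly, and each pair i < j occurs twice. The rest is the quadratic form that `Tail` bounds.
  value-deviation : ∀ n p → All (_< n) p → pos (value p) ≡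
    pos (∑ (downFrom n) (λ i → count p i * count p i)) +ᶻ
    ∑ᶻ (downFrom n) (λ j → sgn (σ j) *ᶻ ∑ᶻ (downFrom j) (λ i → sgn (σ i) *ᶻ pos (2 * (count p i * count p j) * 𝟙 (h i ≡ᵇ h j))))
  value-deviation n p lts = begin
    pos (value p)                             ≡⟨ value-κ p ⟩
    ∑ᶻ p (λ x → ∑ᶻ p (κ x))                   ≡⟨ ∑ᶻ-count n p lts (λ x → ∑ᶻ p (κ x)) ⟩
    ∑ᶻ ds (λ i → f i *ᶻ ∑ᶻ p (κ i))           ≡⟨ ∑ᶻ-cong ds (λ i → trans (cong (f i *ᶻ_) (∑ᶻ-count n p lts (κ i))) (sym (∑ᶻ-*ˡ ds (f i) _))) ⟩
    ∑ᶻ ds (λ i → ∑ᶻ ds (φ i))                 ≡⟨ ∑ᶻ-square n φ φ-sym ⟩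
    ∑ᶻ ds (λ i → φ i i) +ᶻ ∑ᶻ ds (λ j → ∑ᶻ (downFrom j) (λ i → φ i j +ᶻ φ i j))
      ≡⟨ cong₂ _+ᶻ_ (trans (∑ᶻ-cong ds diagonal) (∑ᶻ-pos ds (λ i → count p i * count p i)))
           (∑ᶻ-cong ds λ j → trans (∑ᶻ-cong (downFrom j) λ i → off-diagonal i j) (∑ᶻ-*ˡ (downFrom j) (sgn (σ j)) _)) ⟩
    _ ∎
    where
    open ≡-Reasoning
    ds = downFrom n
    f : ℕ → ℤ
    f i = pos (count p i)
    φ : ℕ → ℕ → ℤ
    φ i j = f i *ᶻ (f j *ᶻ κ i j)
    swap : ∀ a b c → a *ᶻ (b *ᶻ c) ≡ b *ᶻ (a *ᶻ c)
    swap = ℤ-Solver.solve-∀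
    φ-sym : ∀ i j → φ i j ≡ φ j i
    φ-sym i j = trans (swap (f i) (f j) (κ i j)) (cong (λ z → f j *ᶻ (f i *ᶻ z)) (κ-sym i j))
    diagonal : ∀ i → φ i i ≡ pos (count p i * count p i)
    diagonal i = trans (cong (λ z → f i *ᶻ (f i *ᶻ z)) (κ-refl i)) (trans (cong (f i *ᶻ_) (ℤₚ.*-identityʳ (f i))) (sym (ℤₚ.pos-* (count p i) (count p i))))
    e : ∀ a b s t c → a *ᶻ (b *ᶻ (s *ᶻ t *ᶻ c)) +ᶻ a *ᶻ (b *ᶻ (s *ᶻ t *ᶻ c)) ≡ t *ᶻ (s *ᶻ (pos 2 *ᶻ (a *ᶻ b) *ᶻ c))
    e = ℤ-Solver.solve-∀
    off-diagonal : ∀ i j → φ i j +ᶻ φ i j ≡ sgn (σ j) *ᶻ (sgn (σ i) *ᶻ pos (2 * (count p i * count p j) * 𝟙 (h i ≡ᵇ h j)))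
    off-diagonal i j = trans (e (f i) (f j) (sgn (σ i)) (sgn (σ j)) (pos (𝟙 (h i ≡ᵇ h j)))) (cong (λ z → sgn (σ j) *ᶻ (sgn (σ i) *ᶻ z))
      (sym (trans (ℤₚ.pos-* (2 * (count p i * count p j)) (𝟙 (h i ≡ᵇ h j))) (cong (_*ᶻ pos (𝟙 (h i ≡ᵇ h j)))
        (trans (ℤₚ.pos-* 2 (count p i * count p j)) (cong (pos 2 *ᶻ_) (ℤₚ.pos-* (count p i) (count p j))))))))

-- Frequencies of a stream and its reversed history

∑-tabulate : ∀ n {a} {A : Set a} (k : Fin n → A) (f : A → ℕ) (g : ℕ → ℕ) → (∀ i → f (k i) ≡ g (toℕ i)) →
  ∑ (List.tabulate k) f ≡ ∑ (downFrom n) g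
∑-tabulate zero    k f g eq = refl
∑-tabulate (suc n) k f g eq = trans (cong₂ _+_ (eq zero) (∑-tabulate n (λ i → k (suc i)) f (λ x → g (suc x)) (λ i → eq (suc i))))
  (trans (+-comm (g 0) _) (∑-rotate n g))

frequency≡count : ∀ {n} (as : Stream n) i → frequency as i ≡ count (map toℕ as) (toℕ i)
frequency≡count []       i = refl
frequency≡count (a ∷ as) i with a Finₚ.≟ i
... | yes refl = cong₂ _+_ (cong 𝟙 (sym (≡ᵇ-refl (toℕ a)))) (frequency≡count as i)
... | no  a≢i  = trans (frequency≡count as i) (cong (λ b → 𝟙 b + count (map toℕ as) (toℕ i)) (sym (≢⇒≡ᵇ (toℕ a) (toℕ i) (λ eq → a≢i (Finₚ.toℕ-injective eq)))))

‖‖²≡∑ : ∀ {n} (as : Stream n) → ‖ frequency as ‖² ≡ ∑ (downFrom n) (λ i → count (map toℕ as) i * count (map toℕ as) i)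
‖‖²≡∑ {n} as = trans (sum-map (List.allFin n)) (∑-tabulate n id _ _ (λ i → cong₂ _*_ (frequency≡count as i)
    (trans (*-identityʳ (frequency as i)) (frequency≡count as i))))
  where
  sum-map : ∀ xs → List.sum (map (λ i → frequency as i ^ 2) xs) ≡ ∑ xs (λ i → frequency as i ^ 2)
  sum-map []       = refl
  sum-map (x ∷ xs) = cong (frequency as x ^ 2 +_) (sum-map xs)

-- The most recent item comes first, so that reading an item is a `∷`, the form in which the sketch
-- is updated.
history : ∀ {n} → Stream n → List ℕ
history as = map toℕ as List.ʳ++ []

count-ʳ++ : ∀ xs ys i → count (xs List.ʳ++ ys) i ≡ count xs i + count ys i
count-ʳ++ []       ys i = refl
count-ʳ++ (x ∷ xs) ys i = trans (count-ʳ++ xs (x ∷ ys) i) (e (count xs i) (𝟙 (x ≡ᵇ i)) (count ys i))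
  where
  e : ∀ a b c → a + (b + c) ≡ b + a + c
  e = ℕ-Solver.solve-∀

count-history : ∀ {n} (as : Stream n) i → count (history as) i ≡ count (map toℕ as) i
count-history as i = trans (count-ʳ++ (map toℕ as) [] i) (+-identityʳ _)

count-take-mono : ∀ {n} (as : Stream n) {s t} → s ≤ t → ∀ i → count (map toℕ (List.take s as)) i ≤ count (map toℕ (List.take t as)) i
count-take-mono []       z≤n      i = z≤n
count-take-mono []       (s≤s le) i = z≤n
count-take-mono (a ∷ as) z≤n      i = z≤n
count-take-mono (a ∷ as) (s≤s le) i = +-monoʳ-≤ (𝟙 (toℕ a ≡ᵇ i)) (count-take-mono as le i)

-- Straight-line programs on memories indexed by natural numbers

data Loc : Set where
  dir ind : ℕ → Loc

data Arg : Set where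
  imm : ℕ → Arg
  ref : Loc → Arg

infix 6 _←_⟨_⟩_
data Instr : Set where
  _←_⟨_⟩_ : Loc → Arg → Op → Arg → Instr

module _ {S : ℕ} .{{_ : NonZero S}} where

  toAddr : Loc → Addr S
  toAddr (dir x) = Addr.cell (x mod S)
  toAddr (ind x) = Addr.at (x mod S)

  toOperand : Arg → Operand S
  toOperand (imm k) = Operand.const k
  toOperand (ref l) = Operand.read (toAddr l)

  toCmd : List Instr → Cmd S
  toCmd []                       = Cmd.skip
  toCmd (d ← a ⟨ o ⟩ b ∷ is) = (toAddr d ≔ toOperand a ⟨ o ⟩ toOperand b) ⨾ toCmd is

  size-toCmd : ∀ is → size (toCmd is) ≡ 1 + 2 * length is
  size-toCmd []                       = refl
  size-toCmd (d ← a ⟨ o ⟩ b ∷ is) = cong (λ z → suc (suc z)) (trans (size-toCmd is) (sym (+-suc (length is) _)))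

-- The compiled code works in the cells below `temporaries`; variables live above them.
temporaries : ℕ
temporaries = depth * 12 + 40

instance
  cells≢0 : ∀ {U} → NonZero (temporaries + U)
  cells≢0 {U} = >-nonZero (≤-trans (m≤n⇒m≤o+n (depth * 12) (m≤m+n 1 39)) (m≤m+n temporaries U))

data Expr : Set where
  imm var : ℕ → Expr
  bin     : Op → Expr → Expr → Expr

-- `height` is the number of temporaries needed when the left operand is computed first and kept
-- while the right one is computed one cell further up.
height cost : Expr → ℕ
height (imm k)     = 1
height (var x)     = 1
height (bin o a b) = height a ⊔ suc (height b)
cost (imm k)     = 1
cost (var x)     = 1
cost (bin o a b) = cost a + (cost b + 1)

compile : Expr → ℕ → List Instr
compile (imm k)     t = dir t ← imm k ⟨ Op.add ⟩ imm 0 ∷ []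
compile (var x)     t = dir t ← ref (dir (temporaries + x)) ⟨ Op.add ⟩ imm 0 ∷ []
compile (bin o a b) t = compile a t ++ (compile b (suc t) ++ (dir t ← ref (dir t) ⟨ o ⟩ ref (dir (suc t)) ∷ []))

length-compile : ∀ e t → length (compile e t) ≡ cost e
length-compile (imm k)     t = refl
length-compile (var x)     t = refl
length-compile (bin o a b) t = trans (Listₚ.length-++ (compile a t)) (cong₂ _+_ (length-compile a t)
  (trans (Listₚ.length-++ (compile b (suc t))) (cong (_+ 1) (length-compile b (suc t)))))

-- get x e sets x to the variable with index e; put e e′ sets the variable with index e to e′.
data Stmt : Set where
  set get : ℕ → Expr → Stmt
  put     : Expr → Expr → Stmt

code : Stmt → List Instr
code (set x e)  = compile e 0 ++ (dir (temporaries + x) ← ref (dir 0) ⟨ Op.add ⟩ imm 0 ∷ [])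
code (get x e)  = compile e 0 ++ (dir 0 ← ref (dir 0) ⟨ Op.add ⟩ imm temporaries ∷
                                  (dir (temporaries + x) ← ref (ind 0) ⟨ Op.add ⟩ imm 0 ∷ []))
code (put e e′) = compile e 0 ++ (dir 0 ← ref (dir 0) ⟨ Op.add ⟩ imm temporaries ∷
                                  (compile e′ 1 ++ (ind 0 ← ref (dir 1) ⟨ Op.add ⟩ imm 0 ∷ [])))

codes : List Stmt → List Instr
codes []       = []
codes (s ∷ ss) = code s ++ codes ss

stmt-cost : Stmt → ℕ
stmt-cost (set x e)  = cost e + 1
stmt-cost (get x e)  = cost e + 2
stmt-cost (put e e′) = cost e + suc (cost e′ + 1)

length-code : ∀ s → length (code s) ≡ stmt-cost s
length-code (set x e)  = trans (Listₚ.length-++ (compile e 0)) (cong (_+ 1) (length-compile e 0))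
length-code (get x e)  = trans (Listₚ.length-++ (compile e 0)) (cong (_+ 2) (length-compile e 0))
length-code (put e e′) = trans (Listₚ.length-++ (compile e 0)) (cong₂ (λ x y → x + suc y) (length-compile e 0)
  (trans (Listₚ.length-++ (compile e′ 1)) (cong (_+ 1) (length-compile e′ 1))))

length-codes : ∀ ss → length (codes ss) ≡ ∑ ss stmt-cost
length-codes []       = refl
length-codes (s ∷ ss) = trans (Listₚ.length-++ (code s)) (cong₂ _+_ (length-code s) (length-codes ss))

infix 8 _[_↦_]
_[_↦_] : (ℕ → ℕ) → ℕ → ℕ → ℕ → ℕ
(ρ [ x ↦ v ]) y = if y ≡ᵇ x then v else ρ y

↦-same : ∀ ρ x v {y} → y ≡ x → (ρ [ x ↦ v ]) y ≡ v
↦-same ρ x v refl rewrite ≡ᵇ-refl x = refl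

↦-other : ∀ ρ x v {y} → y ≢ x → (ρ [ x ↦ v ]) y ≡ ρ y
↦-other ρ x v {y} ne rewrite ≢⇒≡ᵇ y x ne = refl

↦-cong : ∀ {ρ ρ′ x x′ v v′} → (∀ y → ρ y ≡ ρ′ y) → x ≡ x′ → v ≡ v′ → ∀ y → (ρ [ x ↦ v ]) y ≡ (ρ′ [ x′ ↦ v′ ]) y
↦-cong {x = x} eq refl refl y with y ≡ᵇ x
... | true  = refl
... | false = eq y

-- Word arithmetic and the correctness of compiled code

module RAM (w : ℕ) where

  open Machine w

  W : ℕ
  W = 2 ^ w

  private instance
    W≢0 : NonZero W
    W≢0 = m^n≢0 2 w

  toℕ-word : ∀ x → toℕ (word x) ≡ x % W
  toℕ-word x = Finₚ.toℕ-fromℕ< (m%n<n x W)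

  word-toℕ : ∀ (x : Word) → word (toℕ x) ≡ x
  word-toℕ x = Finₚ.toℕ-injective (trans (toℕ-word (toℕ x)) (m<n⇒m%n≡m (Finₚ.toℕ<n x)))

  toℕ-word< : ∀ {x} → x < W → toℕ (word x) ≡ x
  toℕ-word< lt = trans (toℕ-word _) (m<n⇒m%n≡m lt)

  ↦-unique : ∀ {S} {M : Mem S} {a i j} → M ⊢ a ↦ i → M ⊢ a ↦ j → i ≡ j
  ↦-unique cell   cell   = refl
  ↦-unique (at p) (at q) = Finₚ.toℕ-injective (trans (sym p) q)

  ⇒-unique : ∀ {S} {M : Mem S} {a x y} → M ⊢ a ⇒ x → M ⊢ a ⇒ y → x ≡ y
  ⇒-unique const    const    = refl
  ⇒-unique {M = M} (read p) (read q) = cong (lookup M) (↦-unique p q)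

  -- The failure event speaks of any execution that reaches some memory; determinism identifies it
  -- with the one constructed here.
  deterministic : ∀ {S} {c : Cmd S} {M M′ M″ k l} → ⟨ c , M ⟩⇓⟨ k , M′ ⟩ → ⟨ c , M ⟩⇓⟨ l , M″ ⟩ → M′ ≡ M″
  deterministic skip skip = refl
  deterministic {M = M} (assign {o = o} p q r) (assign p′ q′ r′) =
    cong₂ (λ i v → M [ i ]≔ v) (↦-unique p p′) (cong₂ ⟦ o ⟧ (⇒-unique q q′) (⇒-unique r r′))
  deterministic (seq p q) (seq p′ q′) with refl ← deterministic p p′ = deterministic q q′
  deterministic (if-true  p ne q) (if-true  p′ ne′ q′) = deterministic q q′
  deterministic (if-true  p ne q) (if-false p′ z   q′) = contradiction (trans (cong toℕ (⇒-unique p p′)) z) ne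
  deterministic (if-false p z  q) (if-true  p′ ne  q′) = contradiction (trans (cong toℕ (⇒-unique p′ p)) z) ne
  deterministic (if-false p z  q) (if-false p′ z′  q′) = deterministic q q′
  deterministic (while-true  p ne q r) (while-true  p′ ne′ q′ r′) with refl ← deterministic q q′ = deterministic r r′
  deterministic (while-true  p ne q r) (while-false p′ z)         = contradiction (trans (cong toℕ (⇒-unique p p′)) z) ne
  deterministic (while-false p z)      (while-true  p′ ne q′ r′)  = contradiction (trans (cong toℕ (⇒-unique p′ p)) z) ne
  deterministic (while-false p z)      (while-false p′ z′)        = refl

  alu : Op → ℕ → ℕ → ℕ
  alu o x y = toℕ (⟦ o ⟧ (word x) (word y))

  alu-add : ∀ {x y} → x + y < W → alu Op.add x y ≡ x + y
  alu-add {x} {y} lt = trans (toℕ-word _) (trans (sym (trans (%-distribˡ-+ x y W) (cong₂ (λ a b → (a + b) % W) (sym (toℕ-word x)) (sym (toℕ-word y)))))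
    (m<n⇒m%n≡m lt))

  alu-sub : ∀ {x y} → y ≤ x → x < W → alu Op.sub x y ≡ x ∸ y
  alu-sub {x} {y} y≤x x<W = trans (toℕ-word _) (trans (cong₂ (λ a b → (a + (W ∸ b)) % W) (toℕ-word< x<W) (toℕ-word< (≤-<-trans y≤x x<W)))
    (trans (cong (_% W) e) (trans ([m+n]%n≡m%n (x ∸ y) W) (m<n⇒m%n≡m (≤-<-trans (m∸n≤m x y) x<W)))))
    where
    e : x + (W ∸ y) ≡ x ∸ y + W
    e = trans (sym (+-∸-assoc x (<⇒≤ (≤-<-trans y≤x x<W)))) (+-∸-comm W y≤x)

  alu-mul-% : ∀ x y → alu Op.mul x y ≡ (x * y) % W
  alu-mul-% x y = trans (toℕ-word _) (sym (trans (%-distribˡ-* x y W) (cong₂ (λ a b → (a * b) % W) (sym (toℕ-word x)) (sym (toℕ-word y)))))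

  alu-add-% : ∀ x y → alu Op.add x y ≡ (x + y) % W
  alu-add-% x y = trans (toℕ-word _) (sym (trans (%-distribˡ-+ x y W) (cong₂ (λ a b → (a + b) % W) (sym (toℕ-word x)) (sym (toℕ-word y)))))

  alu-mul : ∀ {x y} → x * y < W → alu Op.mul x y ≡ x * y
  alu-mul {x} {y} lt = trans (alu-mul-% x y) (m<n⇒m%n≡m lt)

  private
    word-𝟙 : ∀ b → toℕ (word (if b then 1 else 0)) ≡ 𝟙 b % W
    word-𝟙 true  = toℕ-word 1
    word-𝟙 false = toℕ-word 0

  alu-lt : ∀ {x y} → 1 < W → x < W → y < W → alu Op.lt x y ≡ 𝟙 (x <ᵇ y)
  alu-lt {x} {y} 1<W x<W y<W = trans (word-𝟙 (toℕ (word x) <ᵇ toℕ (word y)))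
    (trans (m<n⇒m%n≡m (≤-<-trans (𝟙≤1 _) 1<W)) (cong₂ (λ a b → 𝟙 (a <ᵇ b)) (toℕ-word< x<W) (toℕ-word< y<W)))

  alu-eq : ∀ {x y} → 1 < W → x < W → y < W → alu Op.eq x y ≡ 𝟙 (x ≡ᵇ y)
  alu-eq {x} {y} 1<W x<W y<W = trans (word-𝟙 (toℕ (word x) ≡ᵇ toℕ (word y)))
    (trans (m<n⇒m%n≡m (≤-<-trans (𝟙≤1 _) 1<W)) (cong₂ (λ a b → 𝟙 (a ≡ᵇ b)) (toℕ-word< x<W) (toℕ-word< y<W)))

  alu< : ∀ o x y → alu o x y < W
  alu< o x y = Finₚ.toℕ<n (⟦ o ⟧ (word x) (word y))

  res : (ℕ → ℕ) → Loc → ℕ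
  res ρ (dir x) = x
  res ρ (ind x) = ρ x

  val : (ℕ → ℕ) → Arg → ℕ
  val ρ (imm k) = k
  val ρ (ref l) = ρ (res ρ l)

  step : (ℕ → ℕ) → Instr → ℕ → ℕ
  step ρ (d ← a ⟨ o ⟩ b) = ρ [ res ρ d ↦ alu o (val ρ a) (val ρ b) ]

  exec : (ℕ → ℕ) → List Instr → ℕ → ℕ
  exec ρ []       = ρ
  exec ρ (i ∷ is) = exec (step ρ i) is

  exec-++ : ∀ ρ is js → exec ρ (is ++ js) ≡ exec (exec ρ is) js
  exec-++ ρ []       js = refl
  exec-++ ρ (i ∷ is) js = exec-++ (step ρ i) is js

  module Soundness (S : ℕ) .{{_ : NonZero S}} where

    InRange : (ℕ → ℕ) → Loc → Set
    InRange ρ (dir x) = x < S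
    InRange ρ (ind x) = x < S × ρ x < S

    InRangeᵃ : (ℕ → ℕ) → Arg → Set
    InRangeᵃ ρ (imm k) = ⊤
    InRangeᵃ ρ (ref l) = InRange ρ l

    -- An indirect address depends on the memory reached so far, and one out of range blocks the
    -- machine; safety is therefore tracked along the execution.
    Safe : (ℕ → ℕ) → List Instr → Set
    Safe ρ []                         = ⊤
    Safe ρ (i@(d ← a ⟨ o ⟩ b) ∷ is) = (InRange ρ d × InRangeᵃ ρ a × InRangeᵃ ρ b) × Safe (step ρ i) is

    safe-++ : ∀ ρ is js → Safe ρ is → Safe (exec ρ is) js → Safe ρ (is ++ js)
    safe-++ ρ []                       js p       q = q
    safe-++ ρ ((d ← a ⟨ o ⟩ b) ∷ is) js (p , ps) q = p , safe-++ _ is js ps q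

    infix 4 _≈_
    _≈_ : Mem S → (ℕ → ℕ) → Set
    M ≈ ρ = ∀ i → toℕ (lookup M i) ≡ ρ (toℕ i)

    toℕ-mod : ∀ {x} → x < S → toℕ (x mod S) ≡ x
    toℕ-mod {x} lt = trans (Finₚ.toℕ-fromℕ< (m%n<n x S)) (m<n⇒m%n≡m lt)

    ≈-write : ∀ {M ρ} → M ≈ ρ → ∀ i v → M [ i ]≔ v ≈ ρ [ toℕ i ↦ toℕ v ]
    ≈-write {M} {ρ} eq i v j with j Finₚ.≟ i
    ... | yes refl = trans (cong toℕ (Vecₚ.lookup∘updateAt i M)) (sym (↦-same ρ (toℕ i) (toℕ v) refl))
    ... | no  ne   = trans (cong toℕ (Vecₚ.lookup∘updateAt′ j i ne M)) (trans (eq j)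
                       (sym (↦-other ρ (toℕ i) (toℕ v) (λ e → ne (Finₚ.toℕ-injective e)))))

    ≈-cong : ∀ {M ρ ρ′} → M ≈ ρ → (∀ x → ρ x ≡ ρ′ x) → M ≈ ρ′
    ≈-cong eq eq′ i = trans (eq i) (eq′ (toℕ i))

    sound-loc : ∀ {M ρ} → M ≈ ρ → ∀ l → InRange ρ l → ∃ λ i → M ⊢ toAddr l ↦ i × toℕ i ≡ res ρ l
    sound-loc eq (dir x) lt = x mod S , cell , toℕ-mod lt
    sound-loc {M} {ρ} eq (ind x) (lt , lt′) = ρ x mod S ,
      at (trans (eq (x mod S)) (trans (cong ρ (toℕ-mod lt)) (sym (toℕ-mod lt′)))) , toℕ-mod lt′

    sound-arg : ∀ {M ρ} → M ≈ ρ → ∀ a → InRangeᵃ ρ a → M ⊢ toOperand a ⇒ word (val ρ a)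
    sound-arg eq (imm k) _ = const
    sound-arg {M} {ρ} eq (ref l) ok with sound-loc eq l ok
    ... | i , p , e = subst (M ⊢ _ ⇒_) (trans (sym (word-toℕ (lookup M i))) (cong word (trans (eq i) (cong ρ e)))) (read p)

    sound : ∀ is {M ρ} → M ≈ ρ → Safe ρ is → ∃ λ M′ → ⟨ toCmd is , M ⟩⇓⟨ length is , M′ ⟩ × M′ ≈ exec ρ is
    sound [] {M} eq _ = M , skip , eq
    sound ((d ← a ⟨ o ⟩ b) ∷ is) {M} {ρ} eq ((okd , oka , okb) , ok) with sound-loc eq d okd
    ... | i , p , e with sound is {M [ i ]≔ v} (≈-cong {M [ i ]≔ v} {ρ [ toℕ i ↦ toℕ v ]} (≈-write {M} {ρ} eq i v) (↦-cong {ρ} {ρ} (λ _ → refl) e refl)) ok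
      where v = ⟦ o ⟧ (word (val ρ a)) (word (val ρ b))
    ... | M′ , run , eq′ = M′ , seq (assign p (sound-arg eq a oka) (sound-arg eq b okb)) run , eq′

  -- The only instruction is a binary assignment, so leaves are loaded by adding 0; even a constant
  -- is thereby reduced modulo 2ʷ.
  value : Expr → (ℕ → ℕ) → ℕ
  value (imm k)     σ = alu Op.add k 0
  value (var x)     σ = alu Op.add (σ x) 0
  value (bin o a b) σ = alu o (value a σ) (value b σ)

  value-cong : ∀ e {σ σ′} → (∀ x → σ x ≡ σ′ x) → value e σ ≡ value e σ′
  value-cong (imm k)     eq = refl
  value-cong (var x)     eq = cong (λ z → alu Op.add z 0) (eq x)
  value-cong (bin o a b) eq = cong₂ (alu o) (value-cong a eq) (value-cong b eq)

  value< : ∀ e σ → value e σ < W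
  value< (imm k)     σ = alu< Op.add k 0
  value< (var x)     σ = alu< Op.add (σ x) 0
  value< (bin o a b) σ = alu< o (value a σ) (value b σ)

  alu-+0 : ∀ {x} → x < W → alu Op.add x 0 ≡ x
  alu-+0 {x} lt = trans (alu-add (subst (_< W) (sym (+-identityʳ x)) lt)) (+-identityʳ x)

  run : (ℕ → ℕ) → Stmt → ℕ → ℕ
  run σ (set x e)  = σ [ x ↦ value e σ ]
  run σ (get x e)  = σ [ x ↦ alu Op.add (σ (value e σ)) 0 ]
  run σ (put e e′) = σ [ value e σ ↦ value e′ σ ]

  runs : (ℕ → ℕ) → List Stmt → ℕ → ℕ
  runs σ []       = σ
  runs σ (s ∷ ss) = runs (run σ s) ss

  runs-++ : ∀ σ ss ts → runs σ (ss ++ ts) ≡ runs (runs σ ss) ts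
  runs-++ σ []       ts = refl
  runs-++ σ (s ∷ ss) ts = runs-++ (run σ s) ss ts

  module Compilation (U : ℕ) (S≤W : temporaries + U ≤ W) where

    private
      T₀ = temporaries
      T₀>0 : 0 < T₀
      T₀>0 = m≤n⇒m≤o+n (depth * 12) (m≤m+n 1 39)
      1<T₀ : 1 < T₀
      1<T₀ = m≤n⇒m≤o+n (depth * 12) (m≤m+n 2 38)

    S : ℕ
    S = T₀ + U

    open Soundness S {{cells≢0 {U}}}

    Vars : Expr → Set
    Vars (imm k)     = ⊤
    Vars (var x)     = x < U
    Vars (bin o a b) = Vars a × Vars b

    user : (ℕ → ℕ) → ℕ → ℕ
    user ρ x = ρ (T₀ + x)

    private
      temp< : ∀ {t h} → t + suc h ≤ T₀ → t < S
      temp< {t} {h} le = ≤-trans (≤-trans (≤-trans (s≤s (m≤m+n t h)) (≤-reflexive (sym (+-suc t h)))) le) (m≤m+n T₀ U)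

    -- The frame condition carries the induction: the code of the right operand starts at `suc t`,
    -- so the left operand waits unharmed in `t`, and the variables lie above all temporaries.
    compile-spec : ∀ e t {ρ} → t + height e ≤ T₀ → Vars e →
      exec ρ (compile e t) t ≡ value e (user ρ) ×
      (∀ x → x < t ⊎ T₀ ≤ x → exec ρ (compile e t) x ≡ ρ x) × Safe ρ (compile e t)
    compile-spec (imm k) t {ρ} le _ = ↦-same ρ t _ refl , (λ x → aux x) , (temp< le , tt , tt) , tt
      where
      aux : ∀ x → x < t ⊎ T₀ ≤ x → _
      aux x (inj₁ lt) = ↦-other ρ t _ (<⇒≢ lt)
      aux x (inj₂ ge) = ↦-other ρ t _ (>⇒≢ (<-≤-trans (≤-trans (≤-reflexive (+-comm 1 t)) le) ge))
    compile-spec (var y) t {ρ} le y<U = ↦-same ρ t _ refl , (λ x → aux x) , (temp< le , +-monoʳ-< T₀ y<U , tt) , tt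
      where
      aux : ∀ x → x < t ⊎ T₀ ≤ x → _
      aux x (inj₁ lt) = ↦-other ρ t _ (<⇒≢ lt)
      aux x (inj₂ ge) = ↦-other ρ t _ (>⇒≢ (<-≤-trans (≤-trans (≤-reflexive (+-comm 1 t)) le) ge))
    compile-spec (bin o a b) t {ρ} le (va , vb)
      with compile-spec a t {ρ} (≤-trans (+-monoʳ-≤ t (m≤m⊔n (height a) (suc (height b)))) le) va
         | compile-spec b (suc t) {exec ρ (compile a t)} (≤-trans (≤-reflexive (sym (+-suc t (height b)))) (≤-trans (+-monoʳ-≤ t (m≤n⊔m (height a) (suc (height b)))) le)) vb
    ... | va≡ , fra , oka | vb≡ , frb , okb = outcome , frame , safe
      where
      ρ₁ = exec ρ (compile a t)
      ρ₂ = exec ρ₁ (compile b (suc t))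
      last = dir t ← ref (dir t) ⟨ o ⟩ ref (dir (suc t))
      at-end : ∀ x → exec ρ (compile (bin o a b) t) x ≡ (ρ₂ [ t ↦ alu o (ρ₂ t) (ρ₂ (suc t)) ]) x
      at-end x = cong (λ f → f x) (trans (exec-++ ρ (compile a t) _) (exec-++ ρ₁ (compile b (suc t)) (last ∷ [])))
      user-ρ₁ : ∀ x → user ρ₁ x ≡ user ρ x
      user-ρ₁ x = fra (T₀ + x) (inj₂ (m≤m+n T₀ x))
      le₂ : suc t + suc 0 ≤ T₀
      le₂ = ≤-trans (≤-trans (≤-reflexive (+-comm (suc t) 1)) (≤-trans (≤-reflexive (+-comm 2 t)) (+-monoʳ-≤ t (≤-trans (s≤s (height>0 b)) (m≤n⊔m (height a) (suc (height b))))))) le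
        where
        height>0 : ∀ e → 0 < height e
        height>0 (imm k)     = s≤s z≤n
        height>0 (var x)     = s≤s z≤n
        height>0 (bin o a b) = ≤-trans (height>0 a) (m≤m⊔n (height a) (suc (height b)))
      outcome : exec ρ (compile (bin o a b) t) t ≡ value (bin o a b) (user ρ)
      outcome = trans (at-end t) (trans (↦-same ρ₂ t _ refl) (cong₂ (alu o) (trans (frb t (inj₁ ≤-refl)) va≡) (trans vb≡ (value-cong b user-ρ₁))))
      frame : ∀ x → x < t ⊎ T₀ ≤ x → exec ρ (compile (bin o a b) t) x ≡ ρ x
      frame x (inj₁ lt) = trans (at-end x) (trans (↦-other ρ₂ t _ (<⇒≢ lt)) (trans (frb x (inj₁ (m<n⇒m<1+n lt))) (fra x (inj₁ lt))))
      frame x (inj₂ ge) = trans (at-end x) (trans (↦-other ρ₂ t _ (>⇒≢ (<-≤-trans (≤-trans (s≤s (n≤1+n t)) (≤-trans (≤-reflexive (+-comm 1 (suc t))) le₂)) ge)))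
        (trans (frb x (inj₂ ge)) (fra x (inj₂ ge))))
      t<S : t < S
      t<S = <-trans ≤-refl (temp< {suc t} le₂)
      safe : Safe ρ (compile (bin o a b) t)
      safe = safe-++ ρ (compile a t) _ oka (safe-++ ρ₁ (compile b (suc t)) (last ∷ []) okb ((t<S , t<S , temp< le₂) , tt))

    Fits : Expr → Set
    Fits e = Vars e × 1 + height e ≤ T₀

    OK : (ℕ → ℕ) → Stmt → Set
    OK σ (set x e)  = x < U × Fits e
    OK σ (get x e)  = x < U × Fits e × value e σ < U
    OK σ (put e e′) = Fits e × Fits e′ × value e σ < U

    OKs : (ℕ → ℕ) → List Stmt → Set
    OKs σ []       = ⊤
    OKs σ (s ∷ ss) = OK σ s × OKs (run σ s) ss

    OKs-++ : ∀ σ ss ts → OKs σ ss → OKs (runs σ ss) ts → OKs σ (ss ++ ts)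
    OKs-++ σ []       ts p        q = q
    OKs-++ σ (s ∷ ss) ts (p , ps) q = p , OKs-++ (run σ s) ss ts ps q

    stmt-spec : ∀ s {ρ σ} → (∀ x → user ρ x ≡ σ x) → OK σ s →
      (∀ x → user (exec ρ (code s)) x ≡ run σ s x) × Safe ρ (code s)
    stmt-spec (set x e) {ρ} {σ} eq (x<U , ve , he) with compile-spec e 0 {ρ} (<⇒≤ he) ve
    ... | v≡ , fr , ok = final , safe-++ ρ (compile e 0) _ ok ((+-monoʳ-< T₀ x<U , ≤-trans T₀>0 (m≤m+n T₀ U) , tt) , tt)
      where
      ρ₁ = exec ρ (compile e 0)
      v = value e σ
      v₁ : alu Op.add (ρ₁ 0) 0 ≡ v
      v₁ = trans (cong (λ z → alu Op.add z 0) (trans v≡ (value-cong e eq))) (alu-+0 (value< e σ))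
      final : ∀ y → user (exec ρ (code (set x e))) y ≡ (σ [ x ↦ v ]) y
      final y = trans (cong (λ f → f (T₀ + y)) (exec-++ ρ (compile e 0) _)) (write y)
        where
        write : ∀ y → (ρ₁ [ T₀ + x ↦ alu Op.add (ρ₁ 0) 0 ]) (T₀ + y) ≡ (σ [ x ↦ v ]) y
        write y with y ≟ x
        ... | yes refl = trans (↦-same ρ₁ (T₀ + x) _ refl) (trans v₁ (sym (↦-same σ x v refl)))
        ... | no  ne   = trans (↦-other ρ₁ (T₀ + x) _ (λ e → ne (+-cancelˡ-≡ T₀ _ _ e))) (trans (fr (T₀ + y) (inj₂ (m≤m+n T₀ y))) (trans (eq y) (sym (↦-other σ x v ne))))
    stmt-spec (get x e) {ρ} {σ} eq (x<U , (ve , he) , v<U) with compile-spec e 0 {ρ} (<⇒≤ he) ve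
    ... | v≡ , fr , ok = final , safe-++ ρ (compile e 0) _ ok ((0<S , 0<S , tt) , (+-monoʳ-< T₀ x<U , (0<S , subst (_< S) (sym ρ₂0) (+-monoʳ-< T₀ v<U)) , tt) , tt)
      where
      0<S = ≤-trans T₀>0 (m≤m+n T₀ U)
      ρ₁ = exec ρ (compile e 0)
      v = value e σ
      v₁ : alu Op.add (ρ₁ 0) T₀ ≡ T₀ + v
      v₁ = trans (cong (λ z → alu Op.add z T₀) (trans v≡ (value-cong e eq)))
        (trans (alu-add (<-≤-trans (subst (_< S) (+-comm T₀ v) (+-monoʳ-< T₀ v<U)) S≤W)) (+-comm v T₀))
      ρ₂ = ρ₁ [ 0 ↦ alu Op.add (ρ₁ 0) T₀ ]
      ρ₂0 : ρ₂ 0 ≡ T₀ + v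
      ρ₂0 = trans (↦-same ρ₁ 0 _ refl) v₁
      user-ρ₂ : ∀ y → ρ₂ (T₀ + y) ≡ σ y
      user-ρ₂ y = trans (↦-other ρ₁ 0 _ (>⇒≢ (≤-trans T₀>0 (m≤m+n T₀ y)))) (trans (fr (T₀ + y) (inj₂ (m≤m+n T₀ y))) (eq y))
      final : ∀ y → user (exec ρ (code (get x e))) y ≡ run σ (get x e) y
      final y = trans (cong (λ f → f (T₀ + y)) (exec-++ ρ (compile e 0) _)) (write y)
        where
        write : ∀ y → (ρ₂ [ T₀ + x ↦ alu Op.add (ρ₂ (ρ₂ 0)) 0 ]) (T₀ + y) ≡ (σ [ x ↦ alu Op.add (σ v) 0 ]) y
        write y with y ≟ x
        ... | yes refl = trans (↦-same ρ₂ (T₀ + x) _ refl) (trans (cong (λ z → alu Op.add z 0) (trans (cong ρ₂ ρ₂0) (user-ρ₂ v))) (sym (↦-same σ x _ refl)))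
        ... | no  ne   = trans (↦-other ρ₂ (T₀ + x) _ (λ e → ne (+-cancelˡ-≡ T₀ _ _ e))) (trans (user-ρ₂ y) (sym (↦-other σ x _ ne)))
    stmt-spec (put e e′) {ρ} {σ} eq ((ve , he) , (ve′ , he′) , v<U) with compile-spec e 0 {ρ} (<⇒≤ he) ve
    ... | v≡ , fr , ok with compile-spec e′ 1 {exec ρ (compile e 0) [ 0 ↦ alu Op.add (exec ρ (compile e 0) 0) T₀ ]} he′ ve′
    ... | v′≡ , fr′ , ok′ = final , safe-++ ρ (compile e 0) _ ok ((0<S , 0<S , tt) ,
          safe-++ ρ₂ (compile e′ 1) _ ok′ (((0<S , subst (_< S) (sym ρ₃0) (+-monoʳ-< T₀ v<U)) , ≤-trans 1<T₀ (m≤m+n T₀ U) , tt) , tt))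
      where
      0<S = ≤-trans T₀>0 (m≤m+n T₀ U)
      ρ₁ = exec ρ (compile e 0)
      v = value e σ
      v′ = value e′ σ
      v₁ : alu Op.add (ρ₁ 0) T₀ ≡ T₀ + v
      v₁ = trans (cong (λ z → alu Op.add z T₀) (trans v≡ (value-cong e eq)))
        (trans (alu-add (<-≤-trans (subst (_< S) (+-comm T₀ v) (+-monoʳ-< T₀ v<U)) S≤W)) (+-comm v T₀))
      ρ₂ = ρ₁ [ 0 ↦ alu Op.add (ρ₁ 0) T₀ ]
      ρ₂0 : ρ₂ 0 ≡ T₀ + v
      ρ₂0 = trans (↦-same ρ₁ 0 _ refl) v₁
      user-ρ₂ : ∀ y → ρ₂ (T₀ + y) ≡ σ y
      user-ρ₂ y = trans (↦-other ρ₁ 0 _ (>⇒≢ (≤-trans T₀>0 (m≤m+n T₀ y)))) (trans (fr (T₀ + y) (inj₂ (m≤m+n T₀ y))) (eq y))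
      ρ₃ = exec ρ₂ (compile e′ 1)
      ρ₃0 : ρ₃ 0 ≡ T₀ + v
      ρ₃0 = trans (fr′ 0 (inj₁ (s≤s z≤n))) ρ₂0
      user-ρ₃ : ∀ y → ρ₃ (T₀ + y) ≡ σ y
      user-ρ₃ y = trans (fr′ (T₀ + y) (inj₂ (m≤m+n T₀ y))) (user-ρ₂ y)
      ρ₃1 : alu Op.add (ρ₃ 1) 0 ≡ v′
      ρ₃1 = trans (cong (λ z → alu Op.add z 0) (trans v′≡ (value-cong e′ user-ρ₂))) (alu-+0 (value< e′ σ))
      final : ∀ y → user (exec ρ (code (put e e′))) y ≡ run σ (put e e′) y
      final y = trans (cong (λ f → f (T₀ + y)) (trans (exec-++ ρ (compile e 0) _) (exec-++ ρ₂ (compile e′ 1) _))) (write y)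
        where
        write : ∀ y → (ρ₃ [ ρ₃ 0 ↦ alu Op.add (ρ₃ 1) 0 ]) (T₀ + y) ≡ (σ [ v ↦ v′ ]) y
        write y with y ≟ v
        ... | yes refl = trans (↦-same ρ₃ (ρ₃ 0) _ (sym ρ₃0)) (trans ρ₃1 (sym (↦-same σ v v′ refl)))
        ... | no  ne   = trans (↦-other ρ₃ (ρ₃ 0) _ (λ e → ne (+-cancelˡ-≡ T₀ _ _ (trans e ρ₃0)))) (trans (user-ρ₃ y) (sym (↦-other σ v v′ ne)))

    stmts-spec : ∀ ss {ρ σ} → (∀ x → user ρ x ≡ σ x) → OKs σ ss →
      (∀ x → user (exec ρ (codes ss)) x ≡ runs σ ss x) × Safe ρ (codes ss)
    stmts-spec []       eq _ = eq , tt
    stmts-spec (s ∷ ss) {ρ} {σ} eq (ok , oks) with stmt-spec s {ρ} {σ} eq ok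
    ... | eq₁ , safe₁ with stmts-spec ss {exec ρ (code s)} {run σ s} eq₁ oks
    ... | eq₂ , safe₂ = (λ x → trans (cong (λ f → user f x) (exec-++ ρ (code s) (codes ss))) (eq₂ x)) , safe-++ ρ (code s) (codes ss) safe₁ safe₂

    perform : ∀ ss {M ρ} → M ≈ ρ → OKs (user ρ) ss →
      ∃₂ λ M′ ρ′ → ⟨ toCmd (codes ss) , M ⟩⇓⟨ length (codes ss) , M′ ⟩ × M′ ≈ ρ′ × (∀ x → user ρ′ x ≡ runs (user ρ) ss x)
    perform ss {M} {ρ} eq ok with stmts-spec ss {ρ} {user ρ} (λ _ → refl) ok
    ... | eq′ , safe with sound (codes ss) {M} {ρ} eq safe
    ... | M′ , run , eq″ = M′ , exec ρ (codes ss) , run , eq″ , eq′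

-- Code for median networks

-- Selection without branching: exactly one of the two products has the factor 1, since comparing a
-- bit with 0 negates it. Thus every item costs the same number of operations, whatever the seed.
minᵉ maxᵉ : Expr → Expr → Expr
minᵉ a b = bin Op.add (bin Op.mul a (bin Op.lt a b)) (bin Op.mul b (bin Op.eq (bin Op.lt a b) (imm 0)))
maxᵉ a b = bin Op.add (bin Op.mul b (bin Op.lt a b)) (bin Op.mul a (bin Op.eq (bin Op.lt a b) (imm 0)))

medianᵉ : Expr → Expr → Expr → Expr
medianᵉ a b c = maxᵉ (minᵉ a b) (minᵉ (maxᵉ a b) c)

treeᵉ : ∀ {n} → (Fin n → ℕ) → ∀ d → Tree n d → Expr
treeᵉ loc zero    i                = var (loc i)
treeᵉ loc (suc d) (t ∷ u ∷ v ∷ []) = medianᵉ (treeᵉ loc d t) (treeᵉ loc d u) (treeᵉ loc d v)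

private
  selectᵉ : Expr → Expr → Expr → Expr → Expr
  selectᵉ x y a b = bin Op.add (bin Op.mul x (bin Op.lt a b)) (bin Op.mul y (bin Op.eq (bin Op.lt a b) (imm 0)))

  select-height : ∀ x y a b h → height x ≤ h → height y ≤ h → height a ≤ h → height b ≤ h → height (selectᵉ x y a b) ≤ 4 + h
  select-height x y a b h hx hy ha hb = ⊔-lub
    (≤-trans (⊔-lub (≤-trans hx (m≤n+m h 2)) (s≤s lt≤)) (m≤n+m (2 + h) 2))
    (s≤s (⊔-lub (≤-trans hy (m≤n+m h 3)) (s≤s (⊔-lub (≤-trans lt≤ (n≤1+n (1 + h))) (s≤s (s≤s z≤n))))))
    where
    lt≤ : height a ⊔ suc (height b) ≤ 1 + h
    lt≤ = ⊔-lub (m≤n⇒m≤1+n ha) (s≤s hb)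

  select-cost : ∀ x y a b c → 1 ≤ c → cost x ≤ c → cost y ≤ c → cost a ≤ c → cost b ≤ c → cost (selectᵉ x y a b) ≤ 13 * c
  select-cost x y a b c 1≤ hx hy ha hb = ≤-trans
    (+-mono-≤ (+-mono-≤ hx (+-monoˡ-≤ 1 lt≤)) (+-monoˡ-≤ 1 (+-mono-≤ hy (+-monoˡ-≤ 1 (+-monoˡ-≤ 2 lt≤)))))
    (≤-trans (≤-reflexive (e c)) (≤-trans (+-monoʳ-≤ (6 * c) (*-monoʳ-≤ 7 1≤)) (≤-reflexive (e′ c))))
    where
    lt≤ : cost a + (cost b + 1) ≤ c + (c + 1)
    lt≤ = +-mono-≤ ha (+-monoˡ-≤ 1 hb)
    e : ∀ c → c + (c + (c + 1) + 1) + (c + (c + (c + 1) + 2 + 1) + 1) ≡ 6 * c + 7 * 1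
    e = ℕ-Solver.solve-∀
    e′ : ∀ c → 6 * c + 7 * c ≡ 13 * c
    e′ = ℕ-Solver.solve-∀

-- A median nests three selections, each needing four more cells than its operands: 12 per level.
tree-height : ∀ {n} (loc : Fin n → ℕ) d t → height (treeᵉ loc d t) ≤ d * 12 + 1
tree-height loc zero    i                = ≤-refl
tree-height loc (suc d) (t ∷ u ∷ v ∷ []) =
  select-height q p p q (8 + h) q≤ p≤ p≤ q≤
  where
  h = d * 12 + 1
  x = treeᵉ loc d t
  y = treeᵉ loc d u
  z = treeᵉ loc d v
  hx = tree-height loc d t
  hy = tree-height loc d u
  p = minᵉ x y
  m = maxᵉ x y
  q = minᵉ m z
  p≤ : height p ≤ 8 + h
  p≤ = ≤-trans (select-height x y x y h hx hy hx hy) (m≤n+m (4 + h) 4)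
  m≤ : height m ≤ 4 + h
  m≤ = select-height y x x y h hy hx hx hy
  z≤ : height z ≤ 4 + h
  z≤ = ≤-trans (tree-height loc d v) (m≤n+m h 4)
  q≤ : height q ≤ 8 + h
  q≤ = select-height m z m z (4 + h) m≤ z≤ m≤ z≤

-- Operands are repeated rather than shared, for a factor of 13 per selection and 13³ per level.
-- This is exponential in the depth, which is a constant.
tree-cost : ∀ {n} (loc : Fin n → ℕ) d t → cost (treeᵉ loc d t) ≤ (13 * (13 * 13)) ^ d
tree-cost loc zero    i                = ≤-refl
tree-cost loc (suc d) (t ∷ u ∷ v ∷ []) = ≤-trans (select-cost q p p q (13 * (13 * c)) (1≤ (13 * c) (1≤ c c>0)) q≤ p≤ p≤ q≤)
  (≤-reflexive (e 13 c))
  where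
  c = (13 * (13 * 13)) ^ d
  c>0 : 1 ≤ c
  c>0 = m^n>0 (13 * (13 * 13)) d
  1≤ : ∀ c → 1 ≤ c → 1 ≤ 13 * c
  1≤ c h = ≤-trans h (m≤m+n c (12 * c))
  up : ∀ {k} c → k ≤ c → k ≤ 13 * c
  up c h = ≤-trans h (m≤m+n c (12 * c))
  x = treeᵉ loc d t
  y = treeᵉ loc d u
  z = treeᵉ loc d v
  hx = tree-cost loc d t
  hy = tree-cost loc d u
  p = minᵉ x y
  m = maxᵉ x y
  q = minᵉ m z
  p≤ : cost p ≤ 13 * (13 * c)
  p≤ = up (13 * c) (select-cost x y x y c c>0 hx hy hx hy)
  m≤ : cost m ≤ 13 * c
  m≤ = select-cost y x x y c c>0 hy hx hx hy
  z≤ : cost z ≤ 13 * c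
  z≤ = up c (tree-cost loc d v)
  q≤ : cost q ≤ 13 * (13 * c)
  q≤ = select-cost m z m z (13 * c) (1≤ c c>0) m≤ z≤ m≤ z≤
  e : ∀ k c → k * (k * (k * c)) ≡ k * (k * k) * c
  e = ℕ-Solver.solve-∀

setAll : ∀ {n s} d → ℕ → (Fin n → ℕ) → Vec (Tree n d) s → List Stmt
setAll d f loc []       = []
setAll d f loc (t ∷ ts) = set f (treeᵉ loc d t) ∷ setAll d (suc f) loc ts

-- The 2ᵏ inputs are at loc; the outputs of the stages are stored from f on.
networkCode : ∀ k → (Fin (2 ^ k) → ℕ) → ℕ → List Stmt
networkCode zero    loc f = set 1 (var (loc zero)) ∷ []
networkCode (suc k) loc f = setAll depth f loc (proj₁ (stage k)) ++ networkCode k (λ i → f + toℕ i) (f + 2 ^ k)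

tree-cost-bound : ℕ
tree-cost-bound = (13 * (13 * 13)) ^ depth + 1

setAll-cost : ∀ {n s} f (loc : Fin n → ℕ) (ts : Vec (Tree n depth) s) → ∑ (setAll depth f loc ts) stmt-cost ≤ s * tree-cost-bound
setAll-cost f loc []       = z≤n
setAll-cost f loc (t ∷ ts) = +-mono-≤ (+-monoˡ-≤ 1 (tree-cost loc depth t)) (setAll-cost (suc f) loc ts)

-- A geometric series: the stages evaluate 2 to the k - 1, then 2 to the k - 2, ... trees of bounded
-- cost. This keeps the update time linear in the number of copies.
networkCode-cost : ∀ k loc f → ∑ (networkCode k loc f) stmt-cost ≤ 2 ^ k * tree-cost-bound + 1
networkCode-cost zero    loc f = ≤-trans (+-monoˡ-≤ 0 (s≤s (s≤s z≤n))) (+-monoˡ-≤ 1 (≤-trans (m≤n+m 1 _) (m≤m+n tree-cost-bound 0)))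
networkCode-cost (suc k) loc f = begin
  ∑ (setAll depth f loc W ++ rest) stmt-cost                     ≡⟨ ∑-++ (setAll depth f loc W) rest stmt-cost ⟩
  ∑ (setAll depth f loc W) stmt-cost + ∑ rest stmt-cost          ≤⟨ +-mono-≤ (setAll-cost f loc W) (networkCode-cost k _ _) ⟩
  2 ^ k * c + (2 ^ k * c + 1)                                    ≡⟨ e (2 ^ k) c ⟩
  2 ^ suc k * c + 1                                              ∎
  where
  open ≤-Reasoning
  W = proj₁ (stage k)
  rest = networkCode k (λ i → f + toℕ i) (f + 2 ^ k)
  c = tree-cost-bound
  e : ∀ p c → p * c + (p * c + 1) ≡ 2 * p * c + 1
  e = ℕ-Solver.solve-∀

module NetworkCode (w U : ℕ) (S≤W : temporaries + U ≤ 2 ^ w) (1<W : 1 < 2 ^ w) where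

  open RAM w
  open Compilation U S≤W

  private
    choose : ∀ b {x y} → x < W → y < W → alu Op.add (alu Op.mul x (𝟙 b)) (alu Op.mul y (alu Op.eq (𝟙 b) (alu Op.add 0 0))) ≡ (if b then x else y)
    choose b {x} {y} x<W y<W = trans (cong (λ z → alu Op.add (alu Op.mul x (𝟙 b)) (alu Op.mul y z))
        (trans (cong (alu Op.eq (𝟙 b)) (alu-+0 (<-trans (s≤s z≤n) 1<W))) (alu-eq 1<W (≤-<-trans (𝟙≤1 b) 1<W) (<-trans (s≤s z≤n) 1<W)))) (go b)
      where
      times0 : ∀ x → alu Op.mul x 0 ≡ 0
      times0 x = trans (alu-mul (subst (_< W) (sym (*-zeroʳ x)) (<-trans (s≤s z≤n) 1<W))) (*-zeroʳ x)
      times1 : ∀ {x} → x < W → alu Op.mul x 1 ≡ x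
      times1 {x} lt = trans (alu-mul (subst (_< W) (sym (*-identityʳ x)) lt)) (*-identityʳ x)
      go : ∀ b → alu Op.add (alu Op.mul x (𝟙 b)) (alu Op.mul y (𝟙 (𝟙 b ≡ᵇ 0))) ≡ (if b then x else y)
      go true  = trans (cong₂ (alu Op.add) (times1 x<W) (times0 y)) (alu-+0 x<W)
      go false = trans (cong₂ (alu Op.add) (times0 x) (times1 y<W)) (alu-add y<W)

    if-⊓ : ∀ x y → (if x <ᵇ y then x else y) ≡ x ⊓ y
    if-⊓ x y with x <ᵇ y in eq
    ... | true  = sym (m≤n⇒m⊓n≡m (<⇒≤ (<ᵇ⇒< x y (subst T (sym eq) tt))))
    ... | false = sym (m≥n⇒m⊓n≡n (≮⇒≥ λ lt → subst T eq (<⇒<ᵇ lt)))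

    if-⊔ : ∀ x y → (if x <ᵇ y then y else x) ≡ x ⊔ y
    if-⊔ x y with x <ᵇ y in eq
    ... | true  = sym (m≤n⇒m⊔n≡n (<⇒≤ (<ᵇ⇒< x y (subst T (sym eq) tt))))
    ... | false = sym (m≥n⇒m⊔n≡m (≮⇒≥ λ lt → subst T eq (<⇒<ᵇ lt)))

  value-min : ∀ a b σ → value (minᵉ a b) σ ≡ value a σ ⊓ value b σ
  value-min a b σ = trans (cong (λ l → alu Op.add (alu Op.mul x l) (alu Op.mul y (alu Op.eq l (alu Op.add 0 0)))) (alu-lt 1<W (value< a σ) (value< b σ)))
    (trans (choose (x <ᵇ y) (value< a σ) (value< b σ)) (if-⊓ x y))
    where
    x = value a σ
    y = value b σ

  value-max : ∀ a b σ → value (maxᵉ a b) σ ≡ value a σ ⊔ value b σ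
  value-max a b σ = trans (cong (λ l → alu Op.add (alu Op.mul y l) (alu Op.mul x (alu Op.eq l (alu Op.add 0 0)))) (alu-lt 1<W (value< a σ) (value< b σ)))
    (trans (choose (x <ᵇ y) (value< b σ) (value< a σ)) (if-⊔ x y))
    where
    x = value a σ
    y = value b σ

  value-median : ∀ a b c σ → value (medianᵉ a b c) σ ≡ median (value a σ) (value b σ) (value c σ)
  value-median a b c σ = trans (value-max (minᵉ a b) (minᵉ (maxᵉ a b) c) σ) (cong₂ _⊔_ (value-min a b σ)
    (trans (value-min (maxᵉ a b) c σ) (cong (_⊓ value c σ) (value-max a b σ))))

  module _ {n : ℕ} (loc : Fin n → ℕ) (σ : ℕ → ℕ) (z : Vec ℕ n) (inputs : ∀ i → σ (loc i) ≡ lookup z i) (z<W : ∀ i → lookup z i < W) where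

    value-tree : ∀ d t → value (treeᵉ loc d t) σ ≡ evalTree d z t
    value-tree zero    i                = trans (cong (λ x → alu Op.add x 0) (inputs i)) (alu-+0 (z<W i))
    value-tree (suc d) (t ∷ u ∷ v ∷ []) = trans (value-median (treeᵉ loc d t) (treeᵉ loc d u) (treeᵉ loc d v) σ)
      (trans (cong₂ (λ x y → median x y (value (treeᵉ loc d v) σ)) (value-tree d t) (value-tree d u)) (cong (median (evalTree d z t) (evalTree d z u)) (value-tree d v)))

  tree-vars : ∀ {n} (loc : Fin n → ℕ) → (∀ i → loc i < U) → ∀ d t → Vars (treeᵉ loc d t)
  tree-vars loc lt zero    i                = lt i
  tree-vars loc lt (suc d) (t ∷ u ∷ v ∷ []) = maxv (minᵉ a b) (minᵉ (maxᵉ a b) c) (minv a b x y) (minv (maxᵉ a b) c (maxv a b x y) z)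
    where
    a = treeᵉ loc d t
    b = treeᵉ loc d u
    c = treeᵉ loc d v
    x = tree-vars loc lt d t
    y = tree-vars loc lt d u
    z = tree-vars loc lt d v
    minv : ∀ a b → Vars a → Vars b → Vars (minᵉ a b)
    minv a b p q = (p , p , q) , (q , (p , q) , tt)
    maxv : ∀ a b → Vars a → Vars b → Vars (maxᵉ a b)
    maxv a b p q = (q , p , q) , (p , (p , q) , tt)

  tree-fits : ∀ {n} (loc : Fin n → ℕ) → (∀ i → loc i < U) → ∀ t → Fits (treeᵉ loc depth t)
  tree-fits loc lt t = tree-vars loc lt depth t ,
    ≤-trans (s≤s (tree-height loc depth t)) (≤-trans (≤-reflexive (sym (+-suc (depth * 12) 1))) (+-monoʳ-≤ (depth * 12) (m≤m+n 2 38)))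

  setAll-spec : ∀ {n s} f (loc : Fin n → ℕ) (ts : Vec (Tree n depth) s) σ z →
    (∀ i → σ (loc i) ≡ lookup z i) → (∀ i → lookup z i < W) → (∀ i → loc i < f) → f + s ≤ U →
    OKs σ (setAll depth f loc ts) ×
    (∀ j → runs σ (setAll depth f loc ts) (f + toℕ j) ≡ evalTree depth z (lookup ts j)) ×
    (∀ x → x < f ⊎ f + s ≤ x → runs σ (setAll depth f loc ts) x ≡ σ x)
  setAll-spec f loc [] σ z inputs z<W loc< le = tt , (λ ()) , (λ _ _ → refl)
  setAll-spec {s = suc s} f loc (t ∷ ts) σ z inputs z<W loc< le
    with setAll-spec (suc f) loc ts (run σ (set f (treeᵉ loc depth t))) z
           (λ i → trans (↦-other σ f _ (<⇒≢ (loc< i))) (inputs i)) z<W (λ i → m<n⇒m<1+n (loc< i)) (≤-trans (≤-reflexive (sym (+-suc f s))) le)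
  ... | ok , out , frame = ((f<U , tree-fits loc (λ i → <-trans (loc< i) f<U) t) , ok) , outputs ,
        λ { x (inj₁ lt) → trans (frame x (inj₁ (m<n⇒m<1+n lt))) (↦-other σ f _ (<⇒≢ lt))
          ; x (inj₂ ge) → trans (frame x (inj₂ (≤-trans (≤-reflexive (sym (+-suc f s))) ge)))
                                (↦-other σ f _ (>⇒≢ (≤-trans (≤-trans (s≤s (m≤m+n f s)) (≤-reflexive (sym (+-suc f s)))) ge))) }
    where
    f<U : f < U
    f<U = ≤-trans (≤-trans (s≤s (m≤m+n f s)) (≤-reflexive (sym (+-suc f s)))) le
    outputs : ∀ j → runs σ (setAll depth f loc (t ∷ ts)) (f + toℕ j) ≡ evalTree depth z (lookup (t ∷ ts) j)
    outputs zero    = trans (cong (runs (run σ (set f (treeᵉ loc depth t))) (setAll depth (suc f) loc ts)) (+-identityʳ f))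
      (trans (frame f (inj₁ ≤-refl)) (trans (↦-same σ f _ refl) (value-tree loc σ z inputs z<W depth t)))
    outputs (suc j) = trans (cong (runs (run σ (set f (treeᵉ loc depth t))) (setAll depth (suc f) loc ts)) (+-suc f (toℕ j))) (out j)

  -- Every stage writes beyond its inputs, which is the purpose of requiring `loc i < f`: no value
  -- is overwritten before it is read.
  networkCode-spec : ∀ k f (loc : Fin (2 ^ k) → ℕ) σ z → 1 < f →
    (∀ i → σ (loc i) ≡ lookup z i) → (∀ i → lookup z i < W) → (∀ i → loc i < f) → f + 2 ^ k ≤ U →
    OKs σ (networkCode k loc f) ×
    runs σ (networkCode k loc f) 1 ≡ network k z ×
    (∀ x → x ≢ 1 → x < f ⊎ f + 2 ^ k ≤ x → runs σ (networkCode k loc f) x ≡ σ x)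
  networkCode-spec zero f loc σ z 1<f inputs z<W loc< le =
    ((≤-trans 1<f f≤U , (<-≤-trans (loc< zero) f≤U , m≤n⇒m≤o+n (depth * 12) (m≤m+n 2 38))) , tt) ,
    trans (cong (λ x → alu Op.add x 0) (inputs zero)) (alu-+0 (z<W zero)) ,
    λ x ne _ → ↦-other σ 1 _ ne
    where
    f≤U : f ≤ U
    f≤U = ≤-trans (m≤m+n f 1) le
  networkCode-spec (suc k) f loc σ z 1<f inputs z<W loc< le
    with setAll-spec f loc (proj₁ (stage k)) σ z inputs z<W loc< (≤-trans (+-monoʳ-≤ f (m≤m+n (2 ^ k) (2 ^ k + 0))) le)
  ... | ok₁ , out₁ , fr₁
    with networkCode-spec k (f + 2 ^ k) (λ i → f + toℕ i) (runs σ (setAll depth f loc (proj₁ (stage k)))) (Vec.map (evalTree depth z) (proj₁ (stage k)))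
           (≤-trans 1<f (m≤m+n f (2 ^ k))) (λ j → trans (out₁ j) (sym (Vecₚ.lookup-map j (evalTree depth z) (proj₁ (stage k)))))
           (λ j → subst (_< W) (trans (value-tree loc σ z inputs z<W depth (lookup (proj₁ (stage k)) j)) (sym (Vecₚ.lookup-map j (evalTree depth z) (proj₁ (stage k)))))
                    (value< (treeᵉ loc depth (lookup (proj₁ (stage k)) j)) σ))
           (λ j → +-monoʳ-< f (Finₚ.toℕ<n j))
           (≤-trans (≤-reflexive (trans (+-assoc f (2 ^ k) (2 ^ k)) (cong (λ x → f + (2 ^ k + x)) (sym (+-identityʳ (2 ^ k)))))) le)
  ... | ok₂ , out₂ , fr₂ = OKs-++ σ first second ok₁ ok₂ ,
      trans (cong (λ g → g 1) (runs-++ σ first second)) out₂ ,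
      λ x ne r → trans (cong (λ g → g x) (runs-++ σ first second)) (trans (fr₂ x ne (outer x r)) (fr₁ x (inner x r)))
    where
    first = setAll depth f loc (proj₁ (stage k))
    second = networkCode k (λ i → f + toℕ i) (f + 2 ^ k)
    double : f + 2 ^ k + 2 ^ k ≡ f + 2 ^ suc k
    double = trans (+-assoc f (2 ^ k) (2 ^ k)) (cong (λ x → f + (2 ^ k + x)) (sym (+-identityʳ (2 ^ k))))
    outer : ∀ x → x < f ⊎ f + 2 ^ suc k ≤ x → x < f + 2 ^ k ⊎ f + 2 ^ k + 2 ^ k ≤ x
    outer x (inj₁ lt) = inj₁ (≤-trans lt (m≤m+n f (2 ^ k)))
    outer x (inj₂ ge) = inj₂ (≤-trans (≤-reflexive double) ge)
    inner : ∀ x → x < f ⊎ f + 2 ^ suc k ≤ x → x < f ⊎ f + 2 ^ k ≤ x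
    inner x (inj₁ lt) = inj₁ lt
    inner x (inj₂ ge) = inj₂ (≤-trans (+-monoʳ-≤ f (m≤m+n (2 ^ k) (2 ^ k + 0))) ge)

-- The update program

-- The update program is generic in the hash functions, so that it serves the sketch and exact
-- counting alike.
record HashCode : Set where
  field
    hᵉ σᵉ    : ℕ → Expr
    h-height : ∀ i → height (hᵉ i) ≤ 30
    σ-height : ∀ i → height (σᵉ i) ≤ 30
    h-cost   : ∀ i → cost (hᵉ i) ≤ 60
    σ-cost   : ∀ i → cost (σᵉ i) ≤ 60

-- The variables are 0 for the item, 1 and 2 for the estimate, 3 to 6 for scratch, then for each of the 2ᵏ copies its ten
-- coefficients and its estimate, the outputs of the network, and 2B counters for each copy.
module Layout (k B : ℕ) (H : HashCode) where

  open HashCode H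

  r = 2 ^ k

  coefficientAt : ℕ → ℕ → ℕ
  coefficientAt i c = 7 + (i * 10 + c)

  estimateAt : ℕ → ℕ
  estimateAt i = 7 + (r * 10 + i)

  networkAt : ℕ
  networkAt = 7 + (r * 10 + r)

  counterAt : ℕ → ℕ → ℕ
  counterAt i v = 7 + (r * 10 + (r + r + (i * (B + B) + v)))

  rest = r + r + r * (B + B)

  variables : ℕ
  variables = 7 + (r * 10 + rest)

  ownᵉ otherᵉ : ℕ → Expr
  ownᵉ i   = bin Op.add (imm (counterAt i 0)) (bin Op.add (hᵉ i) (bin Op.mul (σᵉ i) (imm B)))
  otherᵉ i = bin Op.add (imm (counterAt i 0)) (bin Op.add (hᵉ i) (bin Op.mul (bin Op.sub (imm 1) (σᵉ i)) (imm B)))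

  succᵉ : Expr
  succᵉ = bin Op.add (var 5) (imm 1)

  estimateᵉ : ℕ → Expr
  estimateᵉ i = bin Op.sub (bin Op.add (bin Op.add (var (estimateAt i)) (bin Op.mul (imm 2) (var 5))) (imm 1)) (bin Op.mul (imm 2) (var 6))

  copyCode : ℕ → List Stmt
  copyCode i = set 3 (ownᵉ i) ∷ set 4 (otherᵉ i) ∷ get 5 (var 3) ∷ get 6 (var 4) ∷ put (var 3) succᵉ ∷
               set (estimateAt i) (estimateᵉ i) ∷ []

  copiesCode : ℕ → List Stmt
  copiesCode zero    = []
  copiesCode (suc i) = copiesCode i ++ copyCode i

  updateCode : List Stmt
  updateCode = copiesCode r ++ networkCode k (λ i → estimateAt (toℕ i)) networkAt

  copy-cost : ∀ i → ∑ (copyCode i) stmt-cost ≤ 300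
  copy-cost i = ≤-trans (≤-reflexive (e (cost (hᵉ i)) (cost (σᵉ i))))
    (≤-trans (+-monoˡ-≤ 38 (+-mono-≤ (*-monoʳ-≤ 2 (h-cost i)) (*-monoʳ-≤ 2 (σ-cost i)))) (m≤m+n 278 22))
    where
    e : ∀ x y → (1 + (x + (y + 2 + 1) + 1) + 1) + ((1 + (x + (1 + (y + 1) + 2 + 1) + 1) + 1) + 24) ≡ 2 * x + 2 * y + 38
    e = ℕ-Solver.solve-∀

  copies-cost : ∀ i → ∑ (copiesCode i) stmt-cost ≤ i * 300
  copies-cost zero    = z≤n
  copies-cost (suc i) = ≤-trans (≤-reflexive (∑-++ (copiesCode i) (copyCode i) stmt-cost))
    (≤-trans (+-mono-≤ (copies-cost i) (copy-cost i)) (≤-reflexive (+-comm (i * 300) 300)))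

  update-cost : length (codes updateCode) ≤ r * (300 + (tree-cost-bound + 1))
  update-cost = begin
    length (codes updateCode)                        ≡⟨ length-codes updateCode ⟩
    ∑ updateCode stmt-cost                           ≡⟨ ∑-++ (copiesCode r) net stmt-cost ⟩
    ∑ (copiesCode r) stmt-cost + ∑ net stmt-cost     ≤⟨ +-mono-≤ (copies-cost r) (networkCode-cost k _ networkAt) ⟩
    r * 300 + (r * tree-cost-bound + 1)              ≤⟨ +-monoʳ-≤ (r * 300) (+-monoʳ-≤ (r * tree-cost-bound) (m^n>0 2 k)) ⟩
    r * 300 + (r * tree-cost-bound + r)              ≡⟨ e r 300 tree-cost-bound ⟩
    r * (300 + (tree-cost-bound + 1))                ∎
    where
    open ≤-Reasoning
    net = networkCode k (λ i → estimateAt (toℕ i)) networkAt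
    e : ∀ r c t → r * c + (r * t + r) ≡ r * (c + (t + 1))
    e = ℕ-Solver.solve-∀

  coefficient< : ∀ {i c} → i < r → c < 10 → i * 10 + c < r * 10
  coefficient< {i} {c} i<r c<10 = ≤-trans (≤-trans (≤-reflexive (sym (+-suc (i * 10) c))) (+-monoʳ-≤ (i * 10) c<10))
    (≤-trans (≤-reflexive (+-comm (i * 10) 10)) (*-monoˡ-≤ 10 i<r))

  counter<ᵇ : ∀ {i v} → i < r → v < B + B → i * (B + B) + v < r * (B + B)
  counter<ᵇ {i} {v} i<r v< = ≤-trans (≤-trans (≤-reflexive (sym (+-suc (i * (B + B)) v))) (+-monoʳ-≤ (i * (B + B)) v<))
    (≤-trans (≤-reflexive (+-comm (i * (B + B)) (B + B))) (*-monoˡ-≤ (B + B) i<r))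

  counterAt< : ∀ {i v} → i < r → v < B + B → counterAt i v < variables
  counterAt< {i} {v} i<r v< = +-monoʳ-< 7 (+-monoʳ-< (r * 10) (+-monoʳ-< (r + r) (counter<ᵇ i<r v<)))

  estimateAt< : ∀ {i} → i < r → estimateAt i < networkAt
  estimateAt< i<r = +-monoʳ-< 7 (+-monoʳ-< (r * 10) i<r)

  networkAt+r≤ : networkAt + r ≤ variables
  networkAt+r≤ = +-monoʳ-≤ 7 (≤-trans (≤-reflexive (+-assoc (r * 10) r r)) (+-monoʳ-≤ (r * 10) (m≤m+n (r + r) (r * (B + B)))))

  networkAt+r≤counterAt : ∀ i v → networkAt + r ≤ counterAt i v
  networkAt+r≤counterAt i v = +-monoʳ-≤ 7 (≤-trans (≤-reflexive (+-assoc (r * 10) r r)) (+-monoʳ-≤ (r * 10) (m≤m+n (r + r) _)))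

  estimateAt<counterAt : ∀ {i} → i < r → ∀ j v → estimateAt i < counterAt j v
  estimateAt<counterAt i<r j v = <-≤-trans (estimateAt< i<r) (≤-trans (m≤m+n networkAt r) (networkAt+r≤counterAt j v))

  coefficientAt<estimateAt : ∀ {i c} → i < r → c < 10 → ∀ j → coefficientAt i c < estimateAt j
  coefficientAt<estimateAt i<r c<10 j = +-monoʳ-< 7 (<-≤-trans (coefficient< i<r c<10) (m≤m+n (r * 10) j))

  counterAt-injective : ∀ {i j u v} → u < B + B → v < B + B → counterAt i u ≡ counterAt j v → i ≡ j × u ≡ v
  counterAt-injective {i} {j} {u} {v} u< v< eq = go i j (+-cancelˡ-≡ (r + r) _ _ (+-cancelˡ-≡ (r * 10) _ _ (+-cancelˡ-≡ 7 _ _ eq)))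
    where
    D = B + B
    go : ∀ i j → i * D + u ≡ j * D + v → i ≡ j × u ≡ v
    go zero    zero    eq = refl , eq
    go zero    (suc j) eq = contradiction (≤-trans (m≤m+n D (j * D)) (≤-trans (m≤m+n (suc j * D) v) (≤-reflexive (sym eq)))) (<⇒≱ u<)
    go (suc i) zero    eq = contradiction (≤-trans (m≤m+n D (i * D)) (≤-trans (m≤m+n (suc i * D) u) (≤-reflexive eq))) (<⇒≱ v<)
    go (suc i) (suc j) eq with go i j (+-cancelˡ-≡ D _ _ (trans (sym (+-assoc D (i * D) u)) (trans eq (+-assoc D (j * D) v))))
    ... | refl , e = refl , e

  module Update (w : ℕ) (S≤W : temporaries + variables ≤ 2 ^ w) (m : ℕ) (m² : suc m * suc m < 2 ^ w) (n : ℕ)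
    (h s : ℕ → ℕ → ℕ) (h<B : ∀ i x → h i x < B) (s<2 : ∀ i x → s i x < 2) (coefficient : ℕ → ℕ → ℕ) where

    open RAM w
    open Compilation variables S≤W

    private module Sk (i : ℕ) = Sketch B (h i) (s i) (h<B i) (s<2 i)

    HasCoefficients : (ℕ → ℕ) → ℕ → Set
    HasCoefficients σ i = ∀ c → c < 10 → σ (coefficientAt i c) ≡ coefficient i c

    module _ (hᵉ-vars : ∀ i → i < r → Vars (hᵉ i)) (σᵉ-vars : ∀ i → i < r → Vars (σᵉ i))
      (hᵉ-spec : ∀ i → i < r → ∀ σ a → HasCoefficients σ i → σ 0 ≡ a → a < n → value (hᵉ i) σ ≡ h i a)
      (σᵉ-spec : ∀ i → i < r → ∀ σ a → HasCoefficients σ i → σ 0 ≡ a → a < n → value (σᵉ i) σ ≡ s i a) where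

      private
        1<W : 1 < W
        1<W = ≤-<-trans (s≤s z≤n) m²
        var<W : ∀ {x} → x < variables → x < W
        var<W lt = <-≤-trans lt (≤-trans (m≤n+m variables temporaries) S≤W)

      module Copy (i : ℕ) (i<r : i < r) (a : ℕ) (a<n : a < n) (p : List ℕ) (p<m : length p < m) (σ : ℕ → ℕ)
        (item≡ : σ 0 ≡ a) (coeffs : HasCoefficients σ i) (estimate≡ : σ (estimateAt i) ≡ Sk.value i p)
        (counters : ∀ v → v < B + B → σ (counterAt i v) ≡ Sk.counter i p v) where

        private
          open Sk i using (own; other; own<; other<; counter; counter≤length; value≤; value-∷) renaming (value to estimate)
          A  = counterAt i (own a)
          A′ = counterAt i (other a)
          C  = counter p (own a)
          C′ = counter p (other a)
          σ₁ = run σ (set 3 (ownᵉ i))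
          σ₂ = run σ₁ (set 4 (otherᵉ i))
          σ₃ = run σ₂ (get 5 (var 3))
          σ₄ = run σ₃ (get 6 (var 4))
          σ₅ = run σ₄ (put (var 3) succᵉ)
          A<  = counterAt< {i} {own a} i<r (own< a)
          A′< = counterAt< {i} {other a} i<r (other< a)

          address : ∀ s v → s ≤ 1 → h i a + s * B < B + B → v ≡ h i a + s * B →
            alu Op.add (alu Op.add (counterAt i 0) 0) (alu Op.add (h i a) (alu Op.mul s (alu Op.add B 0))) ≡ counterAt i v
          address s _ s≤1 lt refl = trans (cong₂ (alu Op.add) (alu-+0 (var<W base<)) inner)
              (trans (alu-add (subst (_< W) (sym total) (var<W (counterAt< i<r lt)))) total)
            where
            vB : h i a + s * B < W
            vB = var<W (≤-<-trans (≤-trans (m≤n+m (h i a + s * B) (i * (B + B))) (≤-trans (m≤n+m _ (r + r)) (≤-trans (m≤n+m _ (r * 10)) (m≤n+m _ 7)))) (counterAt< i<r lt))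
            base< : counterAt i 0 < variables
            base< = counterAt< i<r (≤-<-trans z≤n lt)
            B<W : B < W
            B<W = <-≤-trans (m<m+n B (≤-<-trans z≤n (h<B i a))) (≤-trans (≤-trans (m≤m*n (B + B) r {{m^n≢0 2 k}}) (≤-trans (≤-reflexive (*-comm (B + B) r))
              (≤-trans (m≤n+m (r * (B + B)) (r + r)) (≤-trans (m≤n+m rest (r * 10)) (m≤n+m _ 7))))) (≤-trans (m≤n+m variables temporaries) S≤W))
            inner : alu Op.add (h i a) (alu Op.mul s (alu Op.add B 0)) ≡ h i a + s * B
            inner = trans (cong (alu Op.add (h i a)) (trans (cong (alu Op.mul s) (alu-+0 B<W)) (alu-mul (≤-<-trans (m≤n+m (s * B) (h i a)) vB)))) (alu-add vB)
            total : counterAt i 0 + (h i a + s * B) ≡ counterAt i (h i a + s * B)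
            total = e (r * 10) (r + r) (i * (B + B)) (h i a + s * B)
              where
              e : ∀ x y z v → 7 + (x + (y + (z + 0))) + v ≡ 7 + (x + (y + (z + v)))
              e = ℕ-Solver.solve-∀

          s≤1 : s i a ≤ 1
          s≤1 = s≤s⁻¹ (s<2 i a)

          own≡ : value (ownᵉ i) σ ≡ A
          own≡ = trans (cong₂ (λ x y → alu Op.add (alu Op.add (counterAt i 0) 0) (alu Op.add x (alu Op.mul y (alu Op.add B 0))))
            (hᵉ-spec i i<r σ a coeffs item≡ a<n) (σᵉ-spec i i<r σ a coeffs item≡ a<n)) (address (s i a) (own a) s≤1 (own< a) refl)

          other≡ : value (otherᵉ i) σ₁ ≡ A′
          other≡ = trans (cong₂ (λ x y → alu Op.add (alu Op.add (counterAt i 0) 0) (alu Op.add x (alu Op.mul y (alu Op.add B 0))))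
            (hᵉ-spec i i<r σ₁ a coeffs item≡ a<n)
            (trans (cong₂ (alu Op.sub) (alu-+0 1<W) (σᵉ-spec i i<r σ₁ a coeffs item≡ a<n)) (alu-sub s≤1 1<W)))
            (address (1 ∸ s i a) (other a) (m∸n≤m 1 (s i a)) (other< a) refl)

          length<W : length p < W
          length<W = <-trans p<m (<-trans (≤-trans (n<1+n m) (m≤m*n (suc m) (suc m))) m²)
          C<W : C < W
          C<W = ≤-<-trans (counter≤length p (own a)) length<W
          C′<W : C′ < W
          C′<W = ≤-<-trans (counter≤length p (other a)) length<W

          read₃ : ∀ τ → τ 3 ≡ value (ownᵉ i) σ → value (var 3) τ ≡ A
          read₃ τ eq = trans (cong (λ x → alu Op.add x 0) (trans eq own≡)) (alu-+0 (var<W A<))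

          c₅ : σ₃ 5 ≡ C
          c₅ = trans (cong (λ x → alu Op.add (σ₂ x) 0) (read₃ σ₂ refl)) (trans (cong (λ x → alu Op.add x 0) (counters (own a) (own< a))) (alu-+0 C<W))

          a₄ : value (var 4) σ₃ ≡ A′
          a₄ = trans (cong (λ x → alu Op.add x 0) other≡) (alu-+0 (var<W A′<))

          c₆ : σ₄ 6 ≡ C′
          c₆ = trans (cong (λ x → alu Op.add (σ₃ x) 0) a₄) (trans (cong (λ x → alu Op.add x 0) (counters (other a) (other< a))) (alu-+0 C′<W))

          a₅ : value (var 3) σ₄ ≡ A
          a₅ = read₃ σ₄ refl

          -- Every number that goes into the new estimate is at most this, hence at most m², and
          -- nothing overflows.
          square : estimate p + 2 * C + 1 ≤ m * m
          square = ≤-trans (+-monoˡ-≤ 1 (+-mono-≤ (value≤ p) (*-monoʳ-≤ 2 (counter≤length p (own a)))))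
            (≤-trans (≤-reflexive (e (length p))) (*-mono-≤ p<m p<m))
            where
            e : ∀ l → l * l + 2 * l + 1 ≡ suc l * suc l
            e = ℕ-Solver.solve-∀
          m²<W : m * m < W
          m²<W = ≤-<-trans (*-mono-≤ (n≤1+n m) (n≤1+n m)) m²

          v₅ : value succᵉ σ₄ ≡ suc C
          v₅ = trans (cong₂ (alu Op.add) (trans (cong (λ x → alu Op.add x 0) c₅) (alu-+0 C<W)) (alu-+0 1<W))
            (trans (alu-add sum<) (+-comm C 1))
            where
            sum< : C + 1 < W
            sum< = ≤-<-trans (≤-trans (+-monoˡ-≤ 1 (≤-trans (m≤m+n C (C + 0)) (m≤n+m (2 * C) (estimate p)))) square) m²<W

          low : ∀ x → x ≢ A → σ₅ x ≡ σ₄ x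
          low x ne = ↦-other σ₄ (value (var 3) σ₄) _ (λ eq → ne (trans eq a₅))

          v₆ : value (estimateᵉ i) σ₅ ≡ estimate (a ∷ p)
          v₆ = begin
            value (estimateᵉ i) σ₅
              ≡⟨ cong₂ (alu Op.sub) (cong₂ (alu Op.add) (cong₂ (alu Op.add)
                   (trans (cong (λ x → alu Op.add x 0) (trans (low (estimateAt i) (<⇒≢ (estimateAt<counterAt i<r i (own a)))) estimate≡)) (alu-+0 (≤-<-trans (≤-trans (m≤m+n (estimate p) _) (≤-trans (m≤m+n _ 1) square)) m²<W)))
                   (trans (cong₂ (alu Op.mul) two (trans (cong (λ x → alu Op.add x 0) (trans (low 5 (λ ())) c₅)) (alu-+0 C<W))) (alu-mul 2C<)))
                   (alu-+0 1<W))
                   (trans (cong₂ (alu Op.mul) two (trans (cong (λ x → alu Op.add x 0) (trans (low 6 (λ ())) c₆)) (alu-+0 C′<W))) (alu-mul 2C′<)) ⟩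
            alu Op.sub (alu Op.add (alu Op.add (estimate p) (2 * C)) 1) (2 * C′)
              ≡⟨ cong (λ x → alu Op.sub x (2 * C′)) (trans (cong (λ x → alu Op.add x 1) (alu-add (≤-<-trans (≤-trans (m≤m+n _ 1) square) m²<W))) (alu-add (≤-<-trans square m²<W))) ⟩
            alu Op.sub (estimate p + 2 * C + 1) (2 * C′)
              -- By `value-∷` this subtraction does not go below zero, although the two counters may
              -- be in either order.
              ≡⟨ alu-sub (≤-trans (m≤n+m (2 * C′) (estimate (a ∷ p))) (≤-reflexive (value-∷ a p))) (≤-<-trans square m²<W) ⟩
            estimate p + 2 * C + 1 ∸ 2 * C′            ≡⟨ cong (_∸ 2 * C′) (value-∷ a p) ⟨
            estimate (a ∷ p) + 2 * C′ ∸ 2 * C′         ≡⟨ m+n∸n≡m (estimate (a ∷ p)) (2 * C′) ⟩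
            estimate (a ∷ p)                           ∎
            where
            open ≡-Reasoning
            2≤m² : 2 ≤ suc m * suc m
            2≤m² = ≤-trans (s≤s (≤-trans (s≤s z≤n) p<m)) (m≤m*n (suc m) (suc m))
            two : alu Op.add 2 0 ≡ 2
            two = alu-+0 (≤-<-trans 2≤m² m²)
            2C< : 2 * C < W
            2C< = ≤-<-trans (≤-trans (m≤n+m (2 * C) (estimate p)) (≤-trans (m≤m+n _ 1) square)) m²<W
            2C′< : 2 * C′ < W
            2C′< = ≤-<-trans (≤-trans (≤-trans (m≤n+m (2 * C′) (estimate (a ∷ p))) (≤-reflexive (value-∷ a p))) square) m²<W

          σ′ = runs σ (copyCode i)

          fits-var : ∀ {x} → x < variables → Fits (var x)
          fits-var lt = lt , m≤n⇒m≤o+n (depth * 12) (m≤m+n 2 38)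
          fits : ∀ e → Vars e → height e ≤ 39 → Fits e
          fits e v h≤ = v , m≤n⇒m≤o+n (depth * 12) (s≤s h≤)
          7≤variables : 7 ≤ variables
          7≤variables = m≤m+n 7 _
          small : ∀ {x} → x < 7 → x < variables
          small lt = <-≤-trans lt 7≤variables
          estimateAt<variables : estimateAt i < variables
          estimateAt<variables = <-≤-trans (estimateAt< i<r) (≤-trans (m≤m+n networkAt r) networkAt+r≤)

        safe : OKs σ (copyCode i)
        safe = (small (m≤m+n 4 3) , fits (ownᵉ i) (tt , hᵉ-vars i i<r , σᵉ-vars i i<r , tt)
                 (s≤s (≤-trans (⊔-lub (≤-trans (h-height i) (m≤m+n 30 1)) (s≤s (⊔-lub (σ-height i) (m≤m+n 2 28)))) (m≤m+n 31 7))))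
             , (small (m≤m+n 5 2) , fits (otherᵉ i) (tt , hᵉ-vars i i<r , (tt , σᵉ-vars i i<r) , tt)
                 (s≤s (≤-trans (⊔-lub (≤-trans (h-height i) (m≤m+n 30 2)) (s≤s (⊔-lub (s≤s (σ-height i)) (m≤m+n 2 29)))) (m≤m+n 32 6))))
             , (small (m≤m+n 6 1) , fits-var (small (m≤m+n 4 3)) , subst (_< variables) (sym (read₃ σ₂ refl)) A<)
             , (small (m≤m+n 7 0) , fits-var (small (m≤m+n 5 2)) , subst (_< variables) (sym a₄) A′<)
             , (fits-var (small (m≤m+n 4 3)) , fits succᵉ (small (m≤m+n 6 1) , tt) (m≤m+n 2 37) , subst (_< variables) (sym a₅) A<)
             , (estimateAt<variables , fits (estimateᵉ i) (((estimateAt<variables , tt , small (m≤m+n 6 1)) , tt) , tt , small (m≤m+n 7 0)) (m≤m+n 3 36))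
             , tt

        estimate-after : σ′ (estimateAt i) ≡ estimate (a ∷ p)
        estimate-after = trans (↦-same σ₅ (estimateAt i) _ refl) v₆

        counters-after : ∀ v → v < B + B → σ′ (counterAt i v) ≡ counter (a ∷ p) v
        counters-after v v< = trans (↦-other σ₅ (estimateAt i) _ (>⇒≢ (estimateAt<counterAt i<r i v))) (write (v ≟ own a))
          where
          write : Dec (v ≡ own a) → σ₅ (counterAt i v) ≡ counter (a ∷ p) v
          write (yes refl) = trans (↦-same σ₄ (value (var 3) σ₄) _ (sym a₅)) (trans v₅ (cong (_+ C) (sym (cong 𝟙 (≡ᵇ-refl v)))))
          write (no ne)    = trans (low (counterAt i v) (λ eq → ne (proj₂ (counterAt-injective {i} {i} v< (own< a) eq))))
            (trans (counters v v<) (cong (λ b → 𝟙 b + counter p v) (sym (≢⇒≡ᵇ (own a) v (λ eq → ne (sym eq))))))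

        unchanged : ∀ x → x < 3 ⊎ 7 ≤ x → x ≢ estimateAt i → (∀ v → v < B + B → x ≢ counterAt i v) → σ′ x ≡ σ x
        unchanged x r ne ne′ = trans (↦-other σ₅ (estimateAt i) _ ne) (trans (low x (ne′ (own a) (own< a)))
          (trans (↦-other σ₃ 6 _ (scratch r (m≤m+n 3 3) ≤-refl)) (trans (↦-other σ₂ 5 _ (scratch r (m≤m+n 3 2) (n≤1+n 6)))
            (trans (↦-other σ₁ 4 _ (scratch r (m≤m+n 3 1) (m≤n+m 5 2))) (↦-other σ 3 _ (scratch r ≤-refl (m≤n+m 4 3)))))))
          where
          scratch : ∀ {x c} → x < 3 ⊎ 7 ≤ x → 3 ≤ c → suc c ≤ 7 → x ≢ c
          scratch (inj₁ lt) 3≤c c<7 = <⇒≢ (<-≤-trans lt 3≤c)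
          scratch (inj₂ ge) 3≤c c<7 = >⇒≢ (<-≤-trans c<7 ge)

      record Invariant (σ : ℕ → ℕ) (p : List ℕ) : Set where
        field
          coefficients≡ : ∀ i → i < r → HasCoefficients σ i
          estimates≡    : ∀ i → i < r → σ (estimateAt i) ≡ Sk.value i p
          counters≡     : ∀ i → i < r → ∀ v → v < B + B → σ (counterAt i v) ≡ Sk.counter i p v
          denominator≡  : σ 2 ≡ 1

      estimates : List ℕ → Vec ℕ (2 ^ k)
      estimates p = Vec.tabulate (λ i → Sk.value (toℕ i) p)

      module Step (a : ℕ) (a<n : a < n) (p : List ℕ) (p<m : length p < m) (σ : ℕ → ℕ) (item≡ : σ 0 ≡ a) (I : Invariant σ p) where

        open Invariant I

        -- The state after the first `j` copies have been updated. Variables 3 to 6 are scratch and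
        -- therefore exempt from `fixed`.
        record Midway (j : ℕ) (τ : ℕ → ℕ) : Set where
          field
            estimates-done : ∀ i → i < j → τ (estimateAt i) ≡ Sk.value i (a ∷ p)
            estimates-todo : ∀ i → j ≤ i → i < r → τ (estimateAt i) ≡ Sk.value i p
            counters-done  : ∀ i → i < j → ∀ v → v < B + B → τ (counterAt i v) ≡ Sk.counter i (a ∷ p) v
            counters-todo  : ∀ i → j ≤ i → i < r → ∀ v → v < B + B → τ (counterAt i v) ≡ Sk.counter i p v
            fixed          : ∀ x → x < 3 ⊎ 7 ≤ x → x < estimateAt 0 → τ x ≡ σ x

        copies-spec : ∀ j → j ≤ r → OKs σ (copiesCode j) × Midway j (runs σ (copiesCode j))
        copies-spec zero    j≤r = tt , record
          { estimates-done = λ i () ; estimates-todo = λ i _ → estimates≡ i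
          ; counters-done = λ i () ; counters-todo = λ i _ → counters≡ i ; fixed = λ _ _ _ → refl }
        copies-spec (suc j) j<r with copies-spec j (<⇒≤ j<r)
        ... | ok , mid = OKs-++ σ (copiesCode j) (copyCode j) ok C.safe , subst (Midway (suc j)) (sym (runs-++ σ (copiesCode j) (copyCode j))) (record
          { estimates-done = λ i i≤j → case (m≤n⇒m<n∨m≡n (s≤s⁻¹ i≤j)) of λ
              { (inj₁ i<j)  → trans (estimate-kept i (<-trans i<j j<r) (<⇒≢ i<j)) (M.estimates-done i i<j)
              ; (inj₂ refl) → C.estimate-after }
          ; estimates-todo = λ i j<i i<r → trans (estimate-kept i i<r (>⇒≢ j<i)) (M.estimates-todo i (<⇒≤ j<i) i<r)
          ; counters-done = λ i i≤j v v< → case (m≤n⇒m<n∨m≡n (s≤s⁻¹ i≤j)) of λ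
              { (inj₁ i<j)  → trans (counter-kept i v v< (<⇒≢ i<j)) (M.counters-done i i<j v v<)
              ; (inj₂ refl) → C.counters-after v v< }
          ; counters-todo = λ i j<i i<r v v< → trans (counter-kept i v v< (>⇒≢ j<i)) (M.counters-todo i (<⇒≤ j<i) i<r v v<)
          ; fixed = λ x r lt → trans (C.unchanged x r (<⇒≢ (<-≤-trans lt (estimateAt-mono j))) (λ v _ → <⇒≢ (<-trans lt (estimateAt<counterAt r>0 j v)))) (M.fixed x r lt) })
          where
          τ = runs σ (copiesCode j)
          module M = Midway mid
          r>0 : 0 < r
          r>0 = ≤-<-trans z≤n j<r
          estimateAt-mono : ∀ i → estimateAt 0 ≤ estimateAt i
          estimateAt-mono i = +-monoʳ-≤ 7 (+-monoʳ-≤ (r * 10) z≤n)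
          module C = Copy j j<r a a<n p p<m τ (trans (M.fixed 0 (inj₁ (s≤s z≤n)) (s≤s z≤n)) item≡)
            (λ c c<10 → trans (M.fixed (coefficientAt j c) (inj₂ (m≤m+n 7 _)) (coefficientAt<estimateAt j<r c<10 0)) (coefficients≡ j j<r c c<10))
            (M.estimates-todo j ≤-refl j<r) (M.counters-todo j ≤-refl j<r)
          estimate-kept : ∀ i → i < r → i ≢ j → runs τ (copyCode j) (estimateAt i) ≡ τ (estimateAt i)
          estimate-kept i i<r ne = C.unchanged (estimateAt i) (inj₂ (m≤m+n 7 _)) (λ eq → ne (+-cancelˡ-≡ (r * 10) _ _ (+-cancelˡ-≡ 7 _ _ eq)))
            (λ v _ → <⇒≢ (estimateAt<counterAt i<r j v))
          counter-kept : ∀ i v → v < B + B → i ≢ j → runs τ (copyCode j) (counterAt i v) ≡ τ (counterAt i v)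
          counter-kept i v v< ne = C.unchanged (counterAt i v) (inj₂ (m≤m+n 7 _)) (>⇒≢ (estimateAt<counterAt j<r i v))
            (λ u u< eq → ne (proj₁ (counterAt-injective {i} {j} v< u< eq)))

        update-spec : OKs σ updateCode × Invariant (runs σ updateCode) (a ∷ p) × runs σ updateCode 1 ≡ network k (estimates (a ∷ p))
        update-spec = OKs-++ σ (copiesCode r) net (proj₁ copies) (proj₁ output) ,
          record
            { coefficients≡ = λ i i<r c c<10 → trans (after (coefficientAt i c) (λ ()) (inj₁ (<-trans (coefficientAt<estimateAt i<r c<10 i) (estimateAt< i<r))))
                (trans (M.fixed (coefficientAt i c) (inj₂ (m≤m+n 7 _)) (coefficientAt<estimateAt i<r c<10 0)) (coefficients≡ i i<r c c<10))
            ; estimates≡ = λ i i<r → trans (after (estimateAt i) (λ ()) (inj₁ (estimateAt< i<r))) (M.estimates-done i i<r)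
            ; counters≡ = λ i i<r v v< → trans (after (counterAt i v) (λ ()) (inj₂ (networkAt+r≤counterAt i v))) (M.counters-done i i<r v v<)
            ; denominator≡ = trans (after 2 (λ ()) (inj₁ (s≤s (s≤s (s≤s z≤n))))) (trans (M.fixed 2 (inj₁ ≤-refl) (s≤s (s≤s (s≤s z≤n)))) denominator≡) } ,
          trans (cong (λ f → f 1) (runs-++ σ (copiesCode r) net)) (proj₁ (proj₂ output))
          where
          open NetworkCode w variables S≤W 1<W using (networkCode-spec)
          copies = copies-spec r ≤-refl
          τ = runs σ (copiesCode r)
          module M = Midway (proj₂ copies)
          loc : Fin (2 ^ k) → ℕ
          loc i = estimateAt (toℕ i)
          net = networkCode k loc networkAt
          lookup-estimates : ∀ i → lookup (estimates (a ∷ p)) i ≡ Sk.value (toℕ i) (a ∷ p)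
          lookup-estimates i = Vecₚ.lookup∘tabulate (λ i → Sk.value (toℕ i) (a ∷ p)) i
          estimate<W : ∀ i → lookup (estimates (a ∷ p)) i < W
          estimate<W i = subst (_< W) (sym (lookup-estimates i)) (≤-<-trans (Sk.value≤ (toℕ i) (a ∷ p))
            (≤-<-trans (*-mono-≤ p<m p<m) (≤-<-trans (*-mono-≤ (n≤1+n m) (n≤1+n m)) m²)))
          output = networkCode-spec k networkAt loc τ (estimates (a ∷ p)) (s≤s (s≤s z≤n))
            (λ i → trans (M.estimates-done (toℕ i) (Finₚ.toℕ<n i)) (sym (lookup-estimates i))) estimate<W
            (λ i → estimateAt< (Finₚ.toℕ<n i)) networkAt+r≤
          after : ∀ x → x ≢ 1 → x < networkAt ⊎ networkAt + r ≤ x → runs σ updateCode x ≡ τ x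
          after x ne q = trans (cong (λ f → f x) (runs-++ σ (copiesCode r) net)) (proj₂ (proj₂ output) x ne q)

-- Execution of the algorithm

-- The default 0 agrees with the initial content of the cells without random bits, so that
-- statements about those hold for every index.
at : ∀ {n} → Vec ℕ n → ℕ → ℕ
at []       y       = 0
at (x ∷ xs) zero    = x
at (x ∷ xs) (suc y) = at xs y

at-toℕ : ∀ {n} (v : Vec ℕ n) i → at v (toℕ i) ≡ lookup v i
at-toℕ (x ∷ v) zero    = refl
at-toℕ (x ∷ v) (suc i) = at-toℕ v i

Below : ℕ → Set
Below b = Fin (suc b)

flatten : ∀ {n} {xs : Vec ℕ n} → VecAll.All Below xs → Vec ℕ n
flatten = VecAll.reduce toℕ

module SketchAlgorithm (k B M′ : ℕ) (H : HashCode) where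

  open Layout k B H

  algorithm : Algorithm
  algorithm = record
    { cells  = temporaries + variables
    -- A bound of 0 fixes a cell at 0, so counters and estimates start correctly and `setup` only
    -- has to write the denominator 1.
    ; random = replicate temporaries 0 Vec.++ (replicate 7 0 Vec.++ (replicate (r * 10) M′ Vec.++ replicate rest 0))
    ; setup  = toCmd (codes (set 2 (imm 1) ∷ []))
    ; update = toCmd (codes updateCode)
    ; item   = (temporaries + 0) mod (temporaries + variables)
    ; num    = (temporaries + 1) mod (temporaries + variables)
    ; den    = (temporaries + 2) mod (temporaries + variables)
    }

  time : ℕ
  time = length (codes updateCode)

  coefficientSeed : Seed algorithm → VecAll.All Below (replicate (r * 10) M′)
  coefficientSeed s = VecAllₚ.++ˡ⁻ (replicate (r * 10) M′) (VecAllₚ.++ʳ⁻ (replicate 7 0) (VecAllₚ.++ʳ⁻ (replicate temporaries 0) s))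

  coefficient : Seed algorithm → ℕ → ℕ → ℕ
  coefficient s i c = at (flatten (coefficientSeed s)) (i * 10 + c)

  module Executions (w : ℕ) (S≤W : temporaries + variables ≤ 2 ^ w) (m : ℕ) (m² : suc m * suc m < 2 ^ w)
    (n : ℕ) (n≤W : n ≤ 2 ^ w) (M′<W : M′ < 2 ^ w) where

    open RAM w
    open Compilation variables S≤W using (user; Vars; OKs; perform)
    open Soundness (temporaries + variables) {{cells≢0 {variables}}}
    open Execution algorithm w
    open Machine w using (Mem; word; ⟨_,_⟩⇓⟨_,_⟩)

    private
      0<W : 0 < W
      0<W = ≤-<-trans z≤n m²
      S₀ = temporaries + variables

      load : ∀ {n} {xs : Vec ℕ n} → VecAll.All Below xs → Vec ℕ n
      load s = Vec.map toℕ (VecAll.reduce (λ r → word (toℕ r)) s)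

      load-ʳ : ∀ {m n} (xs : Vec ℕ m) {ys : Vec ℕ n} (s : VecAll.All Below (xs Vec.++ ys)) y → at (load s) (m + y) ≡ at (load (VecAllₚ.++ʳ⁻ xs s)) y
      load-ʳ []       s              y = refl
      load-ʳ (x ∷ xs) (p VecAll.∷ s) y = load-ʳ xs s y

      load-ˡ : ∀ {m n} (xs : Vec ℕ m) {ys : Vec ℕ n} (s : VecAll.All Below (xs Vec.++ ys)) y → y < m → at (load s) y ≡ at (load (VecAllₚ.++ˡ⁻ xs s)) y
      load-ˡ (x ∷ xs) (p VecAll.∷ s) zero    lt       = refl
      load-ˡ (x ∷ xs) (p VecAll.∷ s) (suc y) (s≤s lt) = load-ˡ xs s y lt

      load-zeros : ∀ n (s : VecAll.All Below (replicate n 0)) y → at (load s) y ≡ 0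
      load-zeros zero    VecAll.[]         y       = refl
      load-zeros (suc n) (zero VecAll.∷ s) zero    = toℕ-word< 0<W
      load-zeros (suc n) (p VecAll.∷ s)    (suc y) = load-zeros n s y

      load-small : ∀ n (s : VecAll.All Below (replicate n M′)) y → at (load s) y ≡ at (flatten s) y
      load-small zero    VecAll.[]      y       = refl
      load-small (suc n) (p VecAll.∷ s) zero    = toℕ-word< (≤-<-trans (s≤s⁻¹ (Finₚ.toℕ<n p)) M′<W)
      load-small (suc n) (p VecAll.∷ s) (suc y) = load-small n s y

      load-variable : ∀ (s : Seed algorithm) y → at (load s) (temporaries + (7 + y)) ≡ at (load (VecAllₚ.++ʳ⁻ (replicate 7 0) (VecAllₚ.++ʳ⁻ (replicate temporaries 0) s))) y
      load-variable s y = trans (load-ʳ (replicate temporaries 0) s (7 + y)) (load-ʳ (replicate 7 0) (VecAllₚ.++ʳ⁻ (replicate temporaries 0) s) y)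

      load-coefficient : ∀ s y → y < r * 10 → at (load s) (temporaries + (7 + y)) ≡ at (flatten (coefficientSeed s)) y
      load-coefficient s y lt = trans (load-variable s y) (trans (load-ˡ (replicate (r * 10) M′) (VecAllₚ.++ʳ⁻ (replicate 7 0) (VecAllₚ.++ʳ⁻ (replicate temporaries 0) s)) y lt)
        (load-small (r * 10) (coefficientSeed s) y))

      load-rest : ∀ s y → at (load s) (temporaries + (7 + (r * 10 + y))) ≡ 0
      load-rest s y = trans (load-variable s (r * 10 + y)) (trans (load-ʳ (replicate (r * 10) M′) (VecAllₚ.++ʳ⁻ (replicate 7 0) (VecAllₚ.++ʳ⁻ (replicate temporaries 0) s)) y)
        (load-zeros rest (VecAllₚ.++ʳ⁻ (replicate (r * 10) M′) (VecAllₚ.++ʳ⁻ (replicate 7 0) (VecAllₚ.++ʳ⁻ (replicate temporaries 0) s))) y))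

    ≈-load : ∀ s → initial s ≈ at (load s)
    ≈-load s i = sym (trans (at-toℕ (load s) i) (Vecₚ.lookup-map i toℕ (initial s)))

    address : ∀ {x} → x < variables → toℕ ((temporaries + x) mod S₀) ≡ temporaries + x
    address lt = toℕ-mod (+-monoʳ-< temporaries lt)

    module Seeded (s : Seed algorithm) (h σ : ℕ → ℕ → ℕ) (h<B : ∀ i x → h i x < B) (σ<2 : ∀ i x → σ i x < 2) where

      open Update w S≤W m m² n h σ h<B σ<2 (coefficient s) using (HasCoefficients; module Step; Invariant; estimates)

      module Correct (hᵉ-vars : ∀ i → i < r → Vars (HashCode.hᵉ H i)) (σᵉ-vars : ∀ i → i < r → Vars (HashCode.σᵉ H i))
        (hᵉ-spec : ∀ i → i < r → ∀ τ a → HasCoefficients τ i → τ 0 ≡ a → a < n → value (HashCode.hᵉ H i) τ ≡ h i a)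
        (σᵉ-spec : ∀ i → i < r → ∀ τ a → HasCoefficients τ i → τ 0 ≡ a → a < n → value (HashCode.σᵉ H i) τ ≡ σ i a) where

        private
          Inv : (ℕ → ℕ) → List ℕ → Set
          Inv = Invariant hᵉ-vars σᵉ-vars hᵉ-spec σᵉ-spec

        median-estimate : List ℕ → ℕ
        median-estimate p = network k (estimates hᵉ-vars σᵉ-vars hᵉ-spec σᵉ-spec p)

        -- Before the first item nothing has been output; tracking starts at time 1.
        Output : (ℕ → ℕ) → List ℕ → Set
        Output τ []      = ⊤
        Output τ (a ∷ p) = τ 1 ≡ median-estimate (a ∷ p)

        Represents : Mem S₀ → List ℕ → Set
        Represents M p = ∃ λ ρ → M ≈ ρ × Inv (user ρ) p × Output (user ρ) p

        Invariant-cong : ∀ {τ τ′ p} → (∀ x → τ′ x ≡ τ x) → Inv τ p → Inv τ′ p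
        Invariant-cong eq inv = record
          { coefficients≡ = λ i i<r c c<10 → trans (eq _) (I.coefficients≡ i i<r c c<10)
          ; estimates≡ = λ i i<r → trans (eq _) (I.estimates≡ i i<r)
          ; counters≡ = λ i i<r v v< → trans (eq _) (I.counters≡ i i<r v v<)
          ; denominator≡ = trans (eq 2) I.denominator≡ }
          where module I = Invariant inv

        initialised : Inv (user (at (load s)) [ 2 ↦ 1 ]) []
        initialised = record
          { coefficients≡ = λ i i<r c c<10 → load-coefficient s (i * 10 + c) (coefficient< i<r c<10)
          ; estimates≡ = λ i i<r → trans (load-rest s i) (sym (∑-zero (downFrom B)))
          ; counters≡ = λ i i<r v v< → load-rest s _
          ; denominator≡ = refl }

        started : ∃ λ M → ⟨ setup algorithm , initial s ⟩⇓⟨ length (codes (set 2 (imm 1) ∷ [])) , M ⟩ × Represents M []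
        started with perform (set 2 (imm 1) ∷ []) {initial s} {at (load s)} (≈-load s) ((m≤m+n 3 _ , tt , m≤n⇒m≤o+n (depth * 12) (m≤m+n 2 38)) , tt)
        ... | M , ρ , run , M≈ρ , eq = M , run , ρ , M≈ρ ,
          Invariant-cong (λ x → trans (eq x) (↦-cong {user (at (load s))} {x = 2} (λ _ → refl) refl (alu-+0 (≤-<-trans (s≤s z≤n) m²)) x)) initialised , tt

        module _ (a : Fin n) (p : List ℕ) (p<m : length p < m) (ρ : ℕ → ℕ) (inv : Inv (user ρ) p) where

          received : ℕ → ℕ
          received = ρ [ toℕ (item algorithm) ↦ toℕ (word (toℕ a)) ]

          private
            item≡address : toℕ (item algorithm) ≡ temporaries + 0
            item≡address = address (s≤s z≤n)

          received-other : ∀ y → user received (suc y) ≡ user ρ (suc y)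
          received-other y = ↦-other ρ _ _ (λ eq → contradiction (+-cancelˡ-≡ temporaries (suc y) 0 (trans eq item≡address)) λ ())

          received-item : user received 0 ≡ toℕ a
          received-item = trans (↦-same ρ _ _ (sym item≡address)) (toℕ-word< (<-≤-trans (Finₚ.toℕ<n a) n≤W))

          received-invariant : Inv (user received) p
          received-invariant = record
            { coefficients≡ = λ i i<r c c<10 → trans (received-other _) (J.coefficients≡ i i<r c c<10)
            ; estimates≡ = λ i i<r → trans (received-other _) (J.estimates≡ i i<r)
            ; counters≡ = λ i i<r v v< → trans (received-other _) (J.counters≡ i i<r v v<)
            ; denominator≡ = trans (received-other 1) J.denominator≡ }
            where module J = Invariant inv

          processed : OKs (user received) updateCode × Inv (runs (user received) updateCode) (toℕ a ∷ p) ×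
                      runs (user received) updateCode 1 ≡ median-estimate (toℕ a ∷ p)
          processed = Step.update-spec hᵉ-vars σᵉ-vars hᵉ-spec σᵉ-spec (toℕ a) (Finₚ.toℕ<n a) p p<m (user received) received-item received-invariant

        advance : ∀ (a : Fin n) p M → length p < m → Represents M p →
          ∃ λ M″ → ⟨ update algorithm , M [ item algorithm ]≔ word (toℕ a) ⟩⇓⟨ time , M″ ⟩ × Represents M″ (toℕ a ∷ p)
        advance a p M p<m (ρ , M≈ρ , inv , _) = finish (processed a p p<m ρ inv)
          where
          finish : OKs (user (received a p p<m ρ inv)) updateCode × Inv (runs (user (received a p p<m ρ inv)) updateCode) (toℕ a ∷ p) ×
                   runs (user (received a p p<m ρ inv)) updateCode 1 ≡ median-estimate (toℕ a ∷ p) → _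
          finish (ok , inv′ , out) with perform updateCode {M [ item algorithm ]≔ word (toℕ a)} {received a p p<m ρ inv} (≈-write {M} {ρ} M≈ρ (item algorithm) (word (toℕ a))) ok
          ... | M″ , ρ″ , run , eq , eq′ = M″ , run , ρ″ , eq , Invariant-cong eq′ inv′ , trans (eq′ 1) out

        runs-on : ∀ (as : Stream n) p M → length as + length p ≤ m → Represents M p →
          ∃ λ M′ → Run M as (List.replicate (length as) time) M′ × Represents M′ (map toℕ as List.ʳ++ p)
        runs-on []       p M le R = M , [] , R
        runs-on (a ∷ as) p M le R = proj₁ later , proj₁ (proj₂ now) ∷ proj₁ (proj₂ later) , proj₂ (proj₂ later)
          where
          now = advance a p M (≤-trans (s≤s (m≤n+m (length p) (length as))) le) R
          later = runs-on as (toℕ a ∷ p) (proj₁ now) (≤-trans (≤-reflexive (+-suc (length as) (length p))) le) (proj₂ (proj₂ now))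

        executes : ∀ (as : Stream n) → length as ≤ m →
          ∃ λ M → RunFromStart s as (List.replicate (length as) time) M × Represents M (history as)
        executes as le = proj₁ ran , (_ , proj₁ started , proj₁ (proj₂ started) , proj₁ (proj₂ ran)) , proj₂ (proj₂ ran)
          where
          ran = runs-on as [] (proj₁ started) (≤-trans (≤-reflexive (+-identityʳ (length as))) le) (proj₂ (proj₂ started))

        estimate≡ : ∀ {M a p} → Represents M (a ∷ p) → estimate M ≡ fromℕ (median-estimate (a ∷ p))
        estimate≡ {M} {a} {p} (ρ , M≈ρ , inv , out) = cong₂ quotient
          (trans (M≈ρ (num algorithm)) (trans (cong ρ (address (s≤s (s≤s z≤n)))) out))
          (trans (M≈ρ (den algorithm)) (trans (cong ρ (address (s≤s (s≤s (s≤s z≤n))))) (Invariant.denominator≡ inv)))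

        represented-estimate : ∀ {M p} → (∃₂ λ a q → p ≡ a ∷ q) → Represents M p → estimate M ≡ fromℕ (median-estimate p)
        represented-estimate {M} (a , q , refl) R = estimate≡ {M} {a} {q} R

    Run-unique : ∀ {M M₁ M₂} {as : Stream n} {ks₁ ks₂} → Run M as ks₁ M₁ → Run M as ks₂ M₂ → M₁ ≡ M₂
    Run-unique []        []          = refl
    Run-unique (p ∷ ps) (q ∷ qs) with refl ← deterministic p q = Run-unique ps qs

    RunFromStart-unique : ∀ {s M₁ M₂} {as : Stream n} {ks₁ ks₂} → RunFromStart s as ks₁ M₁ → RunFromStart s as ks₂ M₂ → M₁ ≡ M₂
    RunFromStart-unique (_ , _ , p , ps) (_ , _ , q , qs) with refl ← deterministic p q = Run-unique ps qs

-- Counting seeds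

remove : ∀ {a} {A : Set a} (f : A → ℕ) {xs : List A} {y} → y ∈ xs →
  ∃ λ ys → ∑ xs f ≡ f y + ∑ ys f × (∀ z → z ∈ xs → z ≢ y → z ∈ ys)
remove f {x ∷ xs} (here refl) = xs , refl , λ { z (here refl) ne → contradiction refl ne ; z (there z∈) ne → z∈ }
remove f {x ∷ xs} {y} (there y∈) with remove f y∈
... | ys , eq , sub = x ∷ ys , trans (cong (f x +_) eq) (e (f x) (f y) (∑ ys f)) ,
    λ { z (here refl) ne → here refl ; z (there z∈) ne → there (sub z z∈ ne) }
  where
  e : ∀ a b c → a + (b + c) ≡ b + (a + c)
  e = ℕ-Solver.solve-∀

unique-count : ∀ {a} {A : Set a} (f : A → ℕ) (xs ys : List A) → Unique ys → All (_∈ xs) ys → All (λ y → 1 ≤ f y) ys → length ys ≤ ∑ xs f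
unique-count f xs []       _            _          _        = z≤n
unique-count f xs (y ∷ ys) (y∉ ∷ uniq) (y∈ ∷ ys∈) (p ∷ ps) with remove f y∈
... | zs , eq , sub = ≤-trans (+-mono-≤ p (unique-count f zs ys uniq
    (All.zipWith (λ { {z} (z∈ , y≢z) → sub z z∈ (λ eq → y≢z (sym eq)) }) (ys∈ , y∉)) ps)) (≤-reflexive (sym eq))

sizes : ∀ {n} → Vec ℕ n → ℕ
sizes v = List.product (map suc (Vec.toList v))

sizes-++ : ∀ {m n} (v : Vec ℕ m) (w : Vec ℕ n) → sizes (v Vec.++ w) ≡ sizes v * sizes w
sizes-++ []      w = sym (+-identityʳ _)
sizes-++ (x ∷ v) w = trans (cong (suc x *_) (sizes-++ v w)) (sym (*-assoc (suc x) (sizes v) (sizes w)))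

sizes-replicate : ∀ n b → sizes (replicate n b) ≡ suc b ^ n
sizes-replicate zero    b = refl
sizes-replicate (suc n) b = cong (suc b *_) (sizes-replicate n b)

at-flatten< : ∀ n b (s : VecAll.All Below (replicate n b)) y → at (flatten s) y < suc b
at-flatten< zero    b VecAll.[]      y       = s≤s z≤n
at-flatten< (suc n) b (p VecAll.∷ s) zero    = Finₚ.toℕ<n p
at-flatten< (suc n) b (p VecAll.∷ s) (suc y) = at-flatten< n b s y

flatten-injective : ∀ {n} {v : Vec ℕ n} (s t : VecAll.All Below v) → (∀ y → y < n → at (flatten s) y ≡ at (flatten t) y) → s ≡ t
flatten-injective VecAll.[]      VecAll.[]      eq = refl
flatten-injective (p VecAll.∷ s) (q VecAll.∷ t) eq =
  cong₂ VecAll._∷_ (Finₚ.toℕ-injective (eq 0 (s≤s z≤n))) (flatten-injective s t (λ y lt → eq (suc y) (s≤s lt)))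

zeros-unique : ∀ {n} (s t : VecAll.All Below (replicate n 0)) → s ≡ t
zeros-unique {zero}  VecAll.[]         VecAll.[]         = refl
zeros-unique {suc n} (zero VecAll.∷ s) (zero VecAll.∷ t) = cong (zero VecAll.∷_) (zeros-unique s t)

++-unique : ∀ {m n} (v : Vec ℕ m) {w : Vec ℕ n} (s t : VecAll.All Below (v Vec.++ w)) →
  VecAllₚ.++ˡ⁻ v s ≡ VecAllₚ.++ˡ⁻ v t → VecAllₚ.++ʳ⁻ v s ≡ VecAllₚ.++ʳ⁻ v t → s ≡ t
++-unique []      s              t              eq eq′ = eq′
++-unique (x ∷ v) (p VecAll.∷ s) (q VecAll.∷ t) eq eq′ = cong₂ VecAll._∷_ (cong VecAll.head eq) (++-unique v s t (cong VecAll.tail eq) eq′)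

module SeedCounting (k B M′ : ℕ) (H : HashCode) where

  open Layout k B H using (r; rest)
  open SketchAlgorithm k B M′ H

  #seeds≡ : #seeds algorithm ≡ suc M′ ^ (r * 10)
  #seeds≡ = trans (sizes-++ (replicate temporaries 0) (replicate 7 0 Vec.++ (replicate (r * 10) M′ Vec.++ replicate rest 0))) (trans (cong₂ _*_ (ones temporaries) (trans (sizes-++ (replicate 7 0) (replicate (r * 10) M′ Vec.++ replicate rest 0))
    (cong₂ _*_ (ones 7) (trans (sizes-++ (replicate (r * 10) M′) (replicate rest 0)) (cong₂ _*_ (sizes-replicate (r * 10) M′) (ones rest))))))
    (trans (*-identityˡ _) (trans (*-identityˡ _) (*-identityʳ _))))
    where
    ones : ∀ n → sizes (replicate n 0) ≡ 1
    ones n = trans (sizes-replicate n 0) (^-zeroˡ n)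

  coefficients : Seed algorithm → ℕ → Vec ℕ 10
  coefficients s i = c 0 ∷ c 1 ∷ c 2 ∷ c 3 ∷ c 4 ∷ c 5 ∷ c 6 ∷ c 7 ∷ c 8 ∷ c 9 ∷ []
    where
    c : ℕ → ℕ
    c = coefficient s i

  coefficientVectors : Seed algorithm → Vec (Vec ℕ 10) r
  coefficientVectors s = Vec.tabulate (λ i → coefficients s (toℕ i))

  private
    at-coefficients : ∀ s i c → c < 10 → at (coefficients s i) c ≡ coefficient s i c
    at-coefficients s i 0 _ = refl
    at-coefficients s i 1 _ = refl
    at-coefficients s i 2 _ = refl
    at-coefficients s i 3 _ = refl
    at-coefficients s i 4 _ = refl
    at-coefficients s i 5 _ = refl
    at-coefficients s i 6 _ = refl
    at-coefficients s i 7 _ = refl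
    at-coefficients s i 8 _ = refl
    at-coefficients s i 9 _ = refl
    at-coefficients s i (suc (suc (suc (suc (suc (suc (suc (suc (suc (suc c))))))))))
      (s≤s (s≤s (s≤s (s≤s (s≤s (s≤s (s≤s (s≤s (s≤s (s≤s ()))))))))))

  coefficientVectors-injective : ∀ {s t} → coefficientVectors s ≡ coefficientVectors t → s ≡ t
  coefficientVectors-injective {s} {t} eq =
    ++-unique (replicate temporaries 0) s t (zeros-unique _ _) (++-unique (replicate 7 0) _ _ (zeros-unique _ _)
      (++-unique (replicate (r * 10) M′) _ _ (flatten-injective (coefficientSeed s) (coefficientSeed t) same) (zeros-unique _ _)))
    where
    copy : ∀ i c → i < r → c < 10 → coefficient s i c ≡ coefficient t i c
    copy i c i<r c<10 = trans (sym (at-coefficients s i c c<10)) (trans (cong (λ v → at v c)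
      (trans (cong (coefficients s) (sym (Finₚ.toℕ-fromℕ< i<r))) (trans (sym (Vecₚ.lookup∘tabulate (λ i → coefficients s (toℕ i)) (Fin.fromℕ< i<r)))
        (trans (cong (λ v → lookup v (Fin.fromℕ< i<r)) eq) (trans (Vecₚ.lookup∘tabulate (λ i → coefficients t (toℕ i)) (Fin.fromℕ< i<r))
          (cong (coefficients t) (Finₚ.toℕ-fromℕ< i<r))))))) (at-coefficients t i c c<10))
    same : ∀ y → y < r * 10 → at (flatten (coefficientSeed s)) y ≡ at (flatten (coefficientSeed t)) y
    same y lt = subst (λ y → at (flatten (coefficientSeed s)) y ≡ at (flatten (coefficientSeed t)) y)
      (trans (+-comm (y / 10 * 10) (y % 10)) (sym (m≡m%n+[m/n]*n y 10))) (copy (y / 10) (y % 10) (m<n*o⇒m/o<n lt) (m%n<n y 10))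

  coefficientVectors∈ : ∀ s → coefficientVectors s ∈ tuples r (tuples 10 (downFrom (suc M′)))
  coefficientVectors∈ s = ∈-tuples (coefficientVectors s) λ i → subst (_∈ tuples 10 (downFrom (suc M′)))
    (sym (Vecₚ.lookup∘tabulate (λ i → coefficients s (toℕ i)) i)) (∈-tuples (coefficients s (toℕ i)) λ c → ∈-downFrom
      (subst (_< suc M′) (trans (sym (at-coefficients s (toℕ i) (toℕ c) (Finₚ.toℕ<n c))) (at-toℕ (coefficients s (toℕ i)) c)) (at-flatten< (r * 10) M′ (coefficientSeed s) _)))

  bad-seeds : (bad : Vec ℕ 10 → Bool) → ∑ (tuples 10 (downFrom (suc M′))) (λ v → 𝟙 (bad v)) * 2 ^ (2 * 16) ≤ length (tuples 10 (downFrom (suc M′))) →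
    (ss : List (Seed algorithm)) → Unique ss → All (λ s → 1 ≤ excess (Vec.map bad (coefficientVectors s))) ss → length ss * 2 ^ r ≤ #seeds algorithm
  bad-seeds bad h ss uniq exc = *-cancelʳ-≤ _ _ (2 ^ r) {{m^n≢0 2 r}} (begin
    length ss * 2 ^ r * 2 ^ r            ≡⟨ *-assoc (length ss) (2 ^ r) (2 ^ r) ⟩
    length ss * (2 ^ r * 2 ^ r)          ≡⟨ cong (length ss *_) (trans (sym (^-distribˡ-+-* 2 r r)) (cong (λ x → 2 ^ (r + x)) (sym (+-identityʳ r)))) ⟩
    length ss * 2 ^ (2 * r)              ≤⟨ *-monoˡ-≤ (2 ^ (2 * r)) few ⟩
    ∑ (tuples r (tuples 10 xs)) (λ v → excess (Vec.map bad v)) * 2 ^ (2 * r) ≤⟨ chernoff (tuples 10 xs) bad 2 r h ⟩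
    2 ^ r * length (tuples 10 xs) ^ r    ≡⟨ cong (2 ^ r *_) total ⟩
    2 ^ r * #seeds algorithm             ≡⟨ *-comm (2 ^ r) _ ⟩
    #seeds algorithm * 2 ^ r             ∎)
    where
    open ≤-Reasoning
    xs = downFrom (suc M′)
    few : length ss ≤ ∑ (tuples r (tuples 10 xs)) (λ v → excess (Vec.map bad v))
    few = ≤-trans (≤-reflexive (sym (Listₚ.length-map coefficientVectors ss)))
      (unique-count (λ v → excess (Vec.map bad v)) (tuples r (tuples 10 xs)) (map coefficientVectors ss)
        (Uniqueₚ.map⁺ coefficientVectors-injective uniq) (Allₚ.map⁺ (All.universal coefficientVectors∈ ss)) (Allₚ.map⁺ exc))
    total : length (tuples 10 xs) ^ r ≡ #seeds algorithm
    total = trans (cong (_^ r) (trans (length-tuples 10 xs) (cong (_^ 10) (Listₚ.length-downFrom (suc M′)))))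
      (trans (^-*-assoc (suc M′) 10 r) (trans (cong (suc M′ ^_) (*-comm 10 r)) (sym #seeds≡)))

-- The hash functions as expressions

hornerᵉ : ℕ → ℕ → ℕ → Expr
hornerᵉ i c zero    = imm 0
hornerᵉ i c (suc l) = bin Op.add (var (7 + (i * 10 + c))) (bin Op.mul (var 0) (hornerᵉ i (suc c) l))

topᵉ : ℕ → ℕ → Expr → Expr
topᵉ K β e = bin Op.div (bin Op.mod e (imm (2 ^ K))) (imm (2 ^ (K ∸ β)))

window : (ℕ → ℕ) → ℕ → (l : ℕ) → Vec ℕ l
window f c zero    = []
window f c (suc l) = f c ∷ window f (suc c) l

module HashValue (w : ℕ) where

  open RAM w
  open Machine w using (Word; word; ⟦_⟧)

  private instance
    W≢0 : NonZero (2 ^ w)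
    W≢0 = m^n≢0 2 w

  private
    mod-word : ∀ (x y : Word) b → toℕ y ≡ suc b → ⟦ Op.mod ⟧ x y ≡ word (toℕ x % suc b)
    mod-word x y b eq rewrite eq = refl

    div-word : ∀ (x y : Word) b → toℕ y ≡ suc b → ⟦ Op.div ⟧ x y ≡ word (toℕ x / suc b)
    div-word x y b eq rewrite eq = refl

  alu-mod : ∀ {x} y .{{_ : NonZero y}} → x < W → y < W → alu Op.mod x y ≡ x % y
  alu-mod {x} (suc y) x<W y<W = trans (cong toℕ (mod-word (word x) (word (suc y)) y (toℕ-word< y<W)))
    (trans (cong (λ z → toℕ (word (z % suc y))) (toℕ-word< x<W)) (toℕ-word< (<-trans (m%n<n x (suc y)) y<W)))

  alu-div : ∀ {x} y .{{_ : NonZero y}} → x < W → y < W → alu Op.div x y ≡ x / y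
  alu-div {x} (suc y) x<W y<W = trans (cong toℕ (div-word (word x) (word (suc y)) y (toℕ-word< y<W)))
    (trans (cong (λ z → toℕ (word (z / suc y))) (toℕ-word< x<W)) (toℕ-word< (≤-<-trans (m/n≤m x (suc y)) x<W)))

  private
    +-cong-% : ∀ {x x′ y y′} → x % W ≡ x′ % W → y % W ≡ y′ % W → (x + y) % W ≡ (x′ + y′) % W
    +-cong-% {x} {x′} {y} {y′} p q = trans (%-distribˡ-+ x y W) (trans (cong₂ (λ a b → (a + b) % W) p q) (sym (%-distribˡ-+ x′ y′ W)))
    *-cong-% : ∀ {x x′ y y′} → x % W ≡ x′ % W → y % W ≡ y′ % W → (x * y) % W ≡ (x′ * y′) % W
    *-cong-% {x} {x′} {y} {y′} p q = trans (%-distribˡ-* x y W) (trans (cong₂ (λ a b → (a * b) % W) p q) (sym (%-distribˡ-* x′ y′ W)))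
    var-% : ∀ x → alu Op.add x 0 % W ≡ x % W
    var-% x = trans (cong (_% W) (trans (alu-add-% x 0) (cong (_% W) (+-identityʳ x)))) (m%n%n≡m%n x W)

  horner-value : ∀ i f σ a → σ 0 ≡ a → ∀ l c → (∀ d → d < c + l → σ (7 + (i * 10 + d)) ≡ f d) →
    value (hornerᵉ i c l) σ ≡ eval (window f c l) a % W
  horner-value i f σ a item≡ zero    c h = alu-add-% 0 0
  horner-value i f σ a item≡ (suc l) c h = trans (alu-add-% _ _) (+-cong-%
    (trans (var-% _) (cong (_% W) (h c (≤-trans (s≤s (m≤m+n c l)) (≤-reflexive (sym (+-suc c l)))))))
    (trans (cong (_% W) (alu-mul-% _ _)) (trans (m%n%n≡m%n _ W) (*-cong-% (trans (var-% (σ 0)) (cong (_% W) item≡))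
      (trans (cong (_% W) (horner-value i f σ a item≡ l (suc c) (λ d lt → h d (≤-trans lt (≤-reflexive (sym (+-suc c l))))))) (m%n%n≡m%n _ W))))))

  top-value : ∀ K β e σ v → K < w → value e σ ≡ v % W → value (topᵉ K β e) σ ≡ top K β v
  top-value K β e σ v K<w eq = trans (cong₂ (alu Op.div) (trans (cong₂ (alu Op.mod) eq (alu-+0 M<W)) mod≡) (alu-+0 h<W))
      (alu-div (2 ^ (K ∸ β)) (<-trans (m%n<n v (2 ^ K)) M<W) h<W)
    where
    instance
      M≢0 : NonZero (2 ^ K)
      M≢0 = m^n≢0 2 K
      h≢0 : NonZero (2 ^ (K ∸ β))
      h≢0 = m^n≢0 2 (K ∸ β)
    M<W : 2 ^ K < W
    M<W = ^-monoʳ-< 2 (s≤s (s≤s z≤n)) K<w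
    h<W : 2 ^ (K ∸ β) < W
    h<W = ≤-<-trans (^-monoʳ-≤ 2 (m∸n≤m K β)) M<W
    M∣W : 2 ^ K ∣ W
    M∣W = divides (2 ^ (w ∸ K)) (trans (cong (2 ^_) (sym (m∸n+n≡m (<⇒≤ K<w)))) (^-distribˡ-+-* 2 (w ∸ K) K))
    mod≡ : alu Op.mod (v % W) (2 ^ K) ≡ v % 2 ^ K
    mod≡ = trans (alu-mod (2 ^ K) (m%n<n v W) M<W) (m∣n⇒o%n%m≡o%m (2 ^ K) W v M∣W)

  module _ (U : ℕ) (S≤W : temporaries + U ≤ 2 ^ w) where

    open Compilation U S≤W using (Vars)

    horner-vars : ∀ i → 0 < U → ∀ l c → (∀ d → d < c + l → 7 + (i * 10 + d) < U) → Vars (hornerᵉ i c l)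
    horner-vars i U>0 zero    c h = tt
    horner-vars i U>0 (suc l) c h = h c (≤-trans (s≤s (m≤m+n c l)) (≤-reflexive (sym (+-suc c l)))) , U>0 ,
      horner-vars i U>0 l (suc c) (λ d lt → h d (≤-trans lt (≤-reflexive (sym (+-suc c l)))))

-- The estimate v is within F / E of F′.
Close : ℕ → ℕ → ℕ → ℕ → Set
Close E F F′ v = Good (λ v → F′ * E ≤ v * E + F) (λ v → v * E ≤ F′ * E + F) v

Close-up : ∀ E F F′ → Up (λ v → F′ * E ≤ v * E + F)
Close-up E F F′ x≤y h = ≤-trans h (+-monoˡ-≤ F (*-monoˡ-≤ E x≤y))

Close-down : ∀ E F F′ → Down (λ v → v * E ≤ F′ * E + F)
Close-down E F F′ x≤y h = ≤-trans (*-monoˡ-≤ E x≤y) h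

deviation-close : ∀ E F F′ v d → pos v ≡ pos F′ +ᶻ d → ∣ d ∣ * E ≤ F → Close E F F′ v
deviation-close E F F′ v d eq small =
  ≤-trans (*-monoˡ-≤ E (≤-trans (≤-reflexive (cong ∣_∣ F′≡)) (ℤₚ.∣i-j∣≤∣i∣+∣j∣ (pos v) d))) (≤-trans (≤-reflexive (*-distribʳ-+ E v ∣ d ∣)) (+-monoʳ-≤ (v * E) small)) ,
  ≤-trans (*-monoˡ-≤ E (≤-trans (≤-reflexive (cong ∣_∣ eq)) (ℤₚ.∣i+j∣≤∣i∣+∣j∣ (pos F′) d))) (≤-trans (≤-reflexive (*-distribʳ-+ E F′ ∣ d ∣)) (+-monoʳ-≤ (F′ * E) small))
  where
  e : ∀ f d → f ≡ (f +ᶻ d) -ᶻ d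
  e = ℤ-Solver.solve-∀
  F′≡ : pos F′ ≡ pos v -ᶻ d
  F′≡ = trans (e (pos F′) d) (cong (_-ᶻ d) (sym eq))

history-< : ∀ {n} (as : Stream n) → All (_< n) (history as)
history-< as = go (map toℕ as) [] (Allₚ.map⁺ (All.universal Finₚ.toℕ<n as)) []
  where
  go : ∀ {n} xs ys → All (_< n) xs → All (_< n) ys → All (_< n) (xs List.ʳ++ ys)
  go []       ys _        qs = qs
  go (x ∷ xs) ys (p ∷ ps) qs = go xs (x ∷ ys) ps (p ∷ qs)

history-∷ : ∀ {n} (a : Fin n) (as : Stream n) → ∃₂ λ x p → history (a ∷ as) ≡ x ∷ p
history-∷ a as = go (map toℕ as) (toℕ a) []
  where
  go : ∀ xs y ys → ∃₂ λ x p → xs List.ʳ++ (y ∷ ys) ≡ x ∷ p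
  go []       y ys = y , ys , refl
  go (x ∷ xs) y ys = go xs x (y ∷ ys)

nonempty : ∀ {n} (as : Stream n) t → 1 ≤ t → t ≤ length as → ∃₂ λ x p → history (List.take t as) ≡ x ∷ p
nonempty (a ∷ as) (suc t) _ _ = history-∷ a (List.take t as)

F₂≡ : ∀ {n} (as : Stream n) t → F₂ as t ≡ ∑ (downFrom n) (λ i → count (history (List.take t as)) i * count (history (List.take t as)) i)
F₂≡ {n} as t = trans (‖‖²≡∑ (List.take t as)) (∑-cong (downFrom n) λ i →
  cong₂ _*_ (sym (count-history (List.take t as) i)) (sym (count-history (List.take t as) i)))

module Sketching (n u k e : ℕ) (n≤2^u : n ≤ 2 ^ u) (b≤u : 2 * e + 42 ≤ u) where

  K b M′ E : ℕ
  K = u * 8 + 1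
  b = 2 * e + 42
  M′ = 2 ^ K ∸ 1
  E = 2 ^ (e + 1)

  M≡ : suc M′ ≡ 2 ^ K
  M≡ = m+[n∸m]≡n {1} (m^n>0 2 K)

  u*7≤ : u * 7 ≤ u * 8
  u*7≤ = *-monoʳ-≤ u (n≤1+n 7)
  u≤K : u ≤ K
  u≤K = ≤-trans (m≤m*n u 8) (m≤m+n (u * 8) 1)
  7u<K : u * 7 + 1 ≤ K
  7u<K = +-monoˡ-≤ 1 u*7≤
  u+b≤K : u + b ≤ K
  u+b≤K = ≤-trans (+-monoʳ-≤ u b≤u) (≤-trans (≤-reflexive (trans (cong (u +_) (sym (+-identityʳ u))) (*-comm 2 u))) (≤-trans (*-monoʳ-≤ u (m≤m+n 2 6)) (m≤m+n (u * 8) 1)))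
  b≤K : b ≤ K
  b≤K = ≤-trans b≤u u≤K
  1≤K : 1 ≤ K
  1≤K = m≤n+m 1 (u * 8)

  hashCode : HashCode
  hashCode = record
    { hᵉ = λ i → topᵉ K b (hornerᵉ i 0 2) ; σᵉ = λ i → topᵉ K 1 (hornerᵉ i 2 8)
    ; h-height = λ i → m≤m+n 5 25 ; σ-height = λ i → m≤m+n 17 13
    ; h-cost = λ i → m≤m+n 13 47 ; σ-cost = λ i → m≤m+n 37 23 }

  open Layout k (2 ^ b) hashCode using (r; variables; coefficient<)
  open SketchAlgorithm k (2 ^ b) M′ hashCode
  open SeedCounting k (2 ^ b) M′ hashCode
  open Hashing K u u≤K using (hash; sign; sign-vanish; collision-probability) renaming (coefficients to allCoefficients)

  module _ (as : Stream n) where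

    private
      m = length as
      f : ℕ → ℕ → ℕ
      f t i = count (history (List.take t as)) i
      f-mono : ∀ {s t} → s ≤ t → ∀ i → f s i ≤ f t i
      f-mono {s} {t} le i = subst₂ _≤_ (sym (count-history (List.take s as) i)) (sym (count-history (List.take t as) i)) (count-take-mono as le i)

    private
      module Tl = Tail (allCoefficients 8) (allCoefficients 2) sign (λ x a → hash b x a) (2 ^ b) n (λ j ω → sgn² (hash 1 j ω))
        (λ j j<n ys lts len → sign-vanish 7u<K j (≤-trans (<⇒≤ j<n) n≤2^u) ys lts len)
        (λ i j i<j j<n → collision-probability b u+b≤K i j i<j (≤-trans (<⇒≤ j<n) n≤2^u)) f f-mono (λ _ → refl) m

    private
      F = F₂ as m
      F≡ : F ≡ Tl.F₂ᵐ
      F≡ = F₂≡ as m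

    bad : Vec ℕ 10 → Bool
    bad (x ∷ y ∷ ω) = Tl.bad E (x ∷ y ∷ []) ω

    bad-probability : 0 < F → ∑ (tuples 10 (downFrom (suc M′))) (λ v → 𝟙 (bad v)) * 2 ^ (2 * 16) ≤ length (tuples 10 (downFrom (suc M′)))
    bad-probability F>0 = subst (λ M → ∑ (tuples 10 (downFrom M)) (λ v → 𝟙 (bad v)) * 2 ^ (2 * 16) ≤ length (tuples 10 (downFrom M))) (sym M≡)
      (*-cancelʳ-≤ _ _ (2 ^ (2 * e + 10)) {{m^n≢0 2 (2 * e + 10)}} (begin
        ∑ (tuples 10 xs) (λ v → 𝟙 (bad v)) * 2 ^ (2 * 16) * 2 ^ (2 * e + 10)
          ≡⟨ *-assoc (∑ (tuples 10 xs) (λ v → 𝟙 (bad v))) (2 ^ (2 * 16)) (2 ^ (2 * e + 10)) ⟩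
        ∑ (tuples 10 xs) (λ v → 𝟙 (bad v)) * (2 ^ (2 * 16) * 2 ^ (2 * e + 10))
          ≡⟨ cong₂ _*_ split (trans (*-comm (2 ^ (2 * 16)) (2 ^ (2 * e + 10))) (trans (sym (^-distribˡ-+-* 2 (2 * e + 10) (2 * 16))) (cong (2 ^_) (+-assoc (2 * e) 10 (2 * 16))))) ⟩
        ∑ (tuples 2 xs) (λ a → ∑ (tuples 8 xs) (λ ω → 𝟙 (Tl.bad E a ω))) * 2 ^ b
          ≤⟨ Tl.failure-probability E (subst (0 <_) F≡ F>0) ⟩
        length (tuples 2 xs) * length (tuples 8 xs) * (E * E) * (117 * 2)
          ≡⟨ trans (*-assoc (length (tuples 2 xs) * length (tuples 8 xs)) (E * E) (117 * 2)) (cong (_* (E * E * (117 * 2))) lengths) ⟩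
        length (tuples 10 xs) * (E * E * (117 * 2))
          ≤⟨ *-monoʳ-≤ (length (tuples 10 xs)) (*-monoʳ-≤ (E * E) (m≤m+n (117 * 2) 22)) ⟩
        length (tuples 10 xs) * (E * E * 2 ^ 8)
          ≡⟨ cong (length (tuples 10 xs) *_) (trans (cong (_* 2 ^ 8) (sym (^-distribˡ-+-* 2 (e + 1) (e + 1)))) (trans (sym (^-distribˡ-+-* 2 (e + 1 + (e + 1)) 8)) (cong (2 ^_) (exponent e)))) ⟩
        length (tuples 10 xs) * 2 ^ (2 * e + 10) ∎))
      where
      open ≤-Reasoning
      xs = downFrom (2 ^ K)
      exponent : ∀ e → e + 1 + (e + 1) + 8 ≡ 2 * e + 10
      exponent = ℕ-Solver.solve-∀
      lengths : length (tuples 2 xs) * length (tuples 8 xs) ≡ length (tuples 10 xs)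
      lengths = trans (cong₂ _*_ (length-tuples 2 xs) (length-tuples 8 xs)) (trans (sym (^-distribˡ-+-* (length xs) 2 8)) (sym (length-tuples 10 xs)))
      split : ∑ (tuples 10 xs) (λ v → 𝟙 (bad v)) ≡ ∑ (tuples 2 xs) (λ a → ∑ (tuples 8 xs) (λ ω → 𝟙 (Tl.bad E a ω)))
      split = trans (trans (∑-tuples-suc 9 xs _) (∑-cong xs λ x → ∑-tuples-suc 8 xs _))
        (sym (trans (∑-tuples-suc 1 xs _) (∑-cong xs λ x → trans (∑-tuples-suc 0 xs _) (∑-cong xs λ y → +-identityʳ _))))

    module _ (w : ℕ) (S≤W : temporaries + variables ≤ 2 ^ w) (m² : suc m * suc m < 2 ^ w) (n≤W : n ≤ 2 ^ w) (K<w : K < w) where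

      open RAM w using (value)
      open Execution algorithm w
      private
        M′<W : M′ < 2 ^ w
        M′<W = ≤-trans (≤-reflexive M≡) (^-monoʳ-≤ 2 (<⇒≤ K<w))
      open Executions w S≤W m m² n n≤W M′<W

      module _ (s : Seed algorithm) where

        private
          h σ : ℕ → ℕ → ℕ
          h i x = hash b x (window (coefficient s i) 0 2)
          σ i x = hash 1 x (window (coefficient s i) 2 8)
          h<B : ∀ i x → h i x < 2 ^ b
          h<B i x = top< b≤K (eval (window (coefficient s i) 0 2) x)
          σ<2 : ∀ i x → σ i x < 2
          σ<2 i x = top< 1≤K (eval (window (coefficient s i) 2 8) x)
          in-range : ∀ {i d} → i < r → d < 10 → 7 + (i * 10 + d) < variables
          in-range i<r d<10 = +-monoʳ-< 7 (<-≤-trans (coefficient< i<r d<10) (m≤m+n (r * 10) _))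
          module S = Seeded s h σ h<B σ<2
          module Sd = S.Correct
            (λ i i<r → (HashValue.horner-vars w variables S≤W i (s≤s z≤n) 2 0 (λ d lt → in-range i<r (<-≤-trans lt (m≤m+n 2 8))) , tt) , tt)
            (λ i i<r → (HashValue.horner-vars w variables S≤W i (s≤s z≤n) 8 2 (λ d lt → in-range i<r lt) , tt) , tt)
            (λ i i<r τ a coeffs item≡ _ → HashValue.top-value w K b (hornerᵉ i 0 2) τ _ K<w (HashValue.horner-value w i (coefficient s i) τ a item≡ 2 0 (λ d lt → coeffs d (<-≤-trans lt (m≤m+n 2 8)))))
            (λ i i<r τ a coeffs item≡ _ → HashValue.top-value w K 1 (hornerᵉ i 2 8) τ _ K<w (HashValue.horner-value w i (coefficient s i) τ a item≡ 8 2 (λ d lt → coeffs d lt)))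
          module Sk (i : ℕ) = Sketch (2 ^ b) (h i) (σ i) (h<B i) (σ<2 i)

        copy-close : ∀ i → bad (coefficients s i) ≡ false → ∀ t → t ≤ m → Close E F (F₂ as t) (Sk.value i (history (List.take t as)))
        copy-close i good t t≤m = deviation-close E F (F₂ as t) (Sk.value i p) dev
            (trans (Sk.value-deviation i n p (history-< (List.take t as))) (cong (λ z → pos z +ᶻ dev) (sym (F₂≡ as t)))) (≮⇒≥ large)
          where
          p = history (List.take t as)
          dev = Tl.deviation (window (coefficient s i) 0 2) t (window (coefficient s i) 2 8)
          large : F < ∣ dev ∣ * E → ⊥
          large lt = contradiction (trans (sym good) (anyBelow⁺ (suc m) (λ t → Tl.F₂ᵐ <ᵇ ∣ Tl.deviation (window (coefficient s i) 0 2) t (window (coefficient s i) 2 8) ∣ * E) t (s≤s t≤m) (T⇒≡true (<⇒<ᵇ (subst (_< ∣ dev ∣ * E) F≡ lt))))) λ ()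

        median-close : excess (Vec.map bad (coefficientVectors s)) ≡ 0 → ∀ t → t ≤ m →
          Close E F (F₂ as t) (Sd.median-estimate (history (List.take t as)))
        median-close ex t t≤m = network-good (λ {x} {y} → Close-up E F (F₂ as t) {x} {y}) (λ {x} {y} → Close-down E F (F₂ as t) {x} {y}) k _ (Vec.map bad (coefficientVectors s))
            (λ i good → subst (Close E F (F₂ as t)) (sym (Vecₚ.lookup∘tabulate (λ i → Sk.value (toℕ i) (history (List.take t as))) i))
              (copy-close (toℕ i) (trans (cong bad (sym (Vecₚ.lookup∘tabulate (λ i → coefficients s (toℕ i)) i)))
                (trans (sym (Vecₚ.lookup-map i bad (coefficientVectors s))) good)) t t≤m))
            (few (r <ᵇ #true (Vec.map bad (coefficientVectors s)) * 16) refl ex)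
          where
          few : ∀ c → (r <ᵇ #true (Vec.map bad (coefficientVectors s)) * 16) ≡ c → 𝟙 c ≡ 0 → #true (Vec.map bad (coefficientVectors s)) * 16 ≤ r
          few false eq _ = ≮⇒≥ λ lt → subst T eq (<⇒<ᵇ lt)

        tracks : ∀ t → 1 ≤ t → t ≤ m → ∀ {ks M} → RunFromStart s (List.take t as) ks M →
          ∃ λ v → estimate M ≡ fromℕ v × (excess (Vec.map bad (coefficientVectors s)) ≡ 0 → Close E F (F₂ as t) v)
        tracks t 1≤t t≤m ran = Sd.median-estimate (history (List.take t as)) ,
            trans (cong estimate (RunFromStart-unique ran (proj₁ (proj₂ executed)))) (Sd.represented-estimate {proj₁ executed} (nonempty as t 1≤t t≤m) (proj₂ (proj₂ executed))) ,
            λ ex → median-close ex t t≤m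
          where
          executed = Sd.executes (List.take t as) (≤-trans (≤-reflexive (Listₚ.length-take t as)) (m⊓n≤n t m))

        completes : ∃ λ M → RunFromStart s as (List.replicate m time) M
        completes = proj₁ (Sd.executes as ≤-refl) , proj₁ (proj₂ (Sd.executes as ≤-refl))

-- Streams over few items are tracked exactly

module Exact (n : ℕ) where

  hashCode : HashCode
  hashCode = record
    { hᵉ = λ _ → var 0 ; σᵉ = λ _ → imm 0
    ; h-height = λ _ → m≤m+n 1 29 ; σ-height = λ _ → m≤m+n 1 29
    ; h-cost = λ _ → m≤m+n 1 59 ; σ-cost = λ _ → m≤m+n 1 59 }

  open Layout 0 (suc n) hashCode using (variables)
  open SketchAlgorithm 0 (suc n) 0 hashCode

  module _ (as : Stream n) (w : ℕ) (S≤W : temporaries + variables ≤ 2 ^ w)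
    (m² : suc (length as) * suc (length as) < 2 ^ w) (n≤W : n ≤ 2 ^ w) where

    private m = length as
    open RAM w using (alu-+0)
    open Execution algorithm w
    open Executions w S≤W m m² n n≤W (m^n>0 2 w)

    private
      h σ : ℕ → ℕ → ℕ
      h _ x = x ⊓ n
      σ _ _ = 0
      h<B : ∀ i x → h i x < suc n
      h<B _ x = s≤s (m⊓n≤n x n)
      σ<2 : ∀ i x → σ i x < 2
      σ<2 _ _ = s≤s z≤n
      module Sk = Sketch (suc n) (h 0) (σ 0) (h<B 0) (σ<2 0)

    value-exact : ∀ p → All (_< n) p → Sk.value p ≡ ∑ (downFrom n) (λ i → count p i * count p i)
    value-exact p p<n = ℤₚ.+-injective (trans (Sk.value-deviation n p p<n) (trans (cong (pos (∑ (downFrom n) (λ i → count p i * count p i)) +ᶻ_)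
        (trans (∑ᶻ-cong< n (λ j j<n → trans (cong (1ℤ *ᶻ_) (trans (∑ᶻ-cong< j (λ i i<j → no-collision i j i<j j<n)) (∑ᶻ-zero (downFrom j)))) refl))
          (∑ᶻ-zero (downFrom n)))) (ℤₚ.+-identityʳ _)))
      where
      no-collision : ∀ i j → i < j → j < n → 1ℤ *ᶻ pos (2 * (count p i * count p j) * 𝟙 (i ⊓ n ≡ᵇ j ⊓ n)) ≡ 0ℤ
      no-collision i j i<j j<n = trans (ℤₚ.*-identityˡ _) (cong pos (trans (cong (λ b → 2 * (count p i * count p j) * 𝟙 b)
        (≢⇒≡ᵇ (i ⊓ n) (j ⊓ n) (λ eq → <⇒≢ i<j (trans (sym (m≤n⇒m⊓n≡m (<⇒≤ (<-trans i<j j<n)))) (trans eq (m≤n⇒m⊓n≡m (<⇒≤ j<n)))))))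
        (*-zeroʳ (2 * (count p i * count p j)))))

    module _ (s : Seed algorithm) where

      private
        module S = Seeded s h σ h<B σ<2
        module Sd = S.Correct (λ _ _ → s≤s z≤n) (λ _ _ → tt)
          (λ _ _ τ a _ item≡ a<n → trans (cong (λ x → RAM.alu w Op.add x 0) item≡) (trans (alu-+0 (<-≤-trans a<n n≤W)) (sym (m≤n⇒m⊓n≡m (<⇒≤ a<n)))))
          (λ _ _ _ _ _ _ _ → alu-+0 (m^n>0 2 w))

      exact : ∀ t → 1 ≤ t → t ≤ m → ∀ {ks M} → RunFromStart s (List.take t as) ks M → estimate M ≡ fromℕ (F₂ as t)
      exact t 1≤t t≤m ran = trans (cong estimate (RunFromStart-unique ran (proj₁ (proj₂ executed))))
          (trans (Sd.represented-estimate {proj₁ executed} (nonempty as t 1≤t t≤m) (proj₂ (proj₂ executed)))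
            (cong fromℕ (trans (value-exact (history (List.take t as)) (history-< (List.take t as))) (sym (F₂≡ as t)))))
        where
        executed = Sd.executes (List.take t as) (≤-trans (≤-reflexive (Listₚ.length-take t as)) (m⊓n≤n t m))

      completes : ∃ λ M → RunFromStart s as (List.replicate m time) M
      completes = proj₁ (Sd.executes as ≤-refl) , proj₁ (proj₂ (Sd.executes as ≤-refl))

-- Machine words

temporaries≤100 : temporaries ≤ 100
temporaries≤100 = ≤-reflexive (cong (λ d → d * 12 + 40) depth≡5)

module LongEnough {n m w : ℕ} (long : LongWords 20 n m w) where

  private
    N = 2 ⊔ n ⊔ m
    2≤N : 2 ≤ N
    2≤N = ≤-trans (m≤m⊔n 2 n) (m≤m⊔n (2 ⊔ n) m)
    n≤N : n ≤ N
    n≤N = ≤-trans (m≤n⊔m 2 n) (m≤m⊔n (2 ⊔ n) m)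
    m≤N : m ≤ N
    m≤N = m≤n⊔m (2 ⊔ n) m
    instance
      N≢0 : NonZero N
      N≢0 = >-nonZero (≤-trans (s≤s z≤n) 2≤N)
    power< : ∀ j → j < 20 → N ^ j < 2 ^ w
    power< j j< = <-≤-trans (^-monoʳ-< N 2≤N j<) long
    double : ∀ {x} → x ≤ N → 2 * x ≤ N ^ 2
    double x≤ = ≤-trans (*-mono-≤ 2≤N x≤) (≤-reflexive (cong (N *_) (sym (*-identityʳ N))))

  m²<W : suc m * suc m < 2 ^ w
  m²<W = ≤-<-trans (≤-trans (*-mono-≤ 1+m≤ 1+m≤) (≤-reflexive (sym (^-distribˡ-+-* N 2 2)))) (power< 4 (m≤m+n 5 15))
    where
    1+m≤ : suc m ≤ N ^ 2
    1+m≤ = ≤-trans (+-mono-≤ (≤-trans (s≤s z≤n) 2≤N) m≤N) (≤-trans (≤-reflexive (cong (N +_) (sym (+-identityʳ N)))) (double ≤-refl))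

  n≤W : n ≤ 2 ^ w
  n≤W = ≤-trans n≤N (≤-trans (≤-reflexive (sym (*-identityʳ N))) (<⇒≤ (power< 1 (m≤m+n 2 18))))

  memory≤W : ∀ x → x ≤ 27 + 14 * n → temporaries + x ≤ 2 ^ w
  memory≤W x x≤ = <⇒≤ (≤-<-trans (begin
    temporaries + x             ≤⟨ +-mono-≤ temporaries≤100 x≤ ⟩
    127 + 14 * n                ≤⟨ +-mono-≤ (≤-trans (m≤m*n 127 N) (≤-reflexive (*-comm 127 N))) (≤-trans (*-monoʳ-≤ 14 n≤N) (≤-reflexive (*-comm 14 N))) ⟩
    N * 127 + N * 14            ≡⟨ *-distribˡ-+ N 127 14 ⟨
    N * 141                     ≤⟨ *-monoʳ-≤ N (≤-trans (m≤m+n 141 115) (^-monoˡ-≤ 8 2≤N)) ⟩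
    N ^ 9                       ∎) (power< 9 (m≤m+n 10 10)))
    where open ≤-Reasoning

  exponent<w : ∀ u → 2 ^ u ≤ 2 * n → u * 8 + 1 < w
  exponent<w u 2^u≤ = ≰⇒> λ w≤ → <⇒≱ (≤-<-trans (begin
    2 ^ (u * 8 + 1)         ≡⟨ trans (^-distribˡ-+-* 2 (u * 8) 1) (cong (_* 2 ^ 1) (sym (^-*-assoc 2 u 8))) ⟩
    (2 ^ u) ^ 8 * 2 ^ 1     ≤⟨ *-mono-≤ (^-monoˡ-≤ 8 (≤-trans 2^u≤ (double n≤N))) (^-monoˡ-≤ 1 2≤N) ⟩
    (N ^ 2) ^ 8 * N ^ 1     ≡⟨ trans (cong (_* N ^ 1) (^-*-assoc N 2 8)) (sym (^-distribˡ-+-* N 16 1)) ⟩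
    N ^ 17                  ∎) (power< 17 (m≤m+n 18 2))) (^-monoʳ-≤ 2 w≤)
    where open ≤-Reasoning

next-power : ∀ n → ∃ λ u → suc n ≤ 2 ^ u × 2 ^ u ≤ 2 * suc n
next-power zero = 0 , s≤s z≤n , s≤s z≤n
next-power (suc n) with next-power n
... | u , lo , hi with ≤-<-connex (2 + n) (2 ^ u)
... | inj₁ le = u , le , ≤-trans hi (*-monoʳ-≤ 2 (n≤1+n (suc n)))
... | inj₂ gt = suc u , ≤-trans (≤-trans (s≤s (m≤n+m (suc n) n)) (≤-reflexive (cong (λ x → suc n + x) (sym (+-identityʳ (suc n)))))) (*-monoʳ-≤ 2 lo) ,
    *-monoʳ-≤ 2 (<⇒≤ gt)

stmt-bound : ℕ
stmt-bound = 300 + (tree-cost-bound + 1)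

-- E is the reciprocal of the accuracy, 2⁻ʳ the failure probability.
record Tracks (A : Algorithm) (w r E : ℕ) {n} (as : Stream n) : Set where
  open Execution A w
  field
    defect    : Seed A → ℕ
    rare      : 0 < F₂ as (length as) → ∀ ss → Unique ss → All (λ s → 1 ≤ defect s) ss → length ss * 2 ^ r ≤ #seeds A
    close     : ∀ s t → 1 ≤ t → t ≤ length as → ∀ {ks M} → RunFromStart s (List.take t as) ks M →
                ∃ λ v → estimate M ≡ fromℕ v × (defect s ≡ 0 → Close E (F₂ as (length as)) (F₂ as t) v)

record Solution (n k e : ℕ) : Set where
  field
    A       : Algorithm
    ops     : ℕ
    space≤  : space A ≤ (temporaries + (27 + 2 * stmt-bound)) * (2 ^ k * 2 ^ (2 * e + 42))
    time≤   : ops ≤ 2 ^ k * stmt-bound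
    correct : ∀ (as : Stream n) w → LongWords 20 n (length as) w →
              Tracks A w (2 ^ k) (2 ^ (e + 1)) as × Execution.UpdateTime A w as ops

all-replicate : ∀ m k → All (_≤ k) (List.replicate m k)
all-replicate zero    k = []
all-replicate (suc m) k = ≤-refl ∷ all-replicate m k

space-bound : ∀ T₀ V s R c → 1 ≤ R → V + 6 ≤ 25 * R + 2 * R → s ≤ R * c → T₀ + V + (5 + (1 + 2 * s)) ≤ (T₀ + (27 + 2 * c)) * R
space-bound T₀ V s R c 1≤R hV hs = begin
  T₀ + V + (5 + (1 + 2 * s))           ≡⟨ e₁ T₀ V s ⟩
  T₀ * 1 + (V + 6) + 2 * s             ≤⟨ +-mono-≤ (+-mono-≤ (*-monoʳ-≤ T₀ 1≤R) hV) (*-monoʳ-≤ 2 hs) ⟩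
  T₀ * R + (25 * R + 2 * R) + 2 * (R * c) ≡⟨ e₂ T₀ R c ⟩
  (T₀ + (27 + 2 * c)) * R              ∎
  where
  open ≤-Reasoning
  e₁ : ∀ T V s → T + V + (5 + (1 + 2 * s)) ≡ T * 1 + (V + 6) + 2 * s
  e₁ = ℕ-Solver.solve-∀
  e₂ : ∀ T R c → T * R + (25 * R + 2 * R) + 2 * (R * c) ≡ (T + (27 + 2 * c)) * R
  e₂ = ℕ-Solver.solve-∀

exact-solution : ∀ n k e → suc n ≤ 2 ^ k * 2 ^ (2 * e + 42) → Solution n k e
exact-solution n k e small = record
  { A = algorithm ; ops = time
  ; space≤ = ≤-trans (≤-reflexive (cong (temporaries + variables +_) (cong₂ _+_ (size-toCmd {temporaries + variables} (codes (set 2 (imm 1) ∷ []))) (size-toCmd {temporaries + variables} (codes updateCode)))))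
      (space-bound temporaries variables time R stmt-bound R>0 variables≤ (≤-trans update-cost (*-monoˡ-≤ stmt-bound R>0)))
  ; time≤ = ≤-trans update-cost (*-monoˡ-≤ stmt-bound (m^n>0 2 k))
  ; correct = λ as w long → let open LongEnough {n} {length as} {w} long in
      record { defect = λ _ → 0 ; rare = λ { _ [] _ _ → z≤n ; _ (_ ∷ _) _ (() ∷ _) }
             ; close = λ s t 1≤t t≤m ran → F₂ as t , Exact.exact n as w (memory≤W variables fits) m²<W n≤W s t 1≤t t≤m ran ,
                 λ _ → m≤m+n (F₂ as t * 2 ^ (e + 1)) (F₂ as (length as)) , m≤m+n (F₂ as t * 2 ^ (e + 1)) (F₂ as (length as)) } ,
      λ s → _ , _ , proj₂ (Exact.completes n as w (memory≤W variables fits) m²<W n≤W s) , all-replicate (length as) time }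
  where
  open Exact n using (hashCode)
  open Layout 0 (suc n) hashCode using (variables; updateCode; update-cost)
  open SketchAlgorithm 0 (suc n) 0 hashCode using (algorithm; time)
  R = 2 ^ k * 2 ^ (2 * e + 42)
  R>0 : 1 ≤ R
  R>0 = *-mono-≤ (m^n>0 2 k) (m^n>0 2 (2 * e + 42))
  variables≡ : ∀ n → 7 + (1 * 10 + (1 + 1 + 1 * (suc n + suc n))) ≡ 19 + 2 * suc n
  variables≡ = ℕ-Solver.solve-∀
  variables≤ : variables + 6 ≤ 25 * R + 2 * R
  variables≤ = ≤-trans (≤-reflexive (trans (cong (_+ 6) (variables≡ n)) (trans (+-assoc 19 (2 * suc n) 6) (cong (19 +_) (+-comm (2 * suc n) 6)))))
    (+-mono-≤ (*-monoʳ-≤ 25 R>0) (*-monoʳ-≤ 2 small))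
  fits : variables ≤ 27 + 14 * n
  fits = ≤-trans (≤-reflexive (trans (variables≡ n) (e₁ n))) (+-mono-≤ (m≤m+n 21 6) (*-monoˡ-≤ n (m≤m+n 2 12)))
    where
    e₁ : ∀ n → 19 + 2 * suc n ≡ 21 + 2 * n
    e₁ = ℕ-Solver.solve-∀

sketch-solution : ∀ n k e → 2 ^ k * 2 ^ (2 * e + 42) ≤ suc n → Solution (suc n) k e
sketch-solution n′ k e big = record
  { A = algorithm ; ops = time
  ; space≤ = ≤-trans (≤-reflexive (cong (temporaries + variables +_) (cong₂ _+_ (size-toCmd {temporaries + variables} (codes (set 2 (imm 1) ∷ []))) (size-toCmd {temporaries + variables} (codes updateCode)))))
      (space-bound temporaries variables time R stmt-bound R>0 variables≤ (≤-trans update-cost (*-monoˡ-≤ stmt-bound r≤R)))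
  ; time≤ = update-cost
  ; correct = λ as w long → let open LongEnough {n} {length as} {w} long
                                S≤W = memory≤W variables fits
                                K<w = exponent<w u (proj₂ (proj₂ (next-power n′))) in
      record { defect = λ s → excess (Vec.map (bad as) (coefficientVectors s))
             ; rare = λ F>0 → bad-seeds (bad as) (bad-probability as F>0)
             ; close = λ s t 1≤t t≤m ran → tracks as w S≤W m²<W n≤W K<w s t 1≤t t≤m ran } ,
      λ s → _ , _ , proj₂ (completes as w S≤W m²<W n≤W K<w s) , all-replicate (length as) time }
  where
  n = suc n′
  R = 2 ^ k * 2 ^ (2 * e + 42)
  u = proj₁ (next-power n′)
  b≤u : 2 * e + 42 ≤ u
  b≤u = ≮⇒≥ λ lt → <⇒≱ (^-monoʳ-< 2 (s≤s (s≤s z≤n)) lt) (≤-trans (≤-trans (m≤n*m (2 ^ (2 * e + 42)) (2 ^ k) {{m^n≢0 2 k}}) big) (proj₁ (proj₂ (next-power n′))))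
  open Sketching n u k e (proj₁ (proj₂ (next-power n′))) b≤u using (hashCode; M′; bad; bad-probability; tracks; completes)
  open Layout k (2 ^ (2 * e + 42)) hashCode using (variables; updateCode; update-cost)
  open SketchAlgorithm k (2 ^ (2 * e + 42)) M′ hashCode using (algorithm; time)
  open SeedCounting k (2 ^ (2 * e + 42)) M′ hashCode using (coefficientVectors; bad-seeds)
  R>0 : 1 ≤ R
  R>0 = *-mono-≤ (m^n>0 2 k) (m^n>0 2 (2 * e + 42))
  r≤R : 2 ^ k ≤ R
  r≤R = m≤m*n (2 ^ k) (2 ^ (2 * e + 42)) {{m^n≢0 2 (2 * e + 42)}}
  variables≡ : ∀ r B → 7 + (r * 10 + (r + r + r * (B + B))) ≡ 7 + (12 * r + 2 * (r * B))
  variables≡ = ℕ-Solver.solve-∀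
  variables≤ : variables + 6 ≤ 25 * R + 2 * R
  variables≤ = ≤-trans (≤-reflexive (trans (cong (_+ 6) (variables≡ (2 ^ k) (2 ^ (2 * e + 42)))) (e₁ (2 ^ k) R)))
    (+-monoˡ-≤ (2 * R) (≤-trans (+-mono-≤ (*-monoʳ-≤ 13 R>0) (*-monoʳ-≤ 12 r≤R)) (≤-reflexive (sym (*-distribʳ-+ R 13 12)))))
    where
    e₁ : ∀ r R → 7 + (12 * r + 2 * R) + 6 ≡ 13 * 1 + 12 * r + 2 * R
    e₁ = ℕ-Solver.solve-∀
  fits : variables ≤ 27 + 14 * n
  fits = ≤-trans (≤-reflexive (variables≡ (2 ^ k) (2 ^ (2 * e + 42)))) (+-mono-≤ (m≤m+n 7 20)
    (≤-trans (+-mono-≤ (*-monoʳ-≤ 12 (≤-trans r≤R big)) (*-monoʳ-≤ 2 big)) (≤-reflexive (sym (*-distribʳ-+ n 12 2)))))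

solution : ∀ n k e → Solution n k e
solution n k e with ≤-<-connex (suc n) (2 ^ k * 2 ^ (2 * e + 42))
... | inj₁ small = exact-solution n k e small
solution zero    k e | inj₂ big = contradiction (≤-trans (*-mono-≤ (m^n>0 2 k) (m^n>0 2 (2 * e + 42))) (s≤s⁻¹ big)) λ ()
solution (suc n) k e | inj₂ big = sketch-solution n k e (s≤s⁻¹ big)

-- Rational approximations

natℚ : ℕ → ℚ
natℚ k = ℚ.mkℚ (pos k) 0 (Coprimality.sym (Coprimality.1-coprimeTo k))

fromℕ≡natℚ : ∀ k → fromℕ k ≡ natℚ k
fromℕ≡natℚ k = ℚₚ.normalize-coprime (Coprimality.sym (Coprimality.1-coprimeTo k))

<ℚ⇒≱ : ∀ {p q} → p <ℚ q → ¬ (q ≤ℚ p)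
<ℚ⇒≱ lt le = ℚₚ.<-irrefl refl (ℚₚ.<-≤-trans lt le)

fromℕ-mono-≤ : ∀ {m n} → m ≤ n → fromℕ m ≤ℚ fromℕ n
fromℕ-mono-≤ {m} {n} h = subst₂ _≤ℚ_ (sym (fromℕ≡natℚ m)) (sym (fromℕ≡natℚ n))
  (ℚ.*≤* (subst₂ _≤ᶻ_ (sym (ℤₚ.*-identityʳ (pos m))) (sym (ℤₚ.*-identityʳ (pos n))) (ℤ.+≤+ h)))

fromℕ-cancel-< : ∀ {m n} → fromℕ m <ℚ fromℕ n → m < n
fromℕ-cancel-< {m} {n} h = ≰⇒> λ n≤m → <ℚ⇒≱ h (fromℕ-mono-≤ {n} {m} n≤m)

fromℕ-mono-< : ∀ {m n} → m < n → fromℕ m <ℚ fromℕ n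
fromℕ-mono-< {m} {n} h = subst₂ _<ℚ_ (sym (fromℕ≡natℚ m)) (sym (fromℕ≡natℚ n))
  (ℚ.*<* (subst₂ ℤ._<_ (sym (ℤₚ.*-identityʳ (pos m))) (sym (ℤₚ.*-identityʳ (pos n))) (ℤ.+<+ h)))

fromℕ-* : ∀ m n → fromℕ (m * n) ≡ fromℕ m *ℚ fromℕ n
fromℕ-* m n = trans (cong (ℚ._/ 1) (ℤₚ.pos-* m n)) (sym (cong₂ _*ℚ_ (fromℕ≡natℚ m) (fromℕ≡natℚ n)))

fromℕ-+ : ∀ m n → fromℕ (m + n) ≡ fromℕ m +ℚ fromℕ n
fromℕ-+ m n = trans (cong (ℚ._/ 1) (sym (cong₂ _+ᶻ_ (ℤₚ.*-identityʳ (pos m)) (ℤₚ.*-identityʳ (pos n))))) (sym (cong₂ _+ℚ_ (fromℕ≡natℚ m) (fromℕ≡natℚ n)))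

fromℕ-nonNeg : ∀ k → ℚ.NonNegative (fromℕ k)
fromℕ-nonNeg k = ℚₚ.normalize-nonNeg k 1

fromℕ-pos : ∀ k → 0 < k → ℚ.Positive (fromℕ k)
fromℕ-pos k k>0 = ℚₚ.normalize-pos k 1 {{_}} {{>-nonZero k>0}}

2^-pos : ∀ k → ℚ.Positive (fromℕ (2 ^ k))
2^-pos k = fromℕ-pos (2 ^ k) (m^n>0 2 k)

private
  interchange : ∀ a b c d → (a *ℚ b) *ℚ (c *ℚ d) ≡ (a *ℚ c) *ℚ (b *ℚ d)
  interchange = solve 4 (λ a b c d → (a :* b) :* (c :* d) := (a :* c) :* (b :* d)) refl
    where open ℚ-Solver.+-*-Solver

abstract
  half : ℕ → ℚ
  half zero    = 1ℚ
  half (suc n) = ℚ.½ *ℚ half n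

  half-2^ : ∀ n → half n *ℚ fromℕ (2 ^ n) ≡ 1ℚ
  half-2^ zero    = refl
  half-2^ (suc n) = trans (cong (ℚ.½ *ℚ half n *ℚ_) (fromℕ-* 2 (2 ^ n))) (trans (interchange ℚ.½ (half n) (fromℕ 2) (fromℕ (2 ^ n)))
    (trans (cong (ℚ.½ *ℚ fromℕ 2 *ℚ_) (half-2^ n)) refl))

half<⇒ : ∀ n q → half n <ℚ q → 1ℚ <ℚ q *ℚ fromℕ (2 ^ n)
half<⇒ n q lt = subst (_<ℚ q *ℚ fromℕ (2 ^ n)) (half-2^ n) (ℚₚ.*-monoˡ-<-pos (fromℕ (2 ^ n)) {{2^-pos n}} lt)

⇒half< : ∀ n q → 1ℚ <ℚ q *ℚ fromℕ (2 ^ n) → half n <ℚ q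
⇒half< n q lt = ℚₚ.*-cancelʳ-<-nonNeg (fromℕ (2 ^ n)) {{fromℕ-nonNeg (2 ^ n)}} (subst (_<ℚ q *ℚ fromℕ (2 ^ n)) (sym (half-2^ n)) lt)

half-suc< : ∀ n → half (suc n) <ℚ half n
half-suc< n = ⇒half< (suc n) (half n) (subst (1ℚ <ℚ_) (sym eq) (ℚ.*<* (ℤ.+<+ (s≤s (s≤s z≤n)))))
  where
  eq : half n *ℚ fromℕ (2 * 2 ^ n) ≡ natℚ 2
  eq = trans (cong (half n *ℚ_) (trans (fromℕ-* 2 (2 ^ n)) (ℚₚ.*-comm (fromℕ 2) (fromℕ (2 ^ n)))))
    (trans (sym (ℚₚ.*-assoc (half n) (fromℕ (2 ^ n)) (fromℕ 2))) (trans (cong (_*ℚ fromℕ 2) (half-2^ n)) (trans (ℚₚ.*-identityˡ (fromℕ 2)) (fromℕ≡natℚ 2))))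

*-denominator : ∀ q p → ℚ.↥ q ≡ pos p → q *ℚ fromℕ (ℚ.↧ₙ q) ≡ fromℕ p
*-denominator q@(ℚ.mkℚ (pos p) d-1 c) p refl = trans (cong (q *ℚ_) (fromℕ≡natℚ (suc d-1))) (trans
  (ℚₚ.toℚᵘ-injective (ℚᵘₚ.≃-trans (ℚₚ.toℚᵘ-homo-* q (natℚ (suc d-1))) (ℚᵘ.*≡* (e (pos p) (pos (suc d-1)))))) (sym (fromℕ≡natℚ p)))
  where
  e : ∀ a b → a *ᶻ b *ᶻ 1ℤ ≡ a *ᶻ (b *ᶻ 1ℤ)
  e = ℤ-Solver.solve-∀

positive-numerator : ∀ q → 0ℚ <ℚ q → ∃ λ p → ℚ.↥ q ≡ pos p × 0 < p
positive-numerator (ℚ.mkℚ (pos zero)    d c) (ℚ.*<* (ℤ.+<+ ()))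
positive-numerator (ℚ.mkℚ (pos (suc p)) d c) lt = suc p , refl , s≤s z≤n
positive-numerator (ℚ.mkℚ (ℤ.-[1+_] p)  d c) (ℚ.*<* ())

n<2^n : ∀ n → n < 2 ^ n
n<2^n zero    = s≤s z≤n
n<2^n (suc n) = ≤-trans (+-mono-≤ (m^n>0 2 n) (n<2^n n)) (≤-reflexive (cong (2 ^ n +_) (sym (+-identityʳ (2 ^ n)))))

archimedean : ∀ q → 0ℚ <ℚ q → ∃ λ n → half n <ℚ q
archimedean q q>0 with positive-numerator q q>0
... | p , ↥≡ , p>0 = ℚ.↧ₙ q , ⇒half< (ℚ.↧ₙ q) q (ℚₚ.≤-<-trans
    (ℚₚ.≤-trans (fromℕ-mono-≤ {1} {p} p>0) (ℚₚ.≤-reflexive (sym (*-denominator q p ↥≡))))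
    (ℚₚ.*-monoʳ-<-pos q {{ℚ.positive q>0}} (fromℕ-mono-< {ℚ.↧ₙ q} {2 ^ ℚ.↧ₙ q} (n<2^n (ℚ.↧ₙ q)))))

lower<upper : ∀ (x : ℝ) {p q} → p <ᴿ x → x ᴿ< q → p <ℚ q
lower<upper x {p} {q} lo up = ℚₚ.≰⇒> λ q≤p → ℝ.disjoint x lo (below q≤p)
  where
  below : q ≤ℚ p → x ᴿ< p
  below q≤p with ℚₚ.<-cmp q p
  ... | tri< q<p _ _ = ℝ.upper-closed x q<p up
  ... | tri≈ _ refl _ = up
  ... | tri> _ _ p<q = contradiction q≤p (<ℚ⇒≱ p<q)

record Scale (x : ℝ) (e : ℕ) : Set where
  field
    above : half (suc e) <ᴿ x
    below : e ≡ 0 ⊎ ∃ λ e′ → e ≡ suc e′ × x ᴿ< half e′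

descend : ∀ x e → half (suc e) <ᴿ x → ∃ (Scale x)
descend x zero    lo = 0 , record { above = lo ; below = inj₁ refl }
descend x (suc e) lo = [ descend x e , (λ up → suc e , record { above = lo ; below = inj₂ (e , refl , up) }) ]′ (ℝ.located x (half-suc< e))

scale : ∀ x → 0ℚ <ᴿ x → ∃ (Scale x)
scale x x>0 = descend x n (ℝ.lower-closed x (ℚₚ.<-trans (half-suc< n) (proj₂ arch)) (proj₂ (proj₂ open′)))
  where
  open′ = ℝ.lower-open x x>0
  arch = archimedean (proj₁ open′) (proj₁ (proj₂ open′))
  n = proj₁ arch

^ℚ-mono : ∀ {p q} → 0ℚ ≤ℚ p → p ≤ℚ q → ∀ n → 0ℚ ≤ℚ p ^ℚ n × p ^ℚ n ≤ℚ q ^ℚ n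
^ℚ-mono {p} {q} p≥0 p≤q zero    = ℚ.*≤* (ℤ.+≤+ z≤n) , ℚₚ.≤-refl
^ℚ-mono {p} {q} p≥0 p≤q (suc n) with ^ℚ-mono p≥0 p≤q n
... | ≥0 , le = ℚₚ.≤-trans (ℚₚ.≤-reflexive (sym (ℚₚ.*-zeroˡ (p ^ℚ n)))) (ℚₚ.*-monoʳ-≤-nonNeg (p ^ℚ n) {{ℚ.nonNegative ≥0}} p≥0) ,
  ℚₚ.≤-trans (ℚₚ.*-monoʳ-≤-nonNeg (p ^ℚ n) {{ℚ.nonNegative ≥0}} p≤q) (ℚₚ.*-monoˡ-≤-nonNeg q {{ℚ.nonNegative (ℚₚ.≤-trans p≥0 p≤q)}} le)

half-^ : ∀ l d → half l ^ℚ d *ℚ fromℕ (2 ^ (l * d)) ≡ 1ℚ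
half-^ l zero    = cong (λ z → 1ℚ *ℚ fromℕ (2 ^ z)) (*-zeroʳ l)
half-^ l (suc d) = trans (cong (half l *ℚ half l ^ℚ d *ℚ_) (trans (cong fromℕ (trans (cong (2 ^_) (*-suc l d)) (^-distribˡ-+-* 2 l (l * d)))) (fromℕ-* (2 ^ l) (2 ^ (l * d)))))
  (trans (interchange (half l) (half l ^ℚ d) (fromℕ (2 ^ l)) (fromℕ (2 ^ (l * d)))) (trans (cong₂ _*ℚ_ (half-2^ l) (half-^ l d)) refl))

log-bound : ∀ δ l → δ ᴿ< half l → ∀ b → log₂[1/ δ ] b → fromℕ l ≤ℚ b
log-bound δ l δ<h b (b>0 , q , q>0 , q<δ , lt) with positive-numerator b b>0
... | p , ↥≡ , _ = ℚₚ.*-cancelʳ-≤-pos (fromℕ d) {{fromℕ-pos d (s≤s z≤n)}} (begin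
    fromℕ l *ℚ fromℕ d       ≡⟨ fromℕ-* l d ⟨
    fromℕ (l * d)            ≤⟨ fromℕ-mono-≤ {l * d} {p} (<⇒≤ (≰⇒> λ p≤ → <⇒≱ 2^< (^-monoʳ-≤ 2 p≤))) ⟩
    fromℕ p                  ≡⟨ *-denominator b p ↥≡ ⟨
    b *ℚ fromℕ d             ∎)
  where
  open ℚₚ.≤-Reasoning
  d = ℚ.↧ₙ b
  P = fromℕ (2 ^ p)
  h^d = half l ^ℚ d
  lt′ : 1ℚ <ℚ P *ℚ h^d
  lt′ = ℚₚ.<-≤-trans (subst (λ z → 1ℚ <ℚ fromℕ (2 ^ ∣ z ∣) *ℚ q ^ℚ d) ↥≡ lt)
    (ℚₚ.*-monoˡ-≤-nonNeg P {{fromℕ-nonNeg (2 ^ p)}} (proj₂ (^ℚ-mono (ℚₚ.<⇒≤ q>0) (ℚₚ.<⇒≤ (lower<upper δ q<δ δ<h)) d)))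
  2^< : 2 ^ (l * d) < 2 ^ p
  2^< = fromℕ-cancel-< {2 ^ (l * d)} {2 ^ p} (subst₂ _<ℚ_ (ℚₚ.*-identityˡ _) (trans (ℚₚ.*-assoc P h^d _) (trans (cong (P *ℚ_) (half-^ l d)) (ℚₚ.*-identityʳ P)))
    (ℚₚ.*-monoˡ-<-pos (fromℕ (2 ^ (l * d))) {{2^-pos (l * d)}} lt′))

square-bound : ∀ ε e → ε ᴿ< half e → ∀ a → 1ℚ <ℚ a → (ε ⁻²) a → fromℕ (2 ^ e * 2 ^ e) ≤ℚ a
square-bound ε e ε<h a 1<a (q , q>0 , q<ε , lt) = begin
  fromℕ (2 ^ e * 2 ^ e)                            ≡⟨ fromℕ-* (2 ^ e) (2 ^ e) ⟩
  P *ℚ P                                           ≡⟨ ℚₚ.*-identityˡ (P *ℚ P) ⟨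
  1ℚ *ℚ (P *ℚ P)                                   ≤⟨ ℚₚ.*-monoʳ-≤-nonNeg (P *ℚ P) {{P²≥0}} (ℚₚ.<⇒≤ lt) ⟩
  a *ℚ (q *ℚ q) *ℚ (P *ℚ P)                        ≤⟨ ℚₚ.*-monoʳ-≤-nonNeg (P *ℚ P) {{P²≥0}} (ℚₚ.*-monoˡ-≤-nonNeg a {{a≥0}} q²≤) ⟩
  a *ℚ (h *ℚ h) *ℚ (P *ℚ P)                        ≡⟨ ℚₚ.*-assoc a (h *ℚ h) (P *ℚ P) ⟩
  a *ℚ (h *ℚ h *ℚ (P *ℚ P))                        ≡⟨ cong (a *ℚ_) (trans (interchange h h P P) (cong₂ _*ℚ_ (half-2^ e) (half-2^ e))) ⟩
  a *ℚ 1ℚ                                          ≡⟨ ℚₚ.*-identityʳ a ⟩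
  a                                                ∎
  where
  open ℚₚ.≤-Reasoning
  P = fromℕ (2 ^ e)
  h = half e
  P²≥0 : ℚ.NonNegative (P *ℚ P)
  P²≥0 = subst ℚ.NonNegative (fromℕ-* (2 ^ e) (2 ^ e)) (fromℕ-nonNeg (2 ^ e * 2 ^ e))
  a≥0 : ℚ.NonNegative a
  a≥0 = ℚ.nonNegative (ℚₚ.<⇒≤ (ℚₚ.<-trans (ℚ.*<* (ℤ.+<+ (s≤s z≤n))) 1<a))
  q≤h : q ≤ℚ h
  q≤h = ℚₚ.<⇒≤ (lower<upper ε q<ε ε<h)
  q²≤ : q *ℚ q ≤ℚ h *ℚ h
  q²≤ = ℚₚ.≤-trans (ℚₚ.*-monoʳ-≤-nonNeg q {{ℚ.nonNegative (ℚₚ.<⇒≤ q>0)}} q≤h) (ℚₚ.*-monoˡ-≤-nonNeg h {{ℚ.nonNegative (ℚₚ.≤-trans (ℚₚ.<⇒≤ q>0) q≤h)}} q≤h)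

private
  *-mono-≤ℚ : ∀ {p q r s} → 0ℚ ≤ℚ r → 0ℚ ≤ℚ q → p ≤ℚ q → r ≤ℚ s → p *ℚ r ≤ℚ q *ℚ s
  *-mono-≤ℚ {q = q} {r = r} r≥0 q≥0 p≤q r≤s = ℚₚ.≤-trans (ℚₚ.*-monoʳ-≤-nonNeg r {{ℚ.nonNegative r≥0}} p≤q) (ℚₚ.*-monoˡ-≤-nonNeg q {{ℚ.nonNegative q≥0}} r≤s)

  fromℕ≥0 : ∀ k → 0ℚ ≤ℚ fromℕ k
  fromℕ≥0 k = ℚₚ.nonNegative⁻¹ (fromℕ k) {{fromℕ-nonNeg k}}

  *-≥0 : ∀ {p q} → 0ℚ ≤ℚ p → 0ℚ ≤ℚ q → 0ℚ ≤ℚ p *ℚ q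
  *-≥0 {p} {q} p≥0 q≥0 = ℚₚ.≤-trans (ℚₚ.≤-reflexive (sym (ℚₚ.*-zeroˡ q))) (ℚₚ.*-monoʳ-≤-nonNeg q {{ℚ.nonNegative q≥0}} p≥0)

  0≤1 : 0ℚ ≤ℚ 1ℚ
  0≤1 = ℚ.*≤* (ℤ.+≤+ z≤n)

fromℕ≤* : ∀ k {b} → 1ℚ <ℚ b → fromℕ k ≤ℚ fromℕ k *ℚ b
fromℕ≤* k {b} 1<b = ℚₚ.≤-trans (ℚₚ.≤-reflexive (sym (ℚₚ.*-identityʳ (fromℕ k)))) (ℚₚ.*-monoˡ-≤-nonNeg (fromℕ k) {{fromℕ-nonNeg k}} (ℚₚ.<⇒≤ 1<b))

copies-bound : ∀ {δ L} → Scale δ L → ∀ k → 2 ^ k ≤ 2 * suc L → ∀ b → max1 log₂[1/ δ ] b → fromℕ (2 ^ k) ≤ℚ fromℕ 6 *ℚ b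
copies-bound {δ} {L} sc k hk b (1<b , log) = go (Scale.below sc)
  where
  open ℚₚ.≤-Reasoning
  with-lower : ∀ l → L ≤ suc l → fromℕ l ≤ℚ b → fromℕ (2 ^ k) ≤ℚ fromℕ 6 *ℚ b
  with-lower l L≤ l≤b = begin
    fromℕ (2 ^ k)                      ≤⟨ fromℕ-mono-≤ {2 ^ k} {4 + 2 * l} (≤-trans hk (≤-trans (*-monoʳ-≤ 2 (s≤s L≤)) (≤-reflexive (e l)))) ⟩
    fromℕ (4 + 2 * l)                  ≡⟨ trans (fromℕ-+ 4 (2 * l)) (cong (fromℕ 4 +ℚ_) (fromℕ-* 2 l)) ⟩
    fromℕ 4 +ℚ fromℕ 2 *ℚ fromℕ l      ≤⟨ ℚₚ.+-mono-≤ (fromℕ≤* 4 1<b) (ℚₚ.*-monoˡ-≤-nonNeg (fromℕ 2) l≤b) ⟩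
    fromℕ 4 *ℚ b +ℚ fromℕ 2 *ℚ b       ≡⟨ ℚₚ.*-distribʳ-+ b (fromℕ 4) (fromℕ 2) ⟨
    fromℕ 6 *ℚ b                       ∎
    where
    e : ∀ l → 2 * suc (suc l) ≡ 4 + 2 * l
    e = ℕ-Solver.solve-∀
  go : L ≡ 0 ⊎ (∃ λ l → L ≡ suc l × δ ᴿ< half l) → fromℕ (2 ^ k) ≤ℚ fromℕ 6 *ℚ b
  go (inj₁ refl)            = with-lower 0 z≤n (ℚₚ.≤-trans 0≤1 (ℚₚ.<⇒≤ 1<b))
  go (inj₂ (l , refl , up)) = with-lower l ≤-refl (log-bound δ l up b log)

accuracy-bound : ∀ {ε e} → Scale ε e → ∀ a → max1 (ε ⁻²) a → fromℕ (2 ^ (2 * e)) ≤ℚ fromℕ 4 *ℚ a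
accuracy-bound {ε} {e} sc a (1<a , sq) = go (Scale.below sc)
  where
  go : e ≡ 0 ⊎ (∃ λ e′ → e ≡ suc e′ × ε ᴿ< half e′) → fromℕ (2 ^ (2 * e)) ≤ℚ fromℕ 4 *ℚ a
  go (inj₁ refl) = ℚₚ.≤-trans (fromℕ-mono-≤ {1} {4} (s≤s z≤n)) (fromℕ≤* 4 1<a)
  go (inj₂ (e′ , refl , up)) = ℚₚ.≤-trans (ℚₚ.≤-reflexive (trans (cong fromℕ pow) (fromℕ-* 4 (2 ^ e′ * 2 ^ e′))))
      (ℚₚ.*-monoˡ-≤-nonNeg (fromℕ 4) (square-bound ε e′ up a 1<a sq))
    where
    pow : 2 ^ (2 * suc e′) ≡ 4 * (2 ^ e′ * 2 ^ e′)
    pow = trans (cong (2 ^_) (*-suc 2 e′)) (trans (^-distribˡ-+-* 2 2 (2 * e′)) (cong (4 *_) (trans (cong (λ z → 2 ^ (e′ + z)) (+-identityʳ e′)) (^-distribˡ-+-* 2 e′ e′))))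

space-real : ∀ D G X Y a b c → 0ℚ ≤ℚ a → 0ℚ ≤ℚ b → fromℕ X ≤ℚ fromℕ 6 *ℚ b → fromℕ Y ≤ℚ fromℕ 4 *ℚ a → a *ℚ b ≤ℚ c →
  fromℕ (D * (X * (Y * G))) ≤ℚ fromℕ (D * (6 * (4 * G))) *ℚ c
space-real D G X Y a b c a≥0 b≥0 hX hY ab≤c = begin
  fromℕ (D * (X * (Y * G)))                          ≡⟨ expand D X Y G ⟩
  d *ℚ (fromℕ X *ℚ (fromℕ Y *ℚ g))                   ≤⟨ ℚₚ.*-monoˡ-≤-nonNeg d {{fromℕ-nonNeg D}} (*-mono-≤ℚ (*-≥0 (fromℕ≥0 Y) (fromℕ≥0 G)) (*-≥0 (fromℕ≥0 6) b≥0) hX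
                                                          (ℚₚ.*-monoʳ-≤-nonNeg g {{fromℕ-nonNeg G}} hY)) ⟩
  d *ℚ (fromℕ 6 *ℚ b *ℚ (fromℕ 4 *ℚ a *ℚ g))         ≡⟨ e d (fromℕ 6) b (fromℕ 4) a g ⟩
  d *ℚ (fromℕ 6 *ℚ (fromℕ 4 *ℚ g)) *ℚ (a *ℚ b)       ≡⟨ cong (_*ℚ (a *ℚ b)) (expand D 6 4 G) ⟨
  fromℕ (D * (6 * (4 * G))) *ℚ (a *ℚ b)              ≤⟨ ℚₚ.*-monoˡ-≤-nonNeg (fromℕ (D * (6 * (4 * G)))) {{fromℕ-nonNeg (D * (6 * (4 * G)))}} ab≤c ⟩
  fromℕ (D * (6 * (4 * G))) *ℚ c                     ∎
  where
  open ℚₚ.≤-Reasoning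
  d = fromℕ D
  g = fromℕ G
  expand : ∀ D X Y G → fromℕ (D * (X * (Y * G))) ≡ fromℕ D *ℚ (fromℕ X *ℚ (fromℕ Y *ℚ fromℕ G))
  expand D X Y G = trans (fromℕ-* D (X * (Y * G))) (cong (fromℕ D *ℚ_) (trans (fromℕ-* X (Y * G)) (cong (fromℕ X *ℚ_) (fromℕ-* Y G))))
  e : ∀ d x b y a g → d *ℚ (x *ℚ b *ℚ (y *ℚ a *ℚ g)) ≡ d *ℚ (x *ℚ (y *ℚ g)) *ℚ (a *ℚ b)
  e = solve 6 (λ d x b y a g → d :* (x :* b :* (y :* a :* g)) := d :* (x :* (y :* g)) :* (a :* b)) refl
    where open ℚ-Solver.+-*-Solver

close-distance : ∀ E F F′ v → Close E F F′ v → ℚ.∣ fromℕ v -ℚ fromℕ F′ ∣ *ℚ fromℕ E ≤ℚ fromℕ F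
close-distance E F F′ v (lo , hi) = go (ℚₚ.∣p∣≡p∨∣p∣≡-p (x -ℚ y))
  where
  x = fromℕ v
  y = fromℕ F′
  open ℚₚ.≤-Reasoning
  one-sided : ∀ a b → a * E ≤ b * E + F → (fromℕ a -ℚ fromℕ b) *ℚ fromℕ E ≤ℚ fromℕ F
  one-sided a b h = begin
    (fromℕ a -ℚ fromℕ b) *ℚ fromℕ E                          ≡⟨ e₁ (fromℕ a) (fromℕ b) (fromℕ E) ⟩
    fromℕ a *ℚ fromℕ E -ℚ fromℕ b *ℚ fromℕ E                 ≡⟨ cong (_-ℚ fromℕ b *ℚ fromℕ E) (fromℕ-* a E) ⟨
    fromℕ (a * E) -ℚ fromℕ b *ℚ fromℕ E                      ≤⟨ ℚₚ.+-monoˡ-≤ (ℚ.- (fromℕ b *ℚ fromℕ E)) (fromℕ-mono-≤ {a * E} {b * E + F} h) ⟩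
    fromℕ (b * E + F) -ℚ fromℕ b *ℚ fromℕ E                  ≡⟨ cong (_-ℚ fromℕ b *ℚ fromℕ E) (trans (fromℕ-+ (b * E) F) (cong (_+ℚ fromℕ F) (fromℕ-* b E))) ⟩
    fromℕ b *ℚ fromℕ E +ℚ fromℕ F -ℚ fromℕ b *ℚ fromℕ E      ≡⟨ e₂ (fromℕ b *ℚ fromℕ E) (fromℕ F) ⟩
    fromℕ F                                                  ∎
    where
    open ℚ-Solver.+-*-Solver
    e₁ : ∀ a b c → (a -ℚ b) *ℚ c ≡ a *ℚ c -ℚ b *ℚ c
    e₁ = solve 3 (λ a b c → (a :- b) :* c := a :* c :- b :* c) refl
    e₂ : ∀ a b → a +ℚ b -ℚ a ≡ b
    e₂ = solve 2 (λ a b → a :+ b :- a := b) refl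
  flip : ∀ x y → ℚ.- (x -ℚ y) ≡ y -ℚ x
  flip = solve 2 (λ x y → :- (x :- y) := y :- x) refl
    where open ℚ-Solver.+-*-Solver
  go : ℚ.∣ x -ℚ y ∣ ≡ x -ℚ y ⊎ ℚ.∣ x -ℚ y ∣ ≡ ℚ.- (x -ℚ y) → ℚ.∣ x -ℚ y ∣ *ℚ fromℕ E ≤ℚ fromℕ F
  go (inj₁ eq) = subst (λ z → z *ℚ fromℕ E ≤ℚ fromℕ F) (sym eq) (one-sided v F′ hi)
  go (inj₂ eq) = subst (λ z → z *ℚ fromℕ E ≤ℚ fromℕ F) (sym (trans eq (flip x y))) (one-sided F′ v lo)

F₂>0 : ∀ {n} (as : Stream n) → 1 ≤ length as → 0 < F₂ as (length as)
F₂>0 {n} (a ∷ as) _ = ≤-trans (*-mono-≤ c>0 c>0) (≤-trans (∑-term (λ i → c i * c i) (∈-downFrom (Finₚ.toℕ<n a))) (≤-reflexive (sym (F₂≡ (a ∷ as) (suc (length as))))))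
  where
  p = List.take (length as) as
  c : ℕ → ℕ
  c = count (history (a ∷ p))
  c>0 : 1 ≤ c (toℕ a)
  c>0 = ≤-trans (≤-trans (≤-reflexive (sym (cong 𝟙 (≡ᵇ-refl (toℕ a))))) (m≤m+n _ (count (map toℕ p) (toℕ a)))) (≤-reflexive (sym (count-history (a ∷ p) (toℕ a))))

tracks⇒weakTracking : ∀ {ε δ e L} → Scale ε e → Scale δ L → ∀ A w k → suc L ≤ 2 ^ k → ∀ {n} (as : Stream n) →
  Tracks A w (2 ^ k) (2 ^ (e + 1)) as → Execution.WeakTracking A w ε δ as
tracks⇒weakTracking {ε} {δ} {e} {L} scε scδ A w k L<2^k as tracks ss uniq fails (q , δ<q , lt) =
    <ℚ⇒≱ lt (begin
      fromℕ len                                     ≡⟨ ℚₚ.*-identityʳ (fromℕ len) ⟨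
      fromℕ len *ℚ 1ℚ                               ≤⟨ ℚₚ.*-monoˡ-≤-nonNeg (fromℕ len) {{fromℕ-nonNeg len}} (ℚₚ.<⇒≤ 1<qP) ⟩
      fromℕ len *ℚ (q *ℚ fromℕ P)                   ≡⟨ swap (fromℕ len) q (fromℕ P) ⟩
      q *ℚ (fromℕ len *ℚ fromℕ P)                   ≡⟨ cong (q *ℚ_) (fromℕ-* len P) ⟨
      q *ℚ fromℕ (len * P)                          ≤⟨ ℚₚ.*-monoˡ-≤-nonNeg q {{ℚ.nonNegative (ℚₚ.<⇒≤ q>0)}} (fromℕ-mono-≤ {len * P} {#seeds A} (≤-trans (*-monoʳ-≤ len (^-monoʳ-≤ 2 L<2^k)) few)) ⟩
      q *ℚ fromℕ (#seeds A)                         ∎)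
  where
  open ℚₚ.≤-Reasoning
  open Execution A w
  open Tracks tracks
  len = length ss
  P = 2 ^ suc L
  F = F₂ as (length as)
  swap : ∀ a b c → a *ℚ (b *ℚ c) ≡ b *ℚ (a *ℚ c)
  swap = solve 3 (λ a b c → a :* (b :* c) := b :* (a :* c)) refl
    where open ℚ-Solver.+-*-Solver
  1<qP : 1ℚ <ℚ q *ℚ fromℕ P
  1<qP = half<⇒ (suc L) q (lower<upper δ (Scale.above scδ) δ<q)
  positive-factor : ∀ k q → 1ℚ <ℚ q *ℚ fromℕ (2 ^ k) → 0ℚ <ℚ q
  positive-factor k q h = ℚₚ.*-cancelʳ-<-nonNeg (fromℕ (2 ^ k)) {{fromℕ-nonNeg (2 ^ k)}}
    (ℚₚ.≤-<-trans (ℚₚ.≤-reflexive (ℚₚ.*-zeroˡ (fromℕ (2 ^ k)))) (ℚₚ.≤-<-trans 0≤1 h))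
  q>0 : 0ℚ <ℚ q
  q>0 = positive-factor (suc L) q 1<qP
  far-from-close : ∀ F′ v → Close (2 ^ (e + 1)) F F′ v → ¬ (ε · F < ℚ.∣ fromℕ v -ℚ fromℕ F′ ∣)
  far-from-close F′ v close′ (p , ε<p , far) = <ℚ⇒≱ (ℚₚ.*-monoˡ-<-pos (fromℕ E) {{2^-pos (suc e)}} far) (begin
    ℚ.∣ fromℕ v -ℚ fromℕ F′ ∣ *ℚ fromℕ E     ≤⟨ close-distance E F F′ v (subst (λ z → Close (2 ^ z) F F′ v) (+-comm e 1) close′) ⟩
    fromℕ F                                  ≡⟨ ℚₚ.*-identityʳ (fromℕ F) ⟨
    fromℕ F *ℚ 1ℚ                            ≤⟨ ℚₚ.*-monoˡ-≤-nonNeg (fromℕ F) {{fromℕ-nonNeg F}} (ℚₚ.<⇒≤ (half<⇒ (suc e) p (lower<upper ε (Scale.above scε) ε<p))) ⟩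
    fromℕ F *ℚ (p *ℚ fromℕ E)                ≡⟨ trans (swap (fromℕ F) p (fromℕ E)) (sym (ℚₚ.*-assoc p (fromℕ F) (fromℕ E))) ⟩
    p *ℚ fromℕ F *ℚ fromℕ E                  ∎)
    where E = 2 ^ suc e
  Failure : Seed A → Set
  Failure s = ∃ λ t → 1 ≤ t × t ≤ length as × ∃₂ λ ks M → RunFromStart s (List.take t as) ks M ×
    ε · F < ℚ.∣ estimate M -ℚ fromℕ (F₂ as t) ∣
  defective : ∀ s → Failure s → 1 ≤ defect s
  defective s (t , 1≤t , t≤m , ks , M , ran , far) = n≢0⇒n>0 λ zero-defect →
    far-from-close (F₂ as t) (proj₁ (close s t 1≤t t≤m ran)) (proj₂ (proj₂ (close s t 1≤t t≤m ran)) zero-defect)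
      (subst (λ z → ε · F < ℚ.∣ z -ℚ fromℕ (F₂ as t) ∣) (proj₁ (proj₂ (close s t 1≤t t≤m ran))) far)
  all-few : ∀ ss → Unique ss → All Failure ss → length ss * 2 ^ (2 ^ k) ≤ #seeds A
  all-few []       _    _ = z≤n
  all-few (s ∷ ss) uniq fs@((t , 1≤t , t≤m , _) ∷ _) = rare (F₂>0 as (≤-trans 1≤t t≤m)) (s ∷ ss) uniq (All.map (λ {s} → defective s) fs)
  few : len * 2 ^ (2 ^ k) ≤ #seeds A
  few = all-few ss uniq fails

theorem1p1 : ∃₂ λ (c C : ℕ) →
    ∀ (ε δ : ℝ) → 0ℚ <ᴿ ε → 0ℚ <ᴿ δ → δ ᴿ< 1ℚ → ∀ (n : ℕ) →
    ∃₂ λ (A : Algorithm) (T : ℕ) →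
    (space A ≤ C ∙ max1 (ε ⁻²) ⊗ max1 log₂[1/ δ ]) ×
    (T ≤ C ∙ max1 log₂[1/ δ ]) ×
    (∀ (as : Stream n) (w : ℕ) → LongWords c n (length as) w →
    Execution.WeakTracking A w ε δ as × Execution.UpdateTime A w as T)
theorem1p1 = 20 , C₁ + C₂ , λ ε δ ε>0 δ>0 _ n → prove ε δ n (scale ε ε>0) (scale δ δ>0)
  where
  D G C₁ C₂ : ℕ
  D = temporaries + (27 + 2 * stmt-bound)
  G = 2 ^ 42
  C₁ = D * (6 * (4 * G))
  C₂ = stmt-bound * 6
  weaken : ∀ {x y c} → 0ℚ ≤ℚ c → x ≤ y → fromℕ x *ℚ c ≤ℚ fromℕ y *ℚ c
  weaken {x} {y} {c} c≥0 le = ℚₚ.*-monoʳ-≤-nonNeg c {{ℚ.nonNegative c≥0}} (fromℕ-mono-≤ {x} {y} le)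
  above1 : ∀ {a} → 1ℚ <ℚ a → 0ℚ ≤ℚ a
  above1 1<a = ℚₚ.≤-trans 0≤1 (ℚₚ.<⇒≤ 1<a)
  prove : ∀ ε δ n → ∃ (Scale ε) → ∃ (Scale δ) → _
  prove ε δ n (e , scε) (L , scδ) = A , ops ,
      (λ { c (a , b , (1<a , sq) , (1<b , lg) , ab≤c) → ℚₚ.≤-trans (fromℕ-mono-≤ {space A} space≤′)
          (ℚₚ.≤-trans (space-real D G (2 ^ k) (2 ^ (2 * e)) a b c (above1 1<a) (above1 1<b)
              (copies-bound scδ k 2^k≤ b (1<b , lg)) (accuracy-bound scε a (1<a , sq)) ab≤c)
            (weaken {C₁} {C₁ + C₂} (ℚₚ.≤-trans (*-≥0 (above1 1<a) (above1 1<b)) ab≤c) (m≤m+n C₁ C₂))) }) ,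
      (λ { b (1<b , lg) → ℚₚ.≤-trans (fromℕ-mono-≤ {ops} time≤′) (ℚₚ.≤-trans (time-real b (copies-bound scδ k 2^k≤ b (1<b , lg)))
            (weaken {C₂} {C₁ + C₂} (above1 1<b) (m≤n+m C₂ C₁))) }) ,
      λ as w long → tracks⇒weakTracking scε scδ A w k L<2^k as (proj₁ (correct as w long)) , proj₂ (correct as w long)
    where
    k = proj₁ (next-power L)
    L<2^k : suc L ≤ 2 ^ k
    L<2^k = proj₁ (proj₂ (next-power L))
    2^k≤ : 2 ^ k ≤ 2 * suc L
    2^k≤ = proj₂ (proj₂ (next-power L))
    open Solution (solution n k e)
    space≤′ : space A ≤ D * (2 ^ k * (2 ^ (2 * e) * G))
    space≤′ = ≤-trans space≤ (≤-reflexive (cong (λ z → D * (2 ^ k * z)) (^-distribˡ-+-* 2 (2 * e) 42)))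
    time≤′ : ops ≤ stmt-bound * 2 ^ k
    time≤′ = ≤-trans time≤ (≤-reflexive (*-comm (2 ^ k) stmt-bound))
    time-real : ∀ b → fromℕ (2 ^ k) ≤ℚ fromℕ 6 *ℚ b → fromℕ (stmt-bound * 2 ^ k) ≤ℚ fromℕ C₂ *ℚ b
    time-real b h = ℚₚ.≤-trans (ℚₚ.≤-reflexive (fromℕ-* stmt-bound (2 ^ k))) (ℚₚ.≤-trans (ℚₚ.*-monoˡ-≤-nonNeg (fromℕ stmt-bound) {{fromℕ-nonNeg stmt-bound}} h)
      (ℚₚ.≤-reflexive (trans (sym (ℚₚ.*-assoc (fromℕ stmt-bound) (fromℕ 6) b)) (cong (_*ℚ b) (sym (fromℕ-* stmt-bound 6))))))
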